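{- Suppose $n-k\ge 2$ (with $k\ge1$). Then (1) $P_{n,k}$ is an upper order ideal of $Q_{n,2}$ with $\binom{n}{k}$ minimal elements, namely the elements $(L,\{\})$ with $|L|=k$; (2) $P_{n,k}=\{\mathcal N\in Q_{n,2}: e(\mathcal N)\ge 0\}$; (3) $P_{n,k}$ is graded of height $2k$, with rank function $d(\mathcal N)$ and corank function $c(\mathcal N)$.
   Context: Matroids on $[n]$ are given by their set of bases. For $a\in[n]$, $\le_a$ is the cyclic order $a<_a a+1<_a\cdots<_a n<_a 1<_a\cdots<_a a-1$; the Grassmann necklace $(I_1,\dots,I_n)$ of a matroid has $I_a$ the lexicographically minimal basis w.r.t. $\le_a$. A positroid is the matroid of a point of a totally nonnegative Grassmannian; $Q_{n,k}$ is the poset of rank $k$ positroids on $[n]$ under inclusion; $\mathrm{env}(\mathcal M)$ is the smallest positroid containing $\mathcal M$. For a rank $k$ matroid $\mathcal M$, $\mathcal M^*=\{[n]\setminus J:J\in\mathcal M\}$ and $\mathcal M^{\downarrow2}=\{I\in\binom{[n]}{2}: I\subset J \text{ for some } J\in\mathcal M^*\}$. $P_{n,k}$ is the subposet of $Q_{n,2}$ consisting of all $\mathrm{env}(\mathcal M^{\downarrow 2})$, $\mathcal M\in Q_{n,k}$. Every rank 2 positroid on $[n]$ is described as $\mathcal N=(L,\{[a_1,b_1],\dots,[a_r,b_r]\})$: $L\subset[n]$ is the set of loops, and $[a_i,b_i]$ are pairwise disjoint cyclic intervals of $[n]$ each of rank $1$ (all non-loops in $[a_i,b_i]$ are parallel),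 where $r$ is taken minimal and each interval as small as possible (so each interval contains at least two non-loops and its endpoints are not loops); $\mathcal N=(L,\{\})$ means $r=0$. Set $S=\bigcup_i[a_i,b_i]$ and $d(\mathcal N)=2k+r-|S\setminus L|-2|L|$, $c(\mathcal N)=2k-d(\mathcal N)$, $e(\mathcal N)=r+k-|S\cup L|$.
   Formalization: Positroids are taken to be the matroids of points of the totally nonnegative Grassmannian over the rational numbers instead of the real numbers. -}

module Defs where

open import Data.Nat as ℕ using (ℕ; zero; suc; _≤ᵇ_)
open import Data.Bool using (Bool; true; false; if_then_else_; _∧_; _∨_)
open import Data.Fin as Fin using (Fin; toℕ; punchIn)
open import Data.Fin.Subset using (Subset; _∈_; _∉_; _⊆_; ∁; _∪_; _∩_; ⁅_⁆; ∣_∣; ⋃)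
open import Data.Vec using (tabulate)
open import Data.List as List using (List)
open import Data.Integer as ℤ using (ℤ; +_)
open import Data.Rational as ℚ using (ℚ; 0ℚ; 1ℚ)
open import Data.Product using (Σ; ∃; ∃-syntax; _×_; _,_; proj₁; proj₂)
open import Relation.Binary.PropositionalEquality using (_≡_; _≢_)
open import Relation.Nullary using (¬_)
open import Function.Bundles using (_⇔_)
open import Level using (0ℓ)
open import Data.Empty using (⊥)

Coll : ℕ → Set₁
Coll n = Subset n → Set

_⊆ᶜ_ : ∀ {n} → Coll n → Coll n → Set
M ⊆ᶜ N = ∀ B → M B → N B

_≐ᶜ_ : ∀ {n} → Coll n → Coll n → Set
M ≐ᶜ N = ∀ B → M B ⇔ N B

_⊂ᶜ_ : ∀ {n} → Coll n → Coll n → Set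
M ⊂ᶜ N = M ⊆ᶜ N × ¬ (N ⊆ᶜ M)

IsMatroid : ∀ {n} → Coll n → Set
IsMatroid {n} M =
  (∃[ B ] M B) ×
  (∀ B₁ B₂ → M B₁ → M B₂ → ∀ x → x ∈ B₁ → x ∉ B₂ →
     ∃[ y ] (y ∈ B₂ × y ∉ B₁ × M ((∁ ⁅ x ⁆ ∩ B₁) ∪ ⁅ y ⁆)))

sumF : ∀ {m} → (Fin m → ℚ) → ℚ
sumF {zero}  f = 0ℚ
sumF {suc m} f = f Fin.zero ℚ.+ sumF (λ j → f (Fin.suc j))

sgn : ℕ → ℚ
sgn zero    = 1ℚ
sgn (suc i) = ℚ.- sgn i

det : ∀ m → (Fin m → Fin m → ℚ) → ℚ
det zero    A = 1ℚ
det (suc m) A =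
  sumF (λ j → sgn (toℕ j) ℚ.* (A Fin.zero j ℚ.* det m (λ r c → A (Fin.suc r) (punchIn j c))))

StrictlyIncreasing : ∀ {k n} → (Fin k → Fin n) → Set
StrictlyIncreasing σ = ∀ i j → i Fin.< j → σ i Fin.< σ j

minor : ∀ {k n} → (Fin k → Fin n → ℚ) → (Fin k → Fin n) → ℚ
minor {k} A σ = det k (λ r c → A r (σ c))

ImageIs : ∀ {k n} → (Fin k → Fin n) → Subset n → Set
ImageIs σ B = ∀ x → x ∈ B ⇔ (∃[ i ] σ i ≡ x)

MatroidOf : ∀ {k n} → (Fin k → Fin n → ℚ) → Coll n
MatroidOf {k} A B = ∃[ σ ] (StrictlyIncreasing σ × ImageIs σ B × minor A σ ≢ 0ℚ)

TNN : ∀ {k n} → (Fin k → Fin n → ℚ) → Set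
TNN {k} A = ∀ σ → StrictlyIncreasing σ → 0ℚ ℚ.≤ minor A σ

-- Positroids of rank k on [n]  (the poset Q_{n,k} consists of these,
-- ordered by ⊆ᶜ).  A point of the totally nonnegative Grassmannian is
-- a k × n matrix of rank k (equivalently: its matroid is nonempty)
-- with all maximal minors ≥ 0.

IsPositroid : (n k : ℕ) → Coll n → Set
IsPositroid n k M =
  IsMatroid M ×
  (∀ B → M B → ∣ B ∣ ≡ k) ×
  ∃[ A ] (TNN {k} {n} A × (M ≐ᶜ MatroidOf A))

IsEnv : (n k : ℕ) → Coll n → Coll n → Set₁
IsEnv n k M N =
  IsPositroid n k N × (M ⊆ᶜ N) ×
  (∀ N′ → IsPositroid n k N′ → M ⊆ᶜ N′ → N ⊆ᶜ N′)

Dual : ∀ {n} → Coll n → Coll n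
Dual M J = M (∁ J)

Down2 : ∀ {n} → Coll n → Coll n
Down2 M I = ∣ I ∣ ≡ 2 × ∃[ J ] (Dual M J × I ⊆ J)

InP : (n k : ℕ) → Coll n → Set₁
InP n k N = ∃[ M ] (IsPositroid n k M × IsEnv n 2 (Down2 M) N)

inCycᵇ : ∀ {n} → Fin n → Fin n → Fin n → Bool
inCycᵇ a b x =
  if toℕ a ≤ᵇ toℕ b
  then (toℕ a ≤ᵇ toℕ x) ∧ (toℕ x ≤ᵇ toℕ b)
  else (toℕ a ≤ᵇ toℕ x) ∨ (toℕ x ≤ᵇ toℕ b)

CycInt : ∀ {n} → Fin n → Fin n → Subset n
CycInt a b = tabulate (inCycᵇ a b)

-- Descriptions N = (L, {[a_1,b_1], ..., [a_r,b_r]}) of a rank 2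
-- positroid N: L is the set of loops, the intervals are pairwise
-- disjoint, each has non-loop endpoints and at least two non-loops,
-- and N consists exactly of the pairs {x,y} of distinct non-loops not
-- lying in a common interval (so the non-loops of each interval are
-- parallel, i.e. each interval has rank 1).

record Description {n : ℕ} (N : Coll n) : Set where
  field
    L   : Subset n
    r   : ℕ
    a b : Fin r → Fin n
    loops     : ∀ x → x ∈ L ⇔ (∀ B → N B → x ∉ B)
    disjoint  : ∀ i j x → x ∈ CycInt (a i) (b i) → x ∈ CycInt (a j) (b j) → i ≡ j
    endpoints : ∀ i → (a i ∉ L) × (b i ∉ L)
    twoNonLoops : ∀ i → ∃[ x ] ∃[ y ] (x ≢ y × x ∈ CycInt (a i) (b i) × y ∈ CycInt (a i) (b i)
                                        × x ∉ L × y ∉ L)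
    describes : ∀ B → N B ⇔
      (∃[ x ] ∃[ y ] (x ≢ y × B ≡ ⁅ x ⁆ ∪ ⁅ y ⁆ × x ∉ L × y ∉ L ×
         ¬ (∃[ i ] (x ∈ CycInt (a i) (b i) × y ∈ CycInt (a i) (b i)))))

module _ {n : ℕ} {N : Coll n} (D : Description N) where
  open Description D

  Sᴰ : Subset n
  Sᴰ = ⋃ (List.tabulate (λ i → CycInt (a i) (b i)))

  dᴰ : ℕ → ℤ
  dᴰ k = + (2 ℕ.* k) ℤ.+ + r ℤ.- + ∣ Sᴰ ∩ ∁ L ∣ ℤ.- + (2 ℕ.* ∣ L ∣)

  cᴰ : ℕ → ℤ
  cᴰ k = + (2 ℕ.* k) ℤ.- dᴰ k

  eᴰ : ℕ → ℤ
  eᴰ k = + r ℤ.+ + k ℤ.- + ∣ Sᴰ ∪ L ∣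

NoIntervals : ∀ {n} → Subset n → Coll n
NoIntervals L B = ∣ B ∣ ≡ 2 × (∀ x → x ∈ B → x ∉ L)

MinimalInP : (n k : ℕ) → Coll n → Set₁
MinimalInP n k N = InP n k N × (∀ N′ → InP n k N′ → N′ ⊆ᶜ N → N ⊆ᶜ N′)

MaximalInP : (n k : ℕ) → Coll n → Set₁
MaximalInP n k N = InP n k N × (∀ N′ → InP n k N′ → N ⊆ᶜ N′ → N′ ⊆ᶜ N)

CoversInP : (n k : ℕ) → Coll n → Coll n → Set₁
CoversInP n k N N′ =
  InP n k N × InP n k N′ × N ⊂ᶜ N′ ×
  (∀ N″ → InP n k N″ → N ⊂ᶜ N″ → N″ ⊂ᶜ N′ → ⊥)

{-# OPTIONS --safe #-}
module Submission where

-- Write p for the number of parallel classes of a rank 2 positroid N and L for its set of loops.  Then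
-- e(N) = p − (n − k) and d(N) = 2k − n + p − |L|.  If N lies in P_{n,k}, the complement of a basis of the
-- rank k positroid is a set of n − k pairwise independent elements of N, so p ≥ n − k.  Conversely, given
-- such a set J, a rank k positroid M with M^{↓2} = N is built by adding the elements outside J one at a
-- time: an element x is placed, in the dual, on the flat spanned by its cyclic neighbours (loops are added
-- last).  In terms of matrices this adds a row supported on x and its neighbours, and every Laplace term of
-- a maximal minor along that row is zero or a maximal minor of the old matrix.  Going down a cover of
-- P_{n,k} either turns an element of a nontrivial parallel class into a loop or merges two adjacent
-- classes; both lower p − |L| by one.

open import Defs
open import Data.Nat as ℕ using (ℕ; zero; suc; _+_; _*_; _∸_; _≤_; _<_; z≤n; s≤s)
import Data.Nat.Properties as ℕ
open import Data.Nat.Solver using () renaming (module +-*-Solver to ℕ-Solver)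
open import Data.Integer as ℤ using (ℤ; +_)
import Data.Integer.Properties as ℤ
import Data.Integer.Solver as ℤ
open import Data.Rational as ℚ using (ℚ; 0ℚ; 1ℚ)
import Data.Rational.Properties as ℚ
open import Data.Rational.Solver using (module +-*-Solver)
open import Data.Bool using (true; false; if_then_else_)
import Data.Bool.Properties as Bool
open import Data.Fin as Fin using (Fin; toℕ; punchIn; punchOut)
import Data.Fin.Properties as Fin
open import Data.Fin.Subset using (Subset; inside; outside; _∈_; _∉_; _⊆_; ∁; _∪_; _∩_; ⁅_⁆; ∣_∣; ⋃)
open import Data.Fin.Subset.Properties as Subset using (_∈?_; x∈⁅x⁆; x∈⁅y⁆⇒x≡y; x∈p∪q⁺; x∈p∪q⁻; x∈p∩q⁺; x∈p∩q⁻;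
  ⊆-antisym; x∈∁p⇒x∉p; x∉p⇒x∈∁p; p⊆q⇒∣p∣≤∣q∣; drop-there)
import Data.List as List
open import Data.Vec using (_∷_; []; tabulate; insertAt; here; there)
open import Data.Vec.Properties using (lookup∘tabulate; []=⇒lookup; lookup⇒[]=; insertAt-lookup; insertAt-punchIn)
open import Data.Product as Product using (Σ; ∃; ∃-syntax; _×_; _,_; proj₁; proj₂)
open import Data.Sum as Sum using (_⊎_; inj₁; inj₂)
open import Data.Empty using (⊥-elim)
open import Relation.Nullary using (¬_; Dec; yes; no; does; ¬?)
open import Relation.Nullary.Decidable using (dec-true; dec-false; decidable-stable; map′; _×-dec_)
open import Relation.Binary.Definitions using (Tri; tri<; tri≈; tri>)
open import Relation.Binary.PropositionalEquality hiding (J)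
open import Function using (_∘_; _⇔_; mk⇔; Equivalence)

-- Determinants

-- Membership in P_{n,k} is governed by a clique J of n - k pairwise independent elements. Cliques
-- survive enlarging N, so upward closure is immediate, and a cover in P_{n,k} is a cover among all
-- rank 2 positroids.
--
-- The obstacle in the lift is the signs. The new row has to give every Laplace term the sign of an
-- old minor, which is arranged for x and its two cyclic neighbours. That these span the right flat
-- follows from noncrossing: if x is parallel to neither neighbour, the independent pair in J forces
-- the neighbours to be independent and x to be alone in its class. A neighbour that is a loop would
-- say nothing about the class of x, hence loops come last.
--
-- The number p enters as the size of a set of representatives, which is shown to be the largest
-- size of a clique of nonloops. The values of p for two positroids are then compared by carrying
-- cliques from one to the other.
--
-- In a cover N below N′ one exhibits a positroid M between them, properly below N′, so that M must
-- be N. Either one element of N′ is made a loop, or one class of N′ is moved onto the line of the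
-- class before it; both are explicit changes of vectors in the plane.

sumF-cong : ∀ {m} {f g : Fin m → ℚ} → (∀ j → f j ≡ g j) → sumF f ≡ sumF g
sumF-cong {zero}  eq = refl
sumF-cong {suc m} eq = cong₂ ℚ._+_ (eq Fin.zero) (sumF-cong (eq ∘ Fin.suc))

sumF-zero : ∀ {m} {f : Fin m → ℚ} → (∀ j → f j ≡ 0ℚ) → sumF f ≡ 0ℚ
sumF-zero {zero}  eq = refl
sumF-zero {suc m} eq = trans (cong₂ ℚ._+_ (eq Fin.zero) (sumF-zero (eq ∘ Fin.suc))) (ℚ.+-identityʳ 0ℚ)

sumF-distribˡ : ∀ {m} c (f : Fin m → ℚ) → sumF (λ j → c ℚ.* f j) ≡ c ℚ.* sumF f
sumF-distribˡ {zero}  c f = sym (ℚ.*-zeroʳ c)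
sumF-distribˡ {suc m} c f =
  trans (cong (c ℚ.* f Fin.zero ℚ.+_) (sumF-distribˡ c (f ∘ Fin.suc)))
        (sym (ℚ.*-distribˡ-+ c (f Fin.zero) (sumF (f ∘ Fin.suc))))

sumF-nonneg : ∀ {m} {f : Fin m → ℚ} → (∀ j → 0ℚ ℚ.≤ f j) → 0ℚ ℚ.≤ sumF f
sumF-nonneg {zero}  pos = ℚ.≤-refl
sumF-nonneg {suc m} {f} pos =
  subst (ℚ._≤ sumF f) (ℚ.+-identityʳ 0ℚ) (ℚ.+-mono-≤ (pos Fin.zero) (sumF-nonneg (pos ∘ Fin.suc)))

sumF≢0⇒∃≢0 : ∀ {m} (f : Fin m → ℚ) → sumF f ≢ 0ℚ → ∃[ j ] f j ≢ 0ℚ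
sumF≢0⇒∃≢0 {zero}  f ≢0 = ⊥-elim (≢0 refl)
sumF≢0⇒∃≢0 {suc m} f ≢0 with f Fin.zero ℚ.≟ 0ℚ
... | no  f0≢0 = Fin.zero , f0≢0
... | yes f0≡0 with sumF≢0⇒∃≢0 (f ∘ Fin.suc)
                      (λ rest≡0 → ≢0 (trans (cong₂ ℚ._+_ f0≡0 rest≡0) (ℚ.+-identityʳ 0ℚ)))
...   | j , fj≢0 = Fin.suc j , fj≢0

nonneg-+≡0ˡ : ∀ {p q} → 0ℚ ℚ.≤ p → 0ℚ ℚ.≤ q → p ℚ.+ q ≡ 0ℚ → p ≡ 0ℚ
nonneg-+≡0ˡ {p} {q} 0≤p 0≤q p+q≡0 = ℚ.≤-antisym p≤0 0≤p
  where
  p≤0 : p ℚ.≤ 0ℚ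
  p≤0 = subst₂ ℚ._≤_ (ℚ.+-identityʳ p) p+q≡0 (ℚ.+-monoʳ-≤ p 0≤q)

nonneg-+≡0ʳ : ∀ {p q} → 0ℚ ℚ.≤ p → 0ℚ ℚ.≤ q → p ℚ.+ q ≡ 0ℚ → q ≡ 0ℚ
nonneg-+≡0ʳ {p} {q} 0≤p 0≤q p+q≡0 = nonneg-+≡0ˡ 0≤q 0≤p (trans (ℚ.+-comm q p) p+q≡0)

nonneg-sumF≢0 : ∀ {m} {f : Fin m → ℚ} → (∀ j → 0ℚ ℚ.≤ f j) → ∀ j → f j ≢ 0ℚ → sumF f ≢ 0ℚ
nonneg-sumF≢0 pos Fin.zero    fj≢0 sum≡0 =
  fj≢0 (nonneg-+≡0ˡ (pos Fin.zero) (sumF-nonneg (pos ∘ Fin.suc)) sum≡0)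
nonneg-sumF≢0 pos (Fin.suc j) fj≢0 sum≡0 =
  nonneg-sumF≢0 (pos ∘ Fin.suc) j fj≢0 (nonneg-+≡0ʳ (pos Fin.zero) (sumF-nonneg (pos ∘ Fin.suc)) sum≡0)

prodF : ∀ {m} → (Fin m → ℚ) → ℚ
prodF {zero}  s = 1ℚ
prodF {suc m} s = s Fin.zero ℚ.* prodF (s ∘ Fin.suc)

prodF-punchIn : ∀ {m} (s : Fin (suc m) → ℚ) j → prodF s ≡ s j ℚ.* prodF (s ∘ punchIn j)
prodF-punchIn s Fin.zero = refl
prodF-punchIn {suc m} s (Fin.suc j) = begin
  s₀ ℚ.* prodF (s ∘ Fin.suc)        ≡⟨ cong (s₀ ℚ.*_) (prodF-punchIn (s ∘ Fin.suc) j) ⟩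
  s₀ ℚ.* (sⱼ ℚ.* rest)              ≡⟨ solve 3 (λ a b c → a :* (b :* c) := b :* (a :* c)) refl s₀ sⱼ rest ⟩
  sⱼ ℚ.* (s₀ ℚ.* rest)              ∎
  where
  open ≡-Reasoning
  open +-*-Solver
  s₀ = s Fin.zero
  sⱼ = s (Fin.suc j)
  rest = prodF (s ∘ Fin.suc ∘ punchIn j)

det-cong : ∀ m {A B : Fin m → Fin m → ℚ} → (∀ r c → A r c ≡ B r c) → det m A ≡ det m B
det-cong zero    eq = refl
det-cong (suc m) eq = sumF-cong λ j →
  cong (sgn (toℕ j) ℚ.*_) (cong₂ ℚ._*_ (eq Fin.zero j) (det-cong m (λ r c → eq (Fin.suc r) (punchIn j c))))

det-zero-column : ∀ m {A : Fin m → Fin m → ℚ} c → (∀ r → A r c ≡ 0ℚ) → det m A ≡ 0ℚ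
det-zero-column (suc m) {A} c zeros = sumF-zero term≡0
  where
  term≡0 : ∀ j → sgn (toℕ j) ℚ.* (A Fin.zero j ℚ.* det m (λ r c → A (Fin.suc r) (punchIn j c))) ≡ 0ℚ
  term≡0 j with j Fin.≟ c
  ... | yes refl = trans (cong (sgn (toℕ j) ℚ.*_) (trans (cong (ℚ._* subdet) (zeros Fin.zero)) (ℚ.*-zeroˡ subdet)))
                         (ℚ.*-zeroʳ (sgn (toℕ j)))
    where subdet = det m (λ r c → A (Fin.suc r) (punchIn j c))
  ... | no j≢c = trans (cong (sgn (toℕ j) ℚ.*_) (trans (cong (A Fin.zero j ℚ.*_) minor≡0) (ℚ.*-zeroʳ (A Fin.zero j))))
                       (ℚ.*-zeroʳ (sgn (toℕ j)))
    where
    minor≡0 : det m (λ r c → A (Fin.suc r) (punchIn j c)) ≡ 0ℚ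
    minor≡0 = det-zero-column m (punchOut j≢c)
      (λ r → trans (cong (A (Fin.suc r)) (Fin.punchIn-punchOut j≢c)) (zeros (Fin.suc r)))

-- Used with the signs `side p`, to turn minors of the sign-changed old rows into minors of the old
-- matrix.
det-scale-columns : ∀ m (s : Fin m → ℚ) (A : Fin m → Fin m → ℚ) →
  det m (λ r c → s c ℚ.* A r c) ≡ prodF s ℚ.* det m A
det-scale-columns zero    s A = refl
det-scale-columns (suc m) s A = trans (sumF-cong term) (sumF-distribˡ (prodF s) (λ j → sgn (toℕ j) ℚ.* (A Fin.zero j ℚ.* sub j)))
  where
  open ≡-Reasoning
  open +-*-Solver
  sub : Fin (suc m) → ℚ
  sub j = det m (λ r c → A (Fin.suc r) (punchIn j c))
  term : ∀ j → sgn (toℕ j) ℚ.* ((s j ℚ.* A Fin.zero j) ℚ.* det m (λ r c → s (punchIn j c) ℚ.* A (Fin.suc r) (punchIn j c)))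
             ≡ prodF s ℚ.* (sgn (toℕ j) ℚ.* (A Fin.zero j ℚ.* sub j))
  term j = begin
    g ℚ.* ((sⱼ ℚ.* a) ℚ.* det m (λ r c → s (punchIn j c) ℚ.* A (Fin.suc r) (punchIn j c)))
      ≡⟨ cong (λ t → g ℚ.* ((sⱼ ℚ.* a) ℚ.* t)) (det-scale-columns m (s ∘ punchIn j) (λ r c → A (Fin.suc r) (punchIn j c))) ⟩
    g ℚ.* ((sⱼ ℚ.* a) ℚ.* (p ℚ.* d))
      ≡⟨ solve 5 (λ g s a p d → g :* ((s :* a) :* (p :* d)) := (s :* p) :* (g :* (a :* d))) refl g sⱼ a p d ⟩
    (sⱼ ℚ.* p) ℚ.* (g ℚ.* (a ℚ.* d))
      ≡⟨ cong (ℚ._* (g ℚ.* (a ℚ.* d))) (sym (prodF-punchIn s j)) ⟩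
    prodF s ℚ.* (g ℚ.* (a ℚ.* d)) ∎
    where
    g = sgn (toℕ j)
    sⱼ = s j
    a = A Fin.zero j
    p = prodF (s ∘ punchIn j)
    d = sub j

prodF-ones : ∀ {m} {s : Fin m → ℚ} → (∀ i → s i ≡ 1ℚ) → prodF s ≡ 1ℚ
prodF-ones {zero}  ones = refl
prodF-ones {suc m} ones = cong₂ ℚ._*_ (ones Fin.zero) (prodF-ones (ones ∘ Fin.suc))

sgn-square : ∀ i → sgn i ℚ.* sgn i ≡ 1ℚ
sgn-square zero    = refl
sgn-square (suc i) = trans (solve 1 (λ x → :- x :* :- x := x :* x) refl (sgn i)) (sgn-square i)
  where open +-*-Solver

prodF-signs : ∀ {m} {s : Fin m → ℚ} j → j ≤ m →
  (∀ i → toℕ i < j → s i ≡ ℚ.- 1ℚ) → (∀ i → j ≤ toℕ i → s i ≡ 1ℚ) → prodF s ≡ sgn j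
prodF-signs zero _ neg pos = prodF-ones (λ i → pos i z≤n)
prodF-signs {suc m} (suc j) (s≤s j≤m) neg pos =
  trans (cong₂ ℚ._*_ (neg Fin.zero (s≤s z≤n))
           (prodF-signs j j≤m (λ i i<j → neg (Fin.suc i) (s≤s i<j)) (λ i j≤i → pos (Fin.suc i) (s≤s j≤i))))
        (solve 1 (λ x → :- con 1ℚ :* x := :- x) refl (sgn j))
  where open +-*-Solver

-- Finite subsets

select : ∀ {n} {P : Fin n → Set} → (∀ x → Dec (P x)) → Subset n
select P? = tabulate (does ∘ P?)

∈select⁺ : ∀ {n} {P : Fin n → Set} (P? : ∀ x → Dec (P x)) {x} → P x → x ∈ select P?
∈select⁺ P? {x} px = lookup⇒[]= x _ (trans (lookup∘tabulate (does ∘ P?) x) (dec-true (P? x) px))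

∈select⁻ : ∀ {n} {P : Fin n → Set} (P? : ∀ x → Dec (P x)) {x} → x ∈ select P? → P x
∈select⁻ P? {x} x∈ with P? x | trans (sym (lookup∘tabulate (does ∘ P?) x)) ([]=⇒lookup x∈)
... | yes px | _ = px
... | no  _  | ()

increasing-injective : ∀ {k n} {σ : Fin k → Fin n} → StrictlyIncreasing σ → ∀ {i j} → σ i ≡ σ j → i ≡ j
increasing-injective inc {i} {j} eq with Fin.<-cmp i j
... | tri< i<j _ _ = ⊥-elim (Fin.<-irrefl eq (inc i j i<j))
... | tri≈ _ i≡j _ = i≡j
... | tri> _ _ j<i = ⊥-elim (Fin.<-irrefl (sym eq) (inc j i j<i))

enumerate : ∀ {n} (B : Subset n) → ∃[ σ ] StrictlyIncreasing {∣ B ∣} {n} σ × ImageIs σ B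
enumerate [] = (λ ()) , (λ ()) , (λ ())
enumerate (outside ∷ B) with enumerate B
... | σ , inc , im = Fin.suc ∘ σ , (λ i j i<j → s≤s (inc i j i<j)) , image
  where
  image : ImageIs (Fin.suc ∘ σ) (outside ∷ B)
  image Fin.zero    = mk⇔ (λ ()) (λ { (_ , ()) })
  image (Fin.suc x) = mk⇔
    (λ x∈ → let i , eq = Equivalence.to (im x) (drop-there x∈) in i , cong Fin.suc eq)
    (λ { (i , refl) → there (Equivalence.from (im x) (i , refl)) })
enumerate (inside ∷ B) with enumerate B
... | σ , inc , im = σ⁺ , inc⁺ , image
  where
  σ⁺ : Fin (suc ∣ B ∣) → Fin _
  σ⁺ Fin.zero    = Fin.zero
  σ⁺ (Fin.suc i) = Fin.suc (σ i)
  inc⁺ : StrictlyIncreasing σ⁺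
  inc⁺ Fin.zero    (Fin.suc j) _         = s≤s z≤n
  inc⁺ (Fin.suc i) (Fin.suc j) (s≤s i<j) = s≤s (inc i j i<j)
  image : ImageIs σ⁺ (inside ∷ B)
  image Fin.zero    = mk⇔ (λ _ → Fin.zero , refl) (λ _ → here)
  image (Fin.suc x) = mk⇔
    (λ x∈ → let i , eq = Equivalence.to (im x) (drop-there x∈) in Fin.suc i , cong Fin.suc eq)
    (λ { (Fin.suc i , refl) → there (Equivalence.from (im x) (i , refl)) })

-- Bound |X| by |Y| through a relation, so that no choice function has to be built from an image.
card-≤ : ∀ {n m} (X : Subset n) (Y : Subset m) (R : Fin n → Fin m → Set) →
  (∀ x → x ∈ X → ∃[ y ] y ∈ Y × R x y) →
  (∀ {x x′ y} → x ∈ X → x′ ∈ X → R x y → R x′ y → x ≡ x′) → ∣ X ∣ ≤ ∣ Y ∣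
card-≤ X Y R total inj with enumerate X | enumerate Y
... | σ , incσ , imσ | τ , incτ , imτ = Fin.injective⇒≤ {f = f} f-injective
  where
  σ∈ : ∀ i → σ i ∈ X
  σ∈ i = Equivalence.from (imσ (σ i)) (i , refl)
  image : ∀ i → ∃[ j ] R (σ i) (τ j)
  image i with total (σ i) (σ∈ i)
  ... | y , y∈ , r with Equivalence.to (imτ y) y∈
  ...   | j , refl = j , r
  f : Fin ∣ X ∣ → Fin ∣ Y ∣
  f = proj₁ ∘ image
  f-injective : ∀ {i j} → f i ≡ f j → i ≡ j
  f-injective {i} {j} eq = increasing-injective incσ
    (inj (σ∈ i) (σ∈ j) (proj₂ (image i)) (subst (R (σ j) ∘ τ) (sym eq) (proj₂ (image j))))

image-card : ∀ {k n} {σ : Fin k → Fin n} {B : Subset n} →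
  (∀ {i j} → σ i ≡ σ j → i ≡ j) → ImageIs σ B → ∣ B ∣ ≡ k
image-card {k} {n} {σ} {B} injective im = ℕ.≤-antisym upper lower
  where
  upper : ∣ B ∣ ≤ k
  upper = subst (∣ B ∣ ≤_) (Subset.∣⊤∣≡n k) (card-≤ B Data.Fin.Subset.⊤ (λ x i → σ i ≡ x)
    (λ x x∈ → let i , eq = Equivalence.to (im x) x∈ in i , Subset.∈⊤ , eq)
    (λ _ _ eq eq′ → trans (sym eq) eq′))
  lower : k ≤ ∣ B ∣
  lower = subst (_≤ ∣ B ∣) (Subset.∣⊤∣≡n k) (card-≤ Data.Fin.Subset.⊤ B (λ i x → σ i ≡ x)
    (λ i _ → σ i , Equivalence.from (im (σ i)) (i , refl) , refl)
    (λ _ _ eq eq′ → injective (trans eq (sym eq′))))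

∣∪∣-disjoint : ∀ {n} (X Y : Subset n) → (∀ {x} → x ∈ X → x ∉ Y) → ∣ X ∪ Y ∣ ≡ ∣ X ∣ + ∣ Y ∣
∣∪∣-disjoint [] [] disj = refl
∣∪∣-disjoint (outside ∷ X) (outside ∷ Y) disj = ∣∪∣-disjoint X Y (λ p q → disj (there p) (there q))
∣∪∣-disjoint (outside ∷ X) (inside  ∷ Y) disj =
  trans (cong suc (∣∪∣-disjoint X Y (λ p q → disj (there p) (there q)))) (sym (ℕ.+-suc ∣ X ∣ ∣ Y ∣))
∣∪∣-disjoint (inside  ∷ X) (outside ∷ Y) disj = cong suc (∣∪∣-disjoint X Y (λ p q → disj (there p) (there q)))
∣∪∣-disjoint (inside  ∷ X) (inside  ∷ Y) disj = ⊥-elim (disj here here)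

∣∁∣+∣∣≡n : ∀ {n} (X : Subset n) → ∣ ∁ X ∣ + ∣ X ∣ ≡ n
∣∁∣+∣∣≡n {n} X = trans (cong (_+ ∣ X ∣) (Subset.∣∁p∣≡n∸∣p∣ X)) (ℕ.m∸n+n≡m (Subset.∣p∣≤n X))

∪⁅⁆-card : ∀ {n} (X : Subset n) y → y ∉ X → ∣ X ∪ ⁅ y ⁆ ∣ ≡ suc ∣ X ∣
∪⁅⁆-card X y y∉X = trans (∣∪∣-disjoint X ⁅ y ⁆ disj)
  (trans (cong (λ m → ∣ X ∣ + m) (Subset.∣⁅x⁆∣≡1 y)) (ℕ.+-comm ∣ X ∣ 1))
  where
  disj : ∀ {x} → x ∈ X → x ∉ ⁅ y ⁆
  disj x∈X x∈y rewrite x∈⁅y⁆⇒x≡y y x∈y = y∉X x∈X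

subset-of-size : ∀ {n} (X : Subset n) m → m ≤ ∣ X ∣ → ∃[ Y ] Y ⊆ X × ∣ Y ∣ ≡ m
subset-of-size {n} X zero m≤ = Data.Fin.Subset.⊥ , Subset.⊆-min X , Subset.∣⊥∣≡0 n
subset-of-size (outside ∷ X) m@(suc _) m≤ with subset-of-size X m m≤
... | Y , Y⊆X , eq = outside ∷ Y , Subset.s⊆s Y⊆X , eq
subset-of-size (inside ∷ X) (suc m) (s≤s m≤) with subset-of-size X m m≤
... | Y , Y⊆X , eq = inside ∷ Y , Subset.s⊆s Y⊆X , cong suc eq

two-elements : ∀ {n} (X : Subset n) → 2 ≤ ∣ X ∣ → ∃[ x ] ∃[ y ] x ∈ X × y ∈ X × x ≢ y
two-elements X 2≤ with ∣ X ∣ | enumerate X | 2≤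
... | suc (suc _) | σ , inc , im | _ =
  σ Fin.zero , σ (Fin.suc Fin.zero) ,
  Equivalence.from (im _) (_ , refl) , Equivalence.from (im _) (_ , refl) ,
  λ eq → Fin.0≢1+n (increasing-injective inc eq)
... | suc zero | _ | s≤s ()

other-element : ∀ {n} {X : Subset n} → 2 ≤ ∣ X ∣ → ∀ z → ∃[ t ] t ∈ X × z ≢ t
other-element {X = X} 2≤ z with two-elements X 2≤
... | s , t , s∈ , t∈ , s≢t with z Fin.≟ s
...   | no z≢s   = s , s∈ , z≢s
...   | yes refl = t , t∈ , s≢t

pair : ∀ {n} → Fin n → Fin n → Subset n
pair x y = ⁅ x ⁆ ∪ ⁅ y ⁆

∈pair⁻ : ∀ {n} {x y z : Fin n} → z ∈ pair x y → z ≡ x ⊎ z ≡ y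
∈pair⁻ {x = x} {y} z∈ with x∈p∪q⁻ ⁅ x ⁆ ⁅ y ⁆ z∈
... | inj₁ z∈x = inj₁ (x∈⁅y⁆⇒x≡y x z∈x)
... | inj₂ z∈y = inj₂ (x∈⁅y⁆⇒x≡y y z∈y)

∈pairˡ : ∀ {n} {x y : Fin n} → x ∈ pair x y
∈pairˡ {x = x} = x∈p∪q⁺ (inj₁ (x∈⁅x⁆ x))

∈pairʳ : ∀ {n} {x y : Fin n} → y ∈ pair x y
∈pairʳ {y = y} = x∈p∪q⁺ (inj₂ (x∈⁅x⁆ y))

pair⊆ : ∀ {n} {x y : Fin n} {X : Subset n} → x ∈ X → y ∈ X → pair x y ⊆ X
pair⊆ x∈ y∈ z∈ with ∈pair⁻ z∈
... | inj₁ refl = x∈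
... | inj₂ refl = y∈

pair-comm : ∀ {n} (x y : Fin n) → pair x y ≡ pair y x
pair-comm x y = ⊆-antisym (pair⊆ ∈pairʳ ∈pairˡ) (pair⊆ ∈pairʳ ∈pairˡ)

pair-card : ∀ {n} {x y : Fin n} → x ≢ y → ∣ pair x y ∣ ≡ 2
pair-card {x = x} {y} x≢y = trans (∪⁅⁆-card ⁅ x ⁆ y (λ y∈x → x≢y (sym (x∈⁅y⁆⇒x≡y x y∈x))))
  (cong suc (Subset.∣⁅x⁆∣≡1 x))

pair-injective : ∀ {n} {x y a b : Fin n} → x ≢ y → pair x y ≡ pair a b → (x ≡ a × y ≡ b) ⊎ (x ≡ b × y ≡ a)
pair-injective {x = x} {y} {a} {b} x≢y eq
  with ∈pair⁻ {x = a} {b} (subst (x ∈_) eq ∈pairˡ) | ∈pair⁻ {x = a} {b} (subst (y ∈_) eq ∈pairʳ)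
... | inj₁ p | inj₂ q = inj₁ (p , q)
... | inj₂ p | inj₁ q = inj₂ (p , q)
... | inj₁ p | inj₁ q = ⊥-elim (x≢y (trans p (sym q)))
... | inj₂ p | inj₂ q = ⊥-elim (x≢y (trans p (sym q)))

card2⇒pair : ∀ {n} (X : Subset n) → ∣ X ∣ ≡ 2 → ∃[ x ] ∃[ y ] x ≢ y × X ≡ pair x y
card2⇒pair X eq with ∣ X ∣ | enumerate X
card2⇒pair X refl | _ | σ , inc , im =
  σ 0F , σ 1F , (λ e → Fin.0≢1+n (increasing-injective inc e)) , ⊆-antisym to from
  where
  0F 1F : Fin 2
  0F = Fin.zero
  1F = Fin.suc Fin.zero
  to : X ⊆ pair (σ 0F) (σ 1F)
  to {x} x∈ with Equivalence.to (im x) x∈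
  ... | Fin.zero , refl = ∈pairˡ
  ... | Fin.suc Fin.zero , refl = ∈pairʳ
  from : pair (σ 0F) (σ 1F) ⊆ X
  from = pair⊆ (Equivalence.from (im _) (_ , refl)) (Equivalence.from (im _) (_ , refl))

lift : ∀ {n} → Fin (suc n) → Subset n → Subset (suc n)
lift p C = insertAt C p outside

∈lift⁺ : ∀ {n} (p : Fin (suc n)) {C : Subset n} {x} → x ∈ C → punchIn p x ∈ lift p C
∈lift⁺ p {C} {x} x∈ = lookup⇒[]= _ _ (trans (insertAt-punchIn C p outside x) ([]=⇒lookup x∈))

∈lift⁻ : ∀ {n} (p : Fin (suc n)) {C : Subset n} {x} → punchIn p x ∈ lift p C → x ∈ C
∈lift⁻ p {C} {x} x∈ = lookup⇒[]= _ _ (trans (sym (insertAt-punchIn C p outside x)) ([]=⇒lookup x∈))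

p∉lift : ∀ {n} (p : Fin (suc n)) {C : Subset n} → p ∉ lift p C
p∉lift p {C} p∈ with trans (sym (insertAt-lookup C p outside)) ([]=⇒lookup p∈)
... | ()

data PunchView {n} (p : Fin (suc n)) : Fin (suc n) → Set where
  hole  : PunchView p p
  other : ∀ x → PunchView p (punchIn p x)

punchView : ∀ {n} (p x : Fin (suc n)) → PunchView p x
punchView p x with p Fin.≟ x
... | yes refl = hole
... | no  p≢x  = subst (PunchView p) (Fin.punchIn-punchOut p≢x) (other (punchOut p≢x))

-- Adjoining an element to a totally nonnegative matrix

punchIn-below : ∀ {n} (j : Fin (suc n)) (i : Fin n) → toℕ i < toℕ j → punchIn j i Fin.< j
punchIn-below (Fin.suc j) Fin.zero    _         = s≤s z≤n
punchIn-below (Fin.suc j) (Fin.suc i) (s≤s i<j) = s≤s (punchIn-below j i i<j)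

punchIn-above : ∀ {n} (j : Fin (suc n)) (i : Fin n) → toℕ j ≤ toℕ i → j Fin.< punchIn j i
punchIn-above Fin.zero    i           _         = s≤s z≤n
punchIn-above (Fin.suc j) (Fin.suc i) (s≤s j≤i) = s≤s (punchIn-above j i j≤i)

punchIn-mono-< : ∀ {n} (j : Fin (suc n)) {x y : Fin n} → x Fin.< y → punchIn j x Fin.< punchIn j y
punchIn-mono-< j {x} {y} x<y = Fin.≤∧≢⇒< (Fin.punchIn-mono-≤ j x y (ℕ.<⇒≤ x<y))
  (λ eq → Fin.<⇒≢ x<y (Fin.punchIn-injective j x y eq))

punchOut-mono-< : ∀ {n} {p x y : Fin (suc n)} (p≢x : p ≢ x) (p≢y : p ≢ y) →
  x Fin.< y → punchOut p≢x Fin.< punchOut p≢y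
punchOut-mono-< p≢x p≢y x<y = Fin.≤∧≢⇒< (Fin.punchOut-mono-≤ p≢x p≢y (ℕ.<⇒≤ x<y))
  (λ eq → Fin.<⇒≢ x<y (Fin.punchOut-injective p≢x p≢y eq))

-- Supplies the column selection of a basis `C ∪ ⁅ f ⁆` together with the position `j` of `f`, which
-- is the index of the Laplace term that will be nonzero.
insert-increasing : ∀ {k n} (τ : Fin k → Fin n) → StrictlyIncreasing τ → ∀ f → (∀ i → τ i ≢ f) →
  ∃[ σ ] ∃[ j ] StrictlyIncreasing σ × σ j ≡ f × (∀ i → σ (punchIn j i) ≡ τ i)
insert-increasing {zero} τ inc f f∉τ =
  (λ _ → f) , Fin.zero , (λ { Fin.zero Fin.zero () }) , refl , λ ()
insert-increasing {suc k} {n} τ inc f f∉τ with f Fin.<? τ Fin.zero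
... | yes f<τ₀ = σ , Fin.zero , σ-inc , refl , λ _ → refl
  where
  σ : Fin (suc (suc k)) → Fin n
  σ Fin.zero    = f
  σ (Fin.suc i) = τ i
  σ-inc : StrictlyIncreasing σ
  σ-inc Fin.zero    (Fin.suc Fin.zero)    _ = f<τ₀
  σ-inc Fin.zero    (Fin.suc (Fin.suc j)) _ = Fin.<-trans f<τ₀ (inc Fin.zero (Fin.suc j) (s≤s z≤n))
  σ-inc (Fin.suc i) (Fin.suc j) (s≤s i<j)   = inc i j i<j
... | no f≮τ₀ with insert-increasing (τ ∘ Fin.suc) (λ i j i<j → inc (Fin.suc i) (Fin.suc j) (s≤s i<j)) f (f∉τ ∘ Fin.suc)
...   | σ′ , j′ , inc′ , at-f , rest = σ , Fin.suc j′ , σ-inc , at-f , σ-rest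
  where
  σ : Fin (suc (suc k)) → Fin n
  σ Fin.zero    = τ Fin.zero
  σ (Fin.suc i) = σ′ i
  σ-rest : ∀ i → σ (punchIn (Fin.suc j′) i) ≡ τ i
  σ-rest Fin.zero    = refl
  σ-rest (Fin.suc i) = rest i
  τ₀<σ′ : ∀ i → τ Fin.zero Fin.< σ′ i
  τ₀<σ′ i with punchView j′ i
  ... | hole    = subst (τ Fin.zero Fin.<_) (sym at-f) (Fin.≤∧≢⇒< (ℕ.≮⇒≥ f≮τ₀) (f∉τ Fin.zero))
  ... | other x = subst (τ Fin.zero Fin.<_) (sym (rest x)) (inc Fin.zero (Fin.suc x) (s≤s z≤n))
  σ-inc : StrictlyIncreasing σ
  σ-inc Fin.zero    (Fin.suc j) _         = τ₀<σ′ j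
  σ-inc (Fin.suc i) (Fin.suc j) (s≤s i<j) = inc′ i j i<j

-- Old columns left of the new element are negated. For a new-row entry next to `p` these signs
-- multiply to (-1)^j, where j is the position of the entry, and cancel the Laplace sign.
side : ∀ {n} → Fin n → Fin n → ℚ
side p x = if does (x Fin.<? p) then ℚ.- 1ℚ else 1ℚ

side-< : ∀ {n} {p x : Fin n} → x Fin.< p → side p x ≡ ℚ.- 1ℚ
side-< {p = p} {x} x<p = cong (if_then ℚ.- 1ℚ else 1ℚ) (dec-true (x Fin.<? p) x<p)

side-≮ : ∀ {n} {p x : Fin n} → ¬ x Fin.< p → side p x ≡ 1ℚ
side-≮ {p = p} {x} x≮p = cong (if_then ℚ.- 1ℚ else 1ℚ) (dec-false (x Fin.<? p) x≮p)

-- The sign of x in the new row making its Laplace term equal to the minor of the old matrix.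
Admissible : ∀ {n} → ℕ → Fin (suc n) → Fin (suc n) → ℚ → Set
Admissible {n} k p x ε = ∀ (σ : Fin (suc k) → Fin (suc n)) → StrictlyIncreasing σ → ∀ j →
  (∀ i → p ≢ σ (punchIn j i)) → σ j ≡ x → sgn (toℕ j) ℚ.* (ε ℚ.* prodF (side p ∘ σ ∘ punchIn j)) ≡ 1ℚ

-- If nothing but `p` separates x from p, the selected columns before x are exactly those left of
-- `p`. Their negations give (-1)^j, the square of which is 1.
admissible-near : ∀ {n k} {p x : Fin (suc n)} →
  (∀ y → p ≢ y → y Fin.< x → y Fin.< p) → (∀ y → p ≢ y → x Fin.< y → ¬ y Fin.< p) →
  Admissible k p x 1ℚ
admissible-near {k = k} {p} {x} left right σ inc j avoid refl =
  trans (cong (sgn (toℕ j) ℚ.*_) (trans (ℚ.*-identityˡ _) signs)) (sgn-square (toℕ j))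
  where
  signs : prodF (side p ∘ σ ∘ punchIn j) ≡ sgn (toℕ j)
  signs = prodF-signs (toℕ j) (ℕ.≤-pred (Fin.toℕ<n j))
    (λ i i<j → side-< (left _ (avoid i) (inc _ _ (punchIn-below j i i<j))))
    (λ i j≤i → side-≮ (right _ (avoid i) (inc _ _ (punchIn-above j i j≤i))))

admissible-self : ∀ {n k} {p : Fin (suc n)} → Admissible k p p 1ℚ
admissible-self = admissible-near (λ _ _ y<p → y<p) (λ _ _ p<y → Fin.<-asym p<y)

admissible-pred : ∀ {n k} {p x : Fin (suc n)} → toℕ p ≡ suc (toℕ x) → Admissible k p x 1ℚ
admissible-pred {p = p} {x} p≡1+x = admissible-near
  (λ y _ y<x → subst (toℕ y <_) (sym p≡1+x) (ℕ.m<n⇒m<1+n y<x))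
  (λ y _ x<y y<p → ℕ.<-irrefl refl (ℕ.<-≤-trans x<y (ℕ.≤-pred (subst (toℕ y <_) p≡1+x y<p))))

admissible-succ : ∀ {n k} {p x : Fin (suc n)} → toℕ x ≡ suc (toℕ p) → Admissible k p x 1ℚ
admissible-succ {p = p} {x} x≡1+p = admissible-near
  (λ y p≢y y<x → Fin.≤∧≢⇒< (ℕ.≤-pred (subst (toℕ y <_) x≡1+p y<x)) (≢-sym p≢y))
  (λ y _ x<y y<p → ℕ.<-irrefl refl (ℕ.<-trans (subst (_< toℕ y) x≡1+p x<y) (ℕ.m<n⇒m<1+n y<p)))

-- Nothing lies left of `p`, so no column is negated, while x comes last and has Laplace sign
-- (-1)^k. The entry (-1)^k corrects this; it is the usual sign of the cyclic shift for k + 1 rows.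
admissible-last : ∀ {n k} {p x : Fin (suc n)} → toℕ p ≡ 0 → toℕ x ≡ n → Admissible k p x (sgn k)
admissible-last {n} {k} {p} {x} p≡0 x≡n σ inc j avoid refl =
  trans (cong₂ (λ a b → sgn a ℚ.* (sgn k ℚ.* b)) (j≡k) (prodF-ones all-right))
    (trans (cong (sgn k ℚ.*_) (ℚ.*-identityʳ (sgn k))) (sgn-square k))
  where
  all-right : ∀ i → side p (σ (punchIn j i)) ≡ 1ℚ
  all-right i = side-≮ (λ lt → ℕ.n≮0 (subst (toℕ (σ (punchIn j i)) <_) p≡0 lt))
  j≡k : toℕ j ≡ k
  j≡k with ℕ.m≤n⇒m<n∨m≡n (ℕ.≤-pred (Fin.toℕ<n j))
  ... | inj₂ eq = eq
  ... | inj₁ j<k = ⊥-elim (ℕ.<-irrefl refl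
    (ℕ.<-≤-trans (subst (_< toℕ (σ last)) x≡n (inc j last j<last))
    (ℕ.≤-pred (Fin.toℕ<n (σ last)))))
    where
    last = Fin.fromℕ k
    j<last : j Fin.< last
    j<last = subst (toℕ j <_) (sym (Fin.toℕ-fromℕ k)) j<k

-- The mirror case: x comes first with Laplace sign 1, but all k other columns are negated.
admissible-first : ∀ {n k} {p x : Fin (suc n)} → toℕ p ≡ n → toℕ x ≡ 0 → Admissible k p x (sgn k)
admissible-first {n} {k} {p} {x} p≡n x≡0 σ inc j avoid refl =
  trans (cong₂ (λ a b → sgn a ℚ.* (sgn k ℚ.* b)) (j≡0 j refl)
    (prodF-signs k ℕ.≤-refl all-left (λ i k≤i → ⊥-elim (ℕ.<⇒≱ (Fin.toℕ<n i) k≤i))))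
    (trans (ℚ.*-identityˡ _) (sgn-square k))
  where
  all-left : ∀ i → toℕ i < k → side p (σ (punchIn j i)) ≡ ℚ.- 1ℚ
  all-left i _ = side-< (Fin.≤∧≢⇒<
    (subst (toℕ (σ (punchIn j i)) ≤_) (sym p≡n) (ℕ.≤-pred (Fin.toℕ<n (σ (punchIn j i)))))
    (≢-sym (avoid i)))
  j≡0 : ∀ j′ → j′ ≡ j → toℕ j ≡ 0
  j≡0 Fin.zero refl = refl
  j≡0 (Fin.suc j′) refl = ⊥-elim (ℕ.n≮0 (subst (toℕ (σ Fin.zero) <_) x≡0 (inc Fin.zero j (s≤s z≤n))))

*-≢0ˡ : ∀ p q → p ℚ.* q ≢ 0ℚ → p ≢ 0ℚ
*-≢0ˡ p q pq≢0 refl = pq≢0 (ℚ.*-zeroˡ q)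

*-≢0ʳ : ∀ p q → p ℚ.* q ≢ 0ℚ → q ≢ 0ℚ
*-≢0ʳ p q pq≢0 refl = pq≢0 (ℚ.*-zeroʳ p)

AddLoop : ∀ {n} → Fin (suc n) → Coll n → Coll (suc n)
AddLoop p M B = ∃[ C ] M C × B ≡ lift p C

-- Matroid union with the rank one matroid whose nonloops form F.
Join : ∀ {n} → Subset n → Coll n → Coll n
Join F M B = ∃[ C ] ∃[ f ] M C × f ∈ F × f ∉ C × B ≡ C ∪ ⁅ f ⁆

-- Every Laplace term of a maximal minor along the top row is zero or a maximal minor of A, so the terms
-- cannot cancel.
module Adjoin {n k : ℕ} (A : Fin k → Fin n → ℚ) (p : Fin (suc n)) (F : Subset (suc n))
  (ε : Fin (suc n) → ℚ) (admissible : ∀ x → x ∈ F → Admissible k p x (ε x)) where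

  top : Fin (suc n) → ℚ
  top x = if does (x ∈? F) then ε x else 0ℚ

  top-∈ : ∀ {x} → x ∈ F → top x ≡ ε x
  top-∈ {x} x∈F = cong (if_then ε x else 0ℚ) (dec-true (x ∈? F) x∈F)

  top-∉ : ∀ {x} → x ∉ F → top x ≡ 0ℚ
  top-∉ {x} x∉F = cong (if_then ε x else 0ℚ) (dec-false (x ∈? F) x∉F)

  below : Fin k → Fin (suc n) → ℚ
  below r x with p Fin.≟ x
  ... | yes _   = 0ℚ
  ... | no  p≢x = side p x ℚ.* A r (punchOut p≢x)

  matrix : Fin (suc k) → Fin (suc n) → ℚ
  matrix Fin.zero    = top
  matrix (Fin.suc r) = below r

  below-p : ∀ r → below r p ≡ 0ℚ
  below-p r with p Fin.≟ p
  ... | yes _  = refl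
  ... | no p≢p = ⊥-elim (p≢p refl)

  below-≢p : ∀ r {x} (p≢x : p ≢ x) → below r x ≡ side p x ℚ.* A r (punchOut p≢x)
  below-≢p r {x} p≢x with p Fin.≟ x
  ... | yes p≡x = ⊥-elim (p≢x p≡x)
  ... | no  _   = cong (λ y → side p x ℚ.* A r y) (Fin.punchOut-cong p refl)

  minor-below : (τ : Fin k → Fin (suc n)) (avoid : ∀ i → p ≢ τ i) →
    minor below τ ≡ prodF (side p ∘ τ) ℚ.* minor A (λ i → punchOut (avoid i))
  minor-below τ avoid = trans (det-cong k (λ r c → below-≢p r (avoid c)))
    (det-scale-columns k (side p ∘ τ) (λ r c → A r (punchOut (avoid c))))

  term : (Fin (suc k) → Fin (suc n)) → Fin (suc k) → ℚ
  term σ j = sgn (toℕ j) ℚ.* (top (σ j) ℚ.* minor below (σ ∘ punchIn j))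

  avoids? : (τ : Fin k → Fin (suc n)) → (∀ i → p ≢ τ i) ⊎ ∃[ i ] p ≡ τ i
  avoids? τ with Fin.any? (λ i → p Fin.≟ τ i)
  ... | yes hit = inj₂ hit
  ... | no miss = inj₁ (λ i eq → miss (i , eq))

  term-avoiding : ∀ {σ} → StrictlyIncreasing σ → ∀ j → σ j ∈ F → (avoid : ∀ i → p ≢ σ (punchIn j i)) →
    term σ j ≡ minor A (λ i → punchOut (avoid i))
  term-avoiding {σ} inc j σj∈F avoid = begin
    g ℚ.* (top (σ j) ℚ.* minor below (σ ∘ punchIn j))
      ≡⟨ cong (λ t → g ℚ.* t) (cong₂ ℚ._*_ (top-∈ σj∈F) (minor-below (σ ∘ punchIn j) avoid)) ⟩
    g ℚ.* (ε (σ j) ℚ.* (P ℚ.* m))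
      ≡⟨ solve 4 (λ g e P m → g :* (e :* (P :* m)) := (g :* (e :* P)) :* m) refl g (ε (σ j)) P m ⟩
    (g ℚ.* (ε (σ j) ℚ.* P)) ℚ.* m
      ≡⟨ cong (ℚ._* m) (admissible (σ j) σj∈F σ inc j avoid refl) ⟩
    1ℚ ℚ.* m
      ≡⟨ ℚ.*-identityˡ m ⟩
    m ∎
    where
    open ≡-Reasoning
    open +-*-Solver
    g = sgn (toℕ j)
    P = prodF (side p ∘ σ ∘ punchIn j)
    m = minor A (λ i → punchOut (avoid i))

  term-hitting : ∀ σ j i → p ≡ σ (punchIn j i) → term σ j ≡ 0ℚ
  term-hitting σ j i p≡ = trans (cong (λ m → sgn (toℕ j) ℚ.* (top (σ j) ℚ.* m)) minor≡0)
      (solve 2 (λ g t → g :* (t :* con 0ℚ) := con 0ℚ) refl (sgn (toℕ j)) (top (σ j)))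
    where
    open +-*-Solver
    minor≡0 : minor below (σ ∘ punchIn j) ≡ 0ℚ
    minor≡0 = det-zero-column k i (λ r → subst (λ x → below r x ≡ 0ℚ) p≡ (below-p r))

  term-outside : ∀ σ j → σ j ∉ F → term σ j ≡ 0ℚ
  term-outside σ j σj∉F = trans (cong (λ t → sgn (toℕ j) ℚ.* (t ℚ.* minor below (σ ∘ punchIn j))) (top-∉ σj∉F))
      (solve 2 (λ g m → g :* (con 0ℚ :* m) := con 0ℚ) refl (sgn (toℕ j)) (minor below (σ ∘ punchIn j)))
    where open +-*-Solver

  punchOut-increasing : ∀ {σ : Fin (suc k) → Fin (suc n)} → StrictlyIncreasing σ → ∀ j (avoid : ∀ i → p ≢ σ (punchIn j i)) →
    StrictlyIncreasing (λ i → punchOut (avoid i))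
  punchOut-increasing inc j avoid a b a<b = punchOut-mono-< (avoid a) (avoid b) (inc _ _ (punchIn-mono-< j a<b))

  Hits : (Fin (suc k) → Fin (suc n)) → Fin (suc k) → Set
  Hits σ j = σ j ∈ F × Σ (∀ i → p ≢ σ (punchIn j i)) λ avoid → term σ j ≡ minor A (λ i → punchOut (avoid i))

  term-cases : ∀ {σ} → StrictlyIncreasing σ → ∀ j → term σ j ≡ 0ℚ ⊎ Hits σ j
  term-cases {σ} inc j = cases (σ j ∈? F) (avoids? (σ ∘ punchIn j))
    where
    cases : Dec (σ j ∈ F) → (∀ i → p ≢ σ (punchIn j i)) ⊎ (∃[ i ] p ≡ σ (punchIn j i)) → term σ j ≡ 0ℚ ⊎ Hits σ j
    cases (no σj∉F)  _                = inj₁ (term-outside σ j σj∉F)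
    cases (yes _)    (inj₂ (i , hit)) = inj₁ (term-hitting σ j i hit)
    cases (yes σj∈F) (inj₁ avoid)     = inj₂ (σj∈F , avoid , term-avoiding inc j σj∈F avoid)

  module _ (tnn : TNN A) where
    term-nonneg : ∀ {σ} → StrictlyIncreasing σ → ∀ j → 0ℚ ℚ.≤ term σ j
    term-nonneg {σ} inc j with term-cases {σ} inc j
    ... | inj₁ ≡0 = ℚ.≤-reflexive (sym ≡0)
    ... | inj₂ (_ , avoid , eq) = subst (0ℚ ℚ.≤_) (sym eq) (tnn _ (punchOut-increasing {σ} inc j avoid))

    matrix-tnn : TNN matrix
    matrix-tnn σ inc = sumF-nonneg (term-nonneg inc)

    -- All terms being nonnegative, one nonzero term makes the minor nonzero. Conversely a nonzero
    -- minor has a nonzero term j, and deleting the column `σ j`, which lies in F, leaves a basis of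
    -- the old matroid.
    matroid-matrix : (M : Coll n) → M ≐ᶜ MatroidOf A → Join F (AddLoop p M) ≐ᶜ MatroidOf matrix
    matroid-matrix M M≐ B = mk⇔ to from
      where
      to : Join F (AddLoop p M) B → MatroidOf matrix B
      to (_ , f , (C , MC , refl) , f∈F , f∉C , refl) with Equivalence.to (M≐ C) MC
      ... | τ , inc , im , nz with insert-increasing (punchIn p ∘ τ) (λ i j i<j → punchIn-mono-< p (inc i j i<j)) f
                 (λ i eq → f∉C (subst (_∈ lift p C) eq (∈lift⁺ p (Equivalence.from (im (τ i)) (i , refl)))))
      ...   | σ , j , σ-inc , σj≡f , rest = σ , σ-inc , image , nonneg-sumF≢0 (term-nonneg σ-inc) j term≢0
        where
        avoid : ∀ i → p ≢ σ (punchIn j i)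
        avoid i eq = Fin.punchInᵢ≢i p (τ i) (sym (trans eq (rest i)))
        term≢0 : term σ j ≢ 0ℚ
        term≢0 eq = nz (trans (det-cong k
          (λ r c → cong (A r) (sym (trans (Fin.punchOut-cong p {i≢k = Fin.punchInᵢ≢i p (τ c) ∘ sym} (rest c))
          (Fin.punchOut-punchIn p)))))
                     (trans (sym (term-avoiding σ-inc j (subst (_∈ F) (sym σj≡f) f∈F) avoid)) eq))
        image : ImageIs σ (lift p C ∪ ⁅ f ⁆)
        image x = mk⇔ into onto
          where
          into : x ∈ lift p C ∪ ⁅ f ⁆ → ∃[ i ] σ i ≡ x
          into x∈ with x∈p∪q⁻ (lift p C) ⁅ f ⁆ x∈
          ... | inj₂ x∈f = j , trans σj≡f (sym (x∈⁅y⁆⇒x≡y f x∈f))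
          ... | inj₁ x∈C with punchView p x
          ...   | hole = ⊥-elim (p∉lift p {C} x∈C)
          ...   | other y with Equivalence.to (im y) (∈lift⁻ p x∈C)
          ...     | i , refl = punchIn j i , rest i
          onto : ∃[ i ] σ i ≡ x → x ∈ lift p C ∪ ⁅ f ⁆
          onto (i , refl) with punchView j i
          ... | hole = x∈p∪q⁺ (inj₂ (subst (_∈ ⁅ f ⁆) (sym σj≡f) (x∈⁅x⁆ f)))
          ... | other i′ = x∈p∪q⁺ (inj₁ (subst (_∈ lift p C) (sym (rest i′))
            (∈lift⁺ p (Equivalence.from (im (τ i′)) (i′ , refl)))))
      from : MatroidOf matrix B → Join F (AddLoop p M) B
      from (σ , inc , im , nz) with sumF≢0⇒∃≢0 (term σ) nz
      ... | j , term≢0 with term-cases {σ} inc j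
      ...   | inj₁ ≡0 = ⊥-elim (term≢0 ≡0)
      ...   | inj₂ (σj∈F , avoid , term≡) = lift p C , σ j , (C , MC , refl) , σj∈F , σj∉C , ⊆-antisym into onto
        where
        τ : Fin k → Fin n
        τ i = punchOut (avoid i)
        in-image? : ∀ x → Dec (∃[ i ] τ i ≡ x)
        in-image? x = Fin.any? (λ i → τ i Fin.≟ x)
        C : Subset n
        C = select in-image?
        MC : M C
        MC = Equivalence.from (M≐ C) (τ , punchOut-increasing {σ} inc j avoid ,
          (λ x → mk⇔ (∈select⁻ in-image?) (∈select⁺ in-image?)) ,
          (λ eq → term≢0 (trans term≡ eq)))
        in-lift : ∀ i → σ (punchIn j i) ∈ lift p C
        in-lift i = subst (_∈ lift p C) (Fin.punchIn-punchOut (avoid i)) (∈lift⁺ p (∈select⁺ in-image? (i , refl)))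
        lift-in : ∀ {x} → x ∈ lift p C → ∃[ i ] σ (punchIn j i) ≡ x
        lift-in {x} x∈ with punchView p x
        ... | hole = ⊥-elim (p∉lift p {C} x∈)
        ... | other y with ∈select⁻ in-image? (∈lift⁻ p {C} x∈)
        ...   | i , refl = i , sym (Fin.punchIn-punchOut (avoid i))
        σj∉C : σ j ∉ lift p C
        σj∉C σj∈ with lift-in σj∈
        ... | i , eq = Fin.punchInᵢ≢i j i (increasing-injective inc eq)
        into : B ⊆ lift p C ∪ ⁅ σ j ⁆
        into {x} x∈ with Equivalence.to (im x) x∈
        ... | i , refl with punchView j i
        ...   | hole = x∈p∪q⁺ (inj₂ (x∈⁅x⁆ (σ j)))
        ...   | other i′ = x∈p∪q⁺ (inj₁ (in-lift i′))
        onto : lift p C ∪ ⁅ σ j ⁆ ⊆ B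
        onto {x} x∈ with x∈p∪q⁻ (lift p C) ⁅ σ j ⁆ x∈
        ... | inj₁ x∈C = let i , eq = lift-in x∈C in Equivalence.from (im x) (_ , eq)
        ... | inj₂ x∈j = Equivalence.from (im x) (j , sym (x∈⁅y⁆⇒x≡y (σ j) x∈j))

-- Exchange for matroid unions

swap : ∀ {n} → Subset n → Fin n → Fin n → Subset n
swap B x y = (∁ ⁅ x ⁆ ∩ B) ∪ ⁅ y ⁆

∈swap⁻ : ∀ {n} {B : Subset n} {x y z} → z ∈ swap B x y → (z ≢ x × z ∈ B) ⊎ z ≡ y
∈swap⁻ {B = B} {x} {y} z∈ with x∈p∪q⁻ (∁ ⁅ x ⁆ ∩ B) ⁅ y ⁆ z∈
... | inj₂ z∈y = inj₂ (x∈⁅y⁆⇒x≡y y z∈y)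
... | inj₁ z∈′ with x∈p∩q⁻ (∁ ⁅ x ⁆) B z∈′
...   | z∉x , z∈B = inj₁ ((λ { refl → x∈∁p⇒x∉p z∉x (x∈⁅x⁆ x) }) , z∈B)

∈swap-old : ∀ {n} {B : Subset n} {x y z} → z ≢ x → z ∈ B → z ∈ swap B x y
∈swap-old {x = x} z≢x z∈B = x∈p∪q⁺ (inj₁ (x∈p∩q⁺ (x∉p⇒x∈∁p (z≢x ∘ x∈⁅y⁆⇒x≡y x) , z∈B)))

∈swap-new : ∀ {n} {B : Subset n} {x y} → y ∈ swap B x y
∈swap-new {y = y} = x∈p∪q⁺ (inj₂ (x∈⁅x⁆ y))

∈∪⁅⁆⁻ : ∀ {n} {C : Subset n} {f z} → z ∈ C ∪ ⁅ f ⁆ → z ∈ C ⊎ z ≡ f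
∈∪⁅⁆⁻ {C = C} {f} z∈ with x∈p∪q⁻ C ⁅ f ⁆ z∈
... | inj₁ z∈C = inj₁ z∈C
... | inj₂ z∈f = inj₂ (x∈⁅y⁆⇒x≡y f z∈f)

∈∪⁅⁆-old : ∀ {n} {C : Subset n} {f z} → z ∈ C → z ∈ C ∪ ⁅ f ⁆
∈∪⁅⁆-old = x∈p∪q⁺ ∘ inj₁

∈∪⁅⁆-new : ∀ {n} {C : Subset n} {f} → f ∈ C ∪ ⁅ f ⁆
∈∪⁅⁆-new {f = f} = x∈p∪q⁺ (inj₂ (x∈⁅x⁆ f))

AddLoop-isMatroid : ∀ {n} p {M : Coll n} → IsMatroid M → IsMatroid (AddLoop p M)
AddLoop-isMatroid p {M} ((C₀ , MC₀) , exchange) = (lift p C₀ , C₀ , MC₀ , refl) , exchange⁺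
  where
  exchange⁺ : ∀ B₁ B₂ → AddLoop p M B₁ → AddLoop p M B₂ → ∀ x → x ∈ B₁ → x ∉ B₂ →
    ∃[ y ] (y ∈ B₂ × y ∉ B₁ × AddLoop p M (swap B₁ x y))
  exchange⁺ _ _ (C₁ , MC₁ , refl) (C₂ , MC₂ , refl) x x∈ x∉ with punchView p x
  ... | hole    = ⊥-elim (p∉lift p {C₁} x∈)
  ... | other x with exchange C₁ C₂ MC₁ MC₂ x (∈lift⁻ p x∈) (x∉ ∘ ∈lift⁺ p)
  ...   | y , y∈ , y∉ , M′ = punchIn p y , ∈lift⁺ p y∈ , y∉ ∘ ∈lift⁻ p , swap C₁ x y , M′ , ⊆-antisym to from
    where
    to : swap (lift p C₁) (punchIn p x) (punchIn p y) ⊆ lift p (swap C₁ x y)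
    to {z} z∈ with ∈swap⁻ z∈
    ... | inj₂ refl = ∈lift⁺ p ∈swap-new
    ... | inj₁ (z≢ , z∈C) with punchView p z
    ...   | hole    = ⊥-elim (p∉lift p {C₁} z∈C)
    ...   | other z = ∈lift⁺ p (∈swap-old (λ { refl → z≢ refl }) (∈lift⁻ p z∈C))
    from : lift p (swap C₁ x y) ⊆ swap (lift p C₁) (punchIn p x) (punchIn p y)
    from {z} z∈ with punchView p z
    ... | hole    = ⊥-elim (p∉lift p {swap C₁ x y} z∈)
    ... | other z with ∈swap⁻ (∈lift⁻ p z∈)
    ...   | inj₂ refl = ∈swap-new
    ...   | inj₁ (z≢x , z∈C) = ∈swap-old (z≢x ∘ Fin.punchIn-injective p _ _) (∈lift⁺ p z∈C)

module _ {n} (F : Subset n) {M : Coll n} (M-isMatroid : IsMatroid M) where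
  private exchange = proj₂ M-isMatroid

  -- If `f₂` is not in C it can be added itself. Otherwise exchange `f₂` out of C against `C₂`,
  -- obtaining y; then C + y is the basis C - f₂ + y of M with `f₂` added back.
  Join-augment : ∀ {C C₂ f₂} → M C → M C₂ → f₂ ∈ F → f₂ ∉ C₂ →
    ∃[ y ] y ∈ C₂ ∪ ⁅ f₂ ⁆ × y ∉ C × Join F M (C ∪ ⁅ y ⁆)
  Join-augment {C} {C₂} {f₂} MC MC₂ f₂∈F f₂∉C₂ with f₂ ∈? C
  ... | no f₂∉C = f₂ , ∈∪⁅⁆-new , f₂∉C , C , f₂ , MC , f₂∈F , f₂∉C , refl
  ... | yes f₂∈C with exchange C C₂ MC MC₂ f₂ f₂∈C f₂∉C₂
  ...   | y , y∈C₂ , y∉C , M′ = y , ∈∪⁅⁆-old y∈C₂ , y∉C , swap C f₂ y , f₂ , M′ , f₂∈F , f₂∉ , ⊆-antisym to from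
    where
    f₂∉ : f₂ ∉ swap C f₂ y
    f₂∉ f₂∈ with ∈swap⁻ f₂∈
    ... | inj₁ (f₂≢f₂ , _) = f₂≢f₂ refl
    ... | inj₂ refl = f₂∉C₂ y∈C₂
    to : C ∪ ⁅ y ⁆ ⊆ swap C f₂ y ∪ ⁅ f₂ ⁆
    to {z} z∈ with ∈∪⁅⁆⁻ z∈
    ... | inj₂ refl = ∈∪⁅⁆-old ∈swap-new
    ... | inj₁ z∈C with z Fin.≟ f₂
    ...   | yes refl = ∈∪⁅⁆-new
    ...   | no z≢f₂ = ∈∪⁅⁆-old (∈swap-old z≢f₂ z∈C)
    from : swap C f₂ y ∪ ⁅ f₂ ⁆ ⊆ C ∪ ⁅ y ⁆
    from z∈ with ∈∪⁅⁆⁻ z∈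
    ... | inj₂ refl = ∈∪⁅⁆-old f₂∈C
    ... | inj₁ z∈′ with ∈swap⁻ z∈′
    ...   | inj₁ (_ , z∈C) = ∈∪⁅⁆-old z∈C
    ...   | inj₂ refl = ∈∪⁅⁆-new

  Join-isMatroid : (∀ {C} → M C → ∃[ f ] f ∈ F × f ∉ C) → IsMatroid (Join F M)
  Join-isMatroid free = nonempty , exchange⁺
    where
    nonempty : ∃[ B ] Join F M B
    nonempty = let C , MC = proj₁ M-isMatroid ; f , f∈F , f∉C = free MC in C ∪ ⁅ f ⁆ , C , f , MC , f∈F , f∉C , refl
    exchange⁺ : ∀ B₁ B₂ → Join F M B₁ → Join F M B₂ → ∀ x → x ∈ B₁ → x ∉ B₂ →
      ∃[ y ] (y ∈ B₂ × y ∉ B₁ × Join F M (swap B₁ x y))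
    exchange⁺ _ _ (C₁ , f₁ , MC₁ , f₁∈F , f₁∉C₁ , refl) (C₂ , f₂ , MC₂ , f₂∈F , f₂∉C₂ , refl) x x∈ x∉
      with ∈∪⁅⁆⁻ x∈
    -- The removed element is the added one, so the basis `C₁` of M remains and is augmented.
    ... | inj₂ refl with Join-augment MC₁ MC₂ f₂∈F f₂∉C₂
    ...   | y , y∈ , y∉C₁ , J = y , y∈ , y∉ , subst (Join F M) (⊆-antisym to from) J
      where
      y∉ : y ∉ C₁ ∪ ⁅ f₁ ⁆
      y∉ y∈₁ with ∈∪⁅⁆⁻ y∈₁
      ... | inj₁ y∈C₁ = y∉C₁ y∈C₁
      ... | inj₂ refl = x∉ y∈
      to : C₁ ∪ ⁅ y ⁆ ⊆ swap (C₁ ∪ ⁅ f₁ ⁆) f₁ y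
      to z∈ with ∈∪⁅⁆⁻ z∈
      ... | inj₁ z∈C₁ = ∈swap-old (λ { refl → f₁∉C₁ z∈C₁ }) (∈∪⁅⁆-old z∈C₁)
      ... | inj₂ refl = ∈swap-new
      from : swap (C₁ ∪ ⁅ f₁ ⁆) f₁ y ⊆ C₁ ∪ ⁅ y ⁆
      from z∈ with ∈swap⁻ z∈
      ... | inj₂ refl = ∈∪⁅⁆-new
      ... | inj₁ (z≢f₁ , z∈′) with ∈∪⁅⁆⁻ z∈′
      ...   | inj₁ z∈C₁ = ∈∪⁅⁆-old z∈C₁
      ...   | inj₂ z≡f₁ = ⊥-elim (z≢f₁ z≡f₁)
    exchange⁺ _ _ (C₁ , f₁ , MC₁ , f₁∈F , f₁∉C₁ , refl) (C₂ , f₂ , MC₂ , f₂∈F , f₂∉C₂ , refl) x x∈ x∉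
        | inj₁ x∈C₁ with exchange C₁ C₂ MC₁ MC₂ x x∈C₁ (x∉ ∘ ∈∪⁅⁆-old)
    ... | y , y∈C₂ , y∉C₁ , M′ with y Fin.≟ f₁
    ...   | no y≢f₁ = y , ∈∪⁅⁆-old y∈C₂ , y∉ , swap C₁ x y , f₁ , M′ , f₁∈F , f₁∉ , ⊆-antisym to from
      where
      y∉ : y ∉ C₁ ∪ ⁅ f₁ ⁆
      y∉ y∈₁ with ∈∪⁅⁆⁻ y∈₁
      ... | inj₁ y∈C₁ = y∉C₁ y∈C₁
      ... | inj₂ y≡f₁ = y≢f₁ y≡f₁
      f₁∉ : f₁ ∉ swap C₁ x y
      f₁∉ f₁∈ with ∈swap⁻ f₁∈
      ... | inj₁ (_ , f₁∈C₁) = f₁∉C₁ f₁∈C₁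
      ... | inj₂ f₁≡y = y≢f₁ (sym f₁≡y)
      to : swap (C₁ ∪ ⁅ f₁ ⁆) x y ⊆ swap C₁ x y ∪ ⁅ f₁ ⁆
      to z∈ with ∈swap⁻ z∈
      ... | inj₂ refl = ∈∪⁅⁆-old ∈swap-new
      ... | inj₁ (z≢x , z∈′) with ∈∪⁅⁆⁻ z∈′
      ...   | inj₁ z∈C₁ = ∈∪⁅⁆-old (∈swap-old z≢x z∈C₁)
      ...   | inj₂ refl = ∈∪⁅⁆-new
      from : swap C₁ x y ∪ ⁅ f₁ ⁆ ⊆ swap (C₁ ∪ ⁅ f₁ ⁆) x y
      from z∈ with ∈∪⁅⁆⁻ z∈
      ... | inj₂ refl = ∈swap-old (λ { refl → f₁∉C₁ x∈C₁ }) ∈∪⁅⁆-new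
      ... | inj₁ z∈′ with ∈swap⁻ z∈′
      ...   | inj₁ (z≢x , z∈C₁) = ∈swap-old z≢x (∈∪⁅⁆-old z∈C₁)
      ...   | inj₂ refl = ∈swap-new
    -- The exchange in M returned `f₁`, which is already present. Then C₁ - x + f₁ is a basis of M,
    -- and augmenting it supplies the missing element.
    ...   | yes refl with Join-augment M′ MC₂ f₂∈F f₂∉C₂
    ...     | y′ , y′∈ , y′∉C₃ , J = y′ , y′∈ , y′∉ , subst (Join F M) (⊆-antisym to from) J
      where
      y′∉ : y′ ∉ C₁ ∪ ⁅ f₁ ⁆
      y′∉ y′∈₁ with ∈∪⁅⁆⁻ y′∈₁
      ... | inj₁ y′∈C₁ = y′∉C₃ (∈swap-old (λ { refl → x∉ y′∈ }) y′∈C₁)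
      ... | inj₂ refl = y′∉C₃ ∈swap-new
      to : swap C₁ x f₁ ∪ ⁅ y′ ⁆ ⊆ swap (C₁ ∪ ⁅ f₁ ⁆) x y′
      to z∈ with ∈∪⁅⁆⁻ z∈
      ... | inj₂ refl = ∈swap-new
      ... | inj₁ z∈′ with ∈swap⁻ z∈′
      ...   | inj₁ (z≢x , z∈C₁) = ∈swap-old z≢x (∈∪⁅⁆-old z∈C₁)
      ...   | inj₂ refl = ∈swap-old (λ { refl → f₁∉C₁ x∈C₁ }) ∈∪⁅⁆-new
      from : swap (C₁ ∪ ⁅ f₁ ⁆) x y′ ⊆ swap C₁ x f₁ ∪ ⁅ y′ ⁆
      from z∈ with ∈swap⁻ z∈
      ... | inj₂ refl = ∈∪⁅⁆-new
      ... | inj₁ (z≢x , z∈′) with ∈∪⁅⁆⁻ z∈′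
      ...   | inj₁ z∈C₁ = ∈∪⁅⁆-old (∈swap-old z≢x z∈C₁)
      ...   | inj₂ refl = ∈∪⁅⁆-old ∈swap-new

-- Rank 2 positroids

*-nonneg : ∀ {p q} → 0ℚ ℚ.≤ p → 0ℚ ℚ.≤ q → 0ℚ ℚ.≤ p ℚ.* q
*-nonneg {p} {q} 0≤p 0≤q =
  subst (ℚ._≤ p ℚ.* q) (ℚ.*-zeroʳ p) (ℚ.*-monoˡ-≤-nonNeg p {{ℚ.nonNegative 0≤p}} 0≤q)

*-≢0 : ∀ {p q} → p ≢ 0ℚ → q ≢ 0ℚ → p ℚ.* q ≢ 0ℚ
*-≢0 {p} {q} p≢0 q≢0 pq≡0 = q≢0 (begin
  q                   ≡⟨ sym (ℚ.*-identityˡ q) ⟩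
  1ℚ ℚ.* q            ≡⟨ cong (ℚ._* q) (sym (ℚ.*-inverseˡ p)) ⟩
  (ℚ.1/ p ℚ.* p) ℚ.* q  ≡⟨ ℚ.*-assoc (ℚ.1/ p) p q ⟩
  ℚ.1/ p ℚ.* (p ℚ.* q)  ≡⟨ cong (ℚ.1/ p ℚ.*_) pq≡0 ⟩
  ℚ.1/ p ℚ.* 0ℚ       ≡⟨ ℚ.*-zeroʳ (ℚ.1/ p) ⟩
  0ℚ                  ∎)
  where
  open ≡-Reasoning
  instance p-nonZero = ℚ.≢-nonZero p≢0

Plane : Set
Plane = ℚ × ℚ

cross : Plane → Plane → ℚ
cross (a , b) (c , d) = a ℚ.* d ℚ.- c ℚ.* b

cross-antisym : ∀ u v → cross u v ≡ ℚ.- cross v u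
cross-antisym (a , b) (c , d) = solve 4 (λ a b c d → a :* d :- c :* b := :- (c :* b :- a :* d)) refl a b c d
  where open +-*-Solver

cross-self : ∀ u → cross u u ≡ 0ℚ
cross-self (a , b) = ℚ.+-inverseʳ (a ℚ.* b)

plücker : ∀ t u v w → cross t v ℚ.* cross u w ≡ cross t u ℚ.* cross v w ℚ.+ cross t w ℚ.* cross u v
plücker (a , b) (c , d) (e , f) (g , h) = solve 8
  (λ a b c d e f g h → (a :* f :- e :* b) :* (c :* h :- g :* d) :=
    (a :* d :- c :* b) :* (e :* h :- g :* f) :+ (a :* h :- g :* b) :* (c :* f :- e :* d))
  refl a b c d e f g h
  where open +-*-Solver

cross≢0-sym : ∀ {u v} → cross u v ≢ 0ℚ → cross v u ≢ 0ℚ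
cross≢0-sym {u} {v} uv≢0 vu≡0 = uv≢0 (trans (cross-antisym u v) (cong ℚ.-_ vu≡0))

-- The graph of independent pairs of a rank 2 matroid. `triangle` says that non-adjacency is
-- transitive among nonloops, so the graph is complete multipartite on the nonloops, with the loops
-- isolated.
record Simple {n} (E : Fin n → Fin n → Set) : Set where
  field
    adj?     : ∀ x y → Dec (E x y)
    irrefl   : ∀ {x} → ¬ E x x
    symm     : ∀ {x y} → E x y → E y x
    triangle : ∀ {a b z t} → E a b → E z t → E z a ⊎ E z b

  adj⇒≢ : ∀ {x y} → E x y → x ≢ y
  adj⇒≢ e refl = irrefl e

  -- The working form of `triangle`: t certifies that y is a nonloop, so y is parallel to x and
  -- takes over its neighbours.
  par-trans : ∀ {x y z} → E x z → ¬ E x y → ∀ {t} → E y t → E y z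
  par-trans e ¬xy f with triangle e f
  ... | inj₁ yx = ⊥-elim (¬xy (symm yx))
  ... | inj₂ yz = yz

  nonloop? : ∀ x → Dec (∃ (E x))
  nonloop? x = Fin.any? (adj? x)

-- What total nonnegativity leaves on the level of the graph. The positions are a parameter so that
-- the property can also be used for the rotated orders.
Noncrossing : ∀ {n} → (Fin n → ℕ) → (Fin n → Fin n → Set) → Set
Noncrossing pos E = ∀ {a b c d} → pos a < pos b → pos b < pos c → pos c < pos d →
  E a b → E c d → E a c × E b d

Independent : ∀ {n} → (Fin n → Plane) → Fin n → Fin n → Set
Independent V x y = cross (V x) (V y) ≢ 0ℚ

Ordered : ∀ {n} → (Fin n → ℕ) → (Fin n → Plane) → Set
Ordered pos V = ∀ x y → pos x < pos y → 0ℚ ℚ.≤ cross (V x) (V y)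

independent-simple : ∀ {n} (V : Fin n → Plane) → Simple (Independent V)
independent-simple V = record
  { adj?     = λ x y → ¬? (cross (V x) (V y) ℚ.≟ 0ℚ)
  ; irrefl   = λ {x} xx≢0 → xx≢0 (cross-self (V x))
  ; symm     = λ {x} {y} → cross≢0-sym {V x} {V y}
  ; triangle = triangle
  }
  where
  triangle : ∀ {a b z t} → Independent V a b → Independent V z t → Independent V z a ⊎ Independent V z b
  triangle {a} {b} {z} {t} ab zt with cross (V z) (V a) ℚ.≟ 0ℚ | cross (V z) (V b) ℚ.≟ 0ℚ
  ... | no za | _ = inj₁ za
  ... | yes _ | no zb = inj₂ zb
  -- With both factors zero, the three-term relation reduces to (zt)(ab) = 0.
  ... | yes za≡0 | yes zb≡0 = ⊥-elim (*-≢0 zt ab (product≡0 (plücker (V z) (V t) (V a) (V b))))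
    where
    product≡0 : cross (V z) (V a) ℚ.* cross (V t) (V b) ≡
      cross (V z) (V t) ℚ.* cross (V a) (V b) ℚ.+ cross (V z) (V b) ℚ.* cross (V t) (V a) →
      cross (V z) (V t) ℚ.* cross (V a) (V b) ≡ 0ℚ
    product≡0 eq = begin
      P                           ≡⟨ sym (ℚ.+-identityʳ P) ⟩
      P ℚ.+ 0ℚ                    ≡⟨ cong (P ℚ.+_) (sym (trans (cong (ℚ._* X) zb≡0) (ℚ.*-zeroˡ X))) ⟩
      P ℚ.+ cross (V z) (V b) ℚ.* X ≡⟨ sym eq ⟩
      cross (V z) (V a) ℚ.* Y     ≡⟨ trans (cong (ℚ._* Y) za≡0) (ℚ.*-zeroˡ Y) ⟩
      0ℚ                          ∎
      where
      open ≡-Reasoning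
      P = cross (V z) (V t) ℚ.* cross (V a) (V b)
      X = cross (V t) (V a)
      Y = cross (V t) (V b)

-- In (ac)(bd) = (ab)(cd) + (ad)(bc) the summands on the right are nonnegative and the first is
-- nonzero, so the left side cannot vanish.
ordered-noncrossing : ∀ {n} {pos : Fin n → ℕ} {V : Fin n → Plane} → Ordered pos V → Noncrossing pos (Independent V)
ordered-noncrossing {V = V} ord {a} {b} {c} {d} a<b b<c c<d ab cd =
  *-≢0ˡ _ (cross (V b) (V d)) ac*bd≢0 , *-≢0ʳ (cross (V a) (V c)) _ ac*bd≢0
  where
  ac*bd≢0 : cross (V a) (V c) ℚ.* cross (V b) (V d) ≢ 0ℚ
  ac*bd≢0 eq = *-≢0 ab cd (nonneg-+≡0ˡ
    (*-nonneg (ord a b a<b) (ord c d c<d))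
    (*-nonneg (ord a d (ℕ.<-trans a<b (ℕ.<-trans b<c c<d))) (ord b c b<c))
    (trans (sym (plücker (V a) (V b) (V c) (V d))) eq))

toMatrix : ∀ {n} → (Fin n → Plane) → Fin 2 → Fin n → ℚ
toMatrix V Fin.zero    x = proj₁ (V x)
toMatrix V (Fin.suc _) x = proj₂ (V x)

columns : ∀ {n} → (Fin 2 → Fin n → ℚ) → Fin n → Plane
columns A x = A Fin.zero x , A (Fin.suc Fin.zero) x

minor₂ : ∀ {n} (A : Fin 2 → Fin n → ℚ) (σ : Fin 2 → Fin n) →
  minor A σ ≡ cross (columns A (σ Fin.zero)) (columns A (σ (Fin.suc Fin.zero)))
minor₂ A σ = solve 4 (λ a b c d →
    con 1ℚ :* (a :* (con 1ℚ :* (d :* con 1ℚ) :+ con 0ℚ)) :+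
      ((:- con 1ℚ) :* (c :* (con 1ℚ :* (b :* con 1ℚ) :+ con 0ℚ)) :+ con 0ℚ)
    := a :* d :- c :* b) refl
  (A Fin.zero (σ Fin.zero)) (A (Fin.suc Fin.zero) (σ Fin.zero))
  (A Fin.zero (σ (Fin.suc Fin.zero))) (A (Fin.suc Fin.zero) (σ (Fin.suc Fin.zero)))
  where open +-*-Solver

twoColumns : ∀ {n} → Fin n → Fin n → Fin 2 → Fin n
twoColumns x y Fin.zero    = x
twoColumns x y (Fin.suc _) = y

twoColumns-increasing : ∀ {n} {x y : Fin n} → x Fin.< y → StrictlyIncreasing (twoColumns x y)
twoColumns-increasing x<y Fin.zero    (Fin.suc Fin.zero) _ = x<y
twoColumns-increasing x<y (Fin.suc Fin.zero) (Fin.suc Fin.zero) (s≤s ())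

PairsOf : ∀ {n} → (Fin n → Fin n → Set) → Coll n
PairsOf E B = ∃[ x ] ∃[ y ] B ≡ pair x y × E x y

PairsOf-pair : ∀ {n} {E : Fin n → Fin n → Set} → Simple E → ∀ {x y} → PairsOf E (pair x y) → E x y
PairsOf-pair {E = E} simple {x} {y} (a , b , eq , ab) with pair-injective (Simple.adj⇒≢ simple ab) (sym eq)
... | inj₁ (refl , refl) = ab
... | inj₂ (refl , refl) = Simple.symm simple ab

ImageIs-pair : ∀ {n} {σ : Fin 2 → Fin n} {B : Subset n} → ImageIs σ B → B ≡ pair (σ Fin.zero) (σ (Fin.suc Fin.zero))
ImageIs-pair {σ = σ} {B} im = ⊆-antisym into
  (pair⊆ (Equivalence.from (im _) (_ , refl)) (Equivalence.from (im _) (_ , refl)))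
  where
  into : B ⊆ pair (σ Fin.zero) (σ (Fin.suc Fin.zero))
  into {x} x∈ with Equivalence.to (im x) x∈
  ... | Fin.zero , refl = ∈pairˡ
  ... | Fin.suc Fin.zero , refl = ∈pairʳ

MatroidOf⇔PairsOf : ∀ {n} (A : Fin 2 → Fin n → ℚ) → MatroidOf A ≐ᶜ PairsOf (Independent (columns A))
MatroidOf⇔PairsOf A B = mk⇔ to from
  where
  to : MatroidOf A B → PairsOf (Independent (columns A)) B
  to (σ , inc , im , nz) = _ , _ , ImageIs-pair im , λ eq → nz (trans (minor₂ A σ) eq)
  from< : ∀ {x y} → x Fin.< y → Independent (columns A) x y → MatroidOf A (pair x y)
  from< {x} {y} x<y e = twoColumns x y , twoColumns-increasing x<y , image ,
    λ eq → e (trans (sym (minor₂ A (twoColumns x y))) eq)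
    where
    image : ImageIs (twoColumns x y) (pair x y)
    image z = mk⇔ into onto
      where
      into : z ∈ pair x y → ∃[ i ] twoColumns x y i ≡ z
      into z∈ with ∈pair⁻ {x = x} {y} z∈
      ... | inj₁ refl = Fin.zero , refl
      ... | inj₂ refl = Fin.suc Fin.zero , refl
      onto : ∃[ i ] twoColumns x y i ≡ z → z ∈ pair x y
      onto (Fin.zero , refl) = ∈pairˡ
      onto (Fin.suc _ , refl) = ∈pairʳ
  from : PairsOf (Independent (columns A)) B → MatroidOf A B
  from (x , y , refl , e) with Fin.<-cmp x y
  ... | tri< x<y _ _ = from< x<y e
  ... | tri≈ _ refl _ = ⊥-elim (e (cross-self (columns A x)))
  ... | tri> _ _ y<x = subst (MatroidOf A) (pair-comm y x) (from< y<x (cross≢0-sym {columns A x} {columns A y} e))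

-- After removing x from {x, a}, `triangle` finds an element of the other basis independent of a.
PairsOf-isMatroid : ∀ {n} {E : Fin n → Fin n → Set} → Simple E → ∃[ x ] ∃[ y ] E x y → IsMatroid (PairsOf E)
PairsOf-isMatroid {n} {E} simple (x₀ , y₀ , e₀) = (pair x₀ y₀ , x₀ , y₀ , refl , e₀) , exchange
  where
  open Simple simple
  replace-by : ∀ {B₂} x a z → E x a → x ∉ B₂ → z ∈ B₂ → E a z →
    ∃[ z ] (z ∈ B₂ × z ∉ pair x a × PairsOf E (swap (pair x a) x z))
  replace-by {B₂} x a z xa x∉ z∈ az = z , z∈ , fresh , a , z , swap≡ , az
    where
    fresh : z ∉ pair x a
    fresh z∈′ with ∈pair⁻ z∈′
    ... | inj₁ refl = x∉ z∈
    ... | inj₂ refl = irrefl az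
    to : swap (pair x a) x z ⊆ pair a z
    to w∈ with ∈swap⁻ w∈
    ... | inj₂ refl = ∈pairʳ
    ... | inj₁ (w≢x , w∈′) with ∈pair⁻ w∈′
    ...   | inj₁ w≡x = ⊥-elim (w≢x w≡x)
    ...   | inj₂ refl = ∈pairˡ
    swap≡ : swap (pair x a) x z ≡ pair a z
    swap≡ = ⊆-antisym to (pair⊆ (∈swap-old (λ { refl → irrefl xa }) ∈pairʳ) ∈swap-new)
  replace : ∀ x a y b → E x a → E y b → x ∉ pair y b →
    ∃[ z ] (z ∈ pair y b × z ∉ pair x a × PairsOf E (swap (pair x a) x z))
  replace x a y b xa yb x∉ with triangle yb (symm xa)
  ... | inj₁ ay = replace-by x a y xa x∉ ∈pairˡ ay
  ... | inj₂ ab = replace-by x a b xa x∉ ∈pairʳ ab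
  exchange : ∀ B₁ B₂ → PairsOf E B₁ → PairsOf E B₂ → ∀ x → x ∈ B₁ → x ∉ B₂ →
    ∃[ y ] (y ∈ B₂ × y ∉ B₁ × PairsOf E (swap B₁ x y))
  exchange _ _ (x₁ , a , refl , xa) (y , b , refl , yb) x x∈ x∉ with ∈pair⁻ x∈
  ... | inj₁ refl = replace x a y b xa yb x∉
  ... | inj₂ refl rewrite pair-comm x₁ x = replace x x₁ y b (symm xa) yb x∉

independent-isPositroid : ∀ {n} {V : Fin n → Plane} → Ordered toℕ V → ∃[ x ] ∃[ y ] Independent V x y →
  IsPositroid n 2 (PairsOf (Independent V))
independent-isPositroid {n} {V} ordered nonempty =
  PairsOf-isMatroid simple nonempty ,
  (λ { _ (x , y , refl , e) → pair-card (Simple.adj⇒≢ simple e) }) ,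
  toMatrix V ,
  (λ σ inc → subst (0ℚ ℚ.≤_) (sym (minor₂ (toMatrix V) σ)) (ordered _ _ (inc Fin.zero (Fin.suc Fin.zero) (s≤s z≤n)))) ,
  λ B → mk⇔ (Equivalence.from (MatroidOf⇔PairsOf (toMatrix V) B)) (Equivalence.to (MatroidOf⇔PairsOf (toMatrix V) B))
  where simple = independent-simple V

Adj : ∀ {n} → Coll n → Fin n → Fin n → Set
Adj N x y = N (pair x y)

record Rank2 {n} (N : Coll n) : Set where
  field
    vectors : Fin n → Plane
    ordered : Ordered toℕ vectors
    pairs   : N ≐ᶜ PairsOf (Independent vectors)
    basis   : ∃[ x ] ∃[ y ] Adj N x y

  adj⇒ind : ∀ {x y} → Adj N x y → Independent vectors x y
  adj⇒ind = PairsOf-pair (independent-simple vectors) ∘ Equivalence.to (pairs _)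

  ind⇒adj : ∀ {x y} → Independent vectors x y → Adj N x y
  ind⇒adj e = Equivalence.from (pairs _) (_ , _ , refl , e)

  simple : Simple (Adj N)
  simple = record
    { adj?     = λ x y → map′ ind⇒adj adj⇒ind (Simple.adj? I x y)
    ; irrefl   = Simple.irrefl I ∘ adj⇒ind
    ; symm     = ind⇒adj ∘ Simple.symm I ∘ adj⇒ind
    ; triangle = λ e f → Sum.map ind⇒adj ind⇒adj (Simple.triangle I (adj⇒ind e) (adj⇒ind f))
    }
    where I = independent-simple vectors

  open Simple simple public

  isPair : ∀ {B} → N B → ∃[ x ] ∃[ y ] B ≡ pair x y × Adj N x y
  isPair NB with Equivalence.to (pairs _) NB
  ... | x , y , eq , e = x , y , eq , ind⇒adj e

  -- V need not be `vectors`: a rotated order is realized by sign-changed vectors with the same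
  -- independent pairs.
  noncrossing : ∀ {pos} {V : Fin n → Plane} → Ordered pos V →
    (∀ {x y} → Independent V x y ⇔ Independent vectors x y) → Noncrossing pos (Adj N)
  noncrossing {V = V} ord V⇔ a<b b<c c<d ab cd =
    Product.map back back (ordered-noncrossing {V = V} ord a<b b<c c<d (forth ab) (forth cd))
    where
    back = λ {x y} → ind⇒adj {x} {y} ∘ Equivalence.to V⇔
    forth = λ {x y} → Equivalence.from V⇔ ∘ adj⇒ind {x} {y}

positroid⇒rank2 : ∀ {n} {N : Coll n} → IsPositroid n 2 N → Rank2 N
positroid⇒rank2 {n} {N} (((B , NB) , _) , _ , A , tnn , N≐) = record
  { vectors = columns A
  ; ordered = λ x y x<y → subst (0ℚ ℚ.≤_) (minor₂ A (twoColumns x y)) (tnn _ (twoColumns-increasing x<y))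
  ; pairs   = N⇔
  ; basis   = let x , y , eq , _ = Equivalence.to (N⇔ B) NB in x , y , subst N eq NB
  }
  where
  N⇔ : N ≐ᶜ PairsOf (Independent (columns A))
  N⇔ B = mk⇔ (Equivalence.to (MatroidOf⇔PairsOf A B) ∘ Equivalence.to (N≐ B))
              (Equivalence.from (N≐ B) ∘ Equivalence.from (MatroidOf⇔PairsOf A B))

-- Lifting rank 2 positroids

-- The cyclic predecessor and successor of `p`. In the cyclic order l, p, r, z the pairs z l and p r
-- do not cross; `separate` records the outcome once for every place where this cycle is cut open.
record Neighbours {n} (k : ℕ) (p : Fin (suc n)) : Set₁ where
  field
    l r           : Fin (suc n)
    εˡ εʳ         : ℚ
    l≢p           : l ≢ p
    r≢p           : r ≢ p
    admissibleˡ   : Admissible k p l εˡ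
    admissibleʳ   : Admissible k p r εʳ
    separate      : ∀ {E : Fin (suc n) → Fin (suc n) → Set} → Simple E → Noncrossing toℕ E →
      ∀ {z} → z ≢ p → z ≢ l → z ≢ r → E z l → E z r → E p l → E p r → E z p × E l r

neighbours-interior : ∀ {n} k {l p r : Fin (suc n)} → toℕ p ≡ suc (toℕ l) → toℕ r ≡ suc (toℕ p) → Neighbours k p
neighbours-interior {n} k {l} {p} {r} p≡1+l r≡1+p = record
  { l = l ; r = r ; εˡ = 1ℚ ; εʳ = 1ℚ
  ; l≢p = λ { refl → ℕ.1+n≢n (sym p≡1+l) } ; r≢p = λ { refl → ℕ.1+n≢n (sym r≡1+p) }
  ; admissibleˡ = admissible-pred p≡1+l ; admissibleʳ = admissible-succ r≡1+p
  ; separate = separate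
  }
  where
  l<p = ℕ.≤-reflexive (sym p≡1+l)
  p<r = ℕ.≤-reflexive (sym r≡1+p)
  separate : ∀ {E : Fin (suc n) → Fin (suc n) → Set} → Simple E → Noncrossing toℕ E →
    ∀ {z} → z ≢ p → z ≢ l → z ≢ r → E z l → E z r → E p l → E p r → E z p × E l r
  separate simple nc {z} z≢p z≢l z≢r zl zr pl pr with Fin.<-cmp z l
  ... | tri< z<l _ _ = nc z<l l<p p<r zl pr
  ... | tri≈ _ z≡l _ = ⊥-elim (z≢l z≡l)
  ... | tri> _ _ l<z = Product.swap (Product.map₂ symm (nc l<p p<r r<z (symm pl) (symm zr)))
    where
    open Simple simple
    p<z : p Fin.< z
    p<z = Fin.≤∧≢⇒< (subst (_≤ toℕ z) (sym p≡1+l) l<z) (≢-sym z≢p)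
    r<z : r Fin.< z
    r<z = Fin.≤∧≢⇒< (subst (_≤ toℕ z) (sym r≡1+p) p<z) (≢-sym z≢r)

neighbours-first : ∀ {n} k {l p r : Fin (suc n)} → toℕ p ≡ 0 → toℕ r ≡ 1 → toℕ l ≡ n → Neighbours k p
neighbours-first {n} k {l} {p} {r} p≡0 r≡1 l≡n = record
  { l = l ; r = r ; εˡ = sgn k ; εʳ = 1ℚ
  ; l≢p = λ { refl → ℕ.<⇒≱ (Fin.toℕ<n r) (subst₂ _≤_ (cong suc (trans (sym p≡0) l≡n)) (sym r≡1) ℕ.≤-refl) }
  ; r≢p = λ { refl → ℕ.0≢1+n (trans (sym p≡0) r≡1) }
  ; admissibleˡ = admissible-last p≡0 l≡n ; admissibleʳ = admissible-succ (trans r≡1 (cong suc (sym p≡0)))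
  ; separate = separate
  }
  where
  p<r : p Fin.< r
  p<r = subst₂ _<_ (sym p≡0) (sym r≡1) (s≤s z≤n)
  separate : ∀ {E : Fin (suc n) → Fin (suc n) → Set} → Simple E → Noncrossing toℕ E →
    ∀ {z} → z ≢ p → z ≢ l → z ≢ r → E z l → E z r → E p l → E p r → E z p × E l r
  separate simple nc {z} z≢p z≢l z≢r zl zr pl pr = Product.map symm symm (nc p<r r<z z<l pr zl)
    where
    open Simple simple
    r<z : r Fin.< z
    r<z = Fin.≤∧≢⇒< (subst (_≤ toℕ z) (sym r≡1)
      (subst (_< toℕ z) p≡0 (Fin.≤∧≢⇒< (subst (_≤ toℕ z) (sym p≡0) z≤n) (≢-sym z≢p))))
      (≢-sym z≢r)
    z<l : z Fin.< l
    z<l = Fin.≤∧≢⇒< (subst (toℕ z ≤_) (sym l≡n) (ℕ.≤-pred (Fin.toℕ<n z))) z≢l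

neighbours-last : ∀ {n} k {l p r : Fin (suc n)} → toℕ p ≡ n → toℕ r ≡ 0 → toℕ p ≡ suc (toℕ l) → Neighbours k p
neighbours-last {n} k {l} {p} {r} p≡n r≡0 p≡1+l = record
  { l = l ; r = r ; εˡ = 1ℚ ; εʳ = sgn k
  ; l≢p = λ { refl → ℕ.1+n≢n (sym p≡1+l) }
  ; r≢p = λ { refl → ℕ.0≢1+n (trans (sym r≡0) p≡1+l) }
  ; admissibleˡ = admissible-pred p≡1+l ; admissibleʳ = admissible-first p≡n r≡0
  ; separate = separate
  }
  where
  l<p = ℕ.≤-reflexive (sym p≡1+l)
  separate : ∀ {E : Fin (suc n) → Fin (suc n) → Set} → Simple E → Noncrossing toℕ E →
    ∀ {z} → z ≢ p → z ≢ l → z ≢ r → E z l → E z r → E p l → E p r → E z p × E l r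
  separate simple nc {z} z≢p z≢l z≢r zl zr pl pr =
    Product.swap (Product.map symm (λ zp → zp) (nc r<z z<l l<p (symm zr) (symm pl)))
    where
    open Simple simple
    r<z : r Fin.< z
    r<z = Fin.≤∧≢⇒< (subst (_≤ toℕ z) (sym r≡0) z≤n) (≢-sym z≢r)
    z<p : z Fin.< p
    z<p = Fin.≤∧≢⇒< (subst (toℕ z ≤_) (sym p≡n) (ℕ.≤-pred (Fin.toℕ<n z))) z≢p
    z<l : z Fin.< l
    z<l = Fin.≤∧≢⇒< (ℕ.≤-pred (subst (toℕ z <_) p≡1+l z<p)) z≢l

neighbours : ∀ {n} k (p : Fin (suc (suc n))) → Neighbours k p
neighbours {n} k Fin.zero =
  neighbours-first k {l = Fin.fromℕ (suc n)} {r = Fin.suc Fin.zero} refl refl (Fin.toℕ-fromℕ (suc n))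
neighbours {n} k p@(Fin.suc i) with toℕ i ℕ.≟ n
... | yes i≡n = neighbours-last k {l = Fin.inject₁ i} {r = Fin.zero} (cong suc i≡n) refl (cong suc (sym (Fin.toℕ-inject₁ i)))
... | no  i≢n = neighbours-interior k {l = Fin.inject₁ i} {r = Fin.fromℕ< r<}
  (cong suc (sym (Fin.toℕ-inject₁ i))) (Fin.toℕ-fromℕ< r<)
  where
  r< : suc (suc (toℕ i)) < suc (suc n)
  r< = s≤s (s≤s (ℕ.≤∧≢⇒< (ℕ.≤-pred (Fin.toℕ<n i)) i≢n))

-- Independence of a pair in the dual, so for x ≢ y these are the pairs of `Down2 M`.
Coindependent : ∀ {n} → Coll n → Fin n → Fin n → Set
Coindependent M x y = ∃[ B ] M B × x ∉ B × y ∉ B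

Clique : ∀ {n} → (Fin n → Fin n → Set) → Subset n → Set
Clique E J = ∀ {x y} → x ∈ J → y ∈ J → x ≢ y → E x y

-- A rank k positroid M whose M^{↓2} has the graph E. Distinctness is required since an element
-- missed by some basis is coindependent with itself.
record Lifting {n} (k : ℕ) (E : Fin n → Fin n → Set) : Set₁ where
  field
    bases      : Coll n
    isPositroid : IsPositroid n k bases
    coindependent : ∀ {x y} → x ≢ y → Coindependent bases x y ⇔ E x y

-- In the dual of the new matroid p is placed freely on the flat spanned by F ∖ {p}.
module _ {n k : ℕ} {E : Fin (suc n) → Fin (suc n) → Set} (simple : Simple E) (p : Fin (suc n)) where
  open Simple simple

  module _ (F : Subset (suc n)) (p∈F : p ∈ F) (ε : Fin (suc n) → ℚ)
    (admissible : ∀ x → x ∈ F → Admissible k p x (ε x))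
    (spans : ∀ {y} → E p y → ∃[ f ] f ∈ F × f ≢ p × E f y)
    (spanned : ∀ {y f} → y ≢ p → f ∈ F → f ≢ p → E f y → E p y)
    (L : Lifting k (λ x y → E (punchIn p x) (punchIn p y))) where

    open Lifting L renaming (bases to M; isPositroid to M-isPositroid; coindependent to M-coindependent)

    -- A basis of the union is `C` plus an element f of F. If it misses p and y, then f ≢ p and C
    -- misses f and y, so y is a neighbour of an element of F ∖ {p}; `spans` and `spanned` identify
    -- these y with the neighbours of p. Two old elements missed by C are still missed by C plus p.
    adjoin : Lifting (suc k) E
    adjoin = record
      { bases = M⁺
      ; isPositroid = M⁺-isMatroid , M⁺-card , matrix , matrix-tnn tnn , M⁺≐
      ; coindependent = λ x≢y → mk⇔ (to x≢y) (from _ _)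
      }
      where
      A = proj₁ (proj₂ (proj₂ M-isPositroid))
      tnn = proj₁ (proj₂ (proj₂ (proj₂ M-isPositroid)))
      open Adjoin A p F ε admissible
      M⁺ : Coll (suc n)
      M⁺ = Join F (AddLoop p M)
      M⁺≐ : M⁺ ≐ᶜ MatroidOf matrix
      M⁺≐ = matroid-matrix tnn M (proj₂ (proj₂ (proj₂ (proj₂ M-isPositroid))))
      M⁺-isMatroid : IsMatroid M⁺
      M⁺-isMatroid = Join-isMatroid F (AddLoop-isMatroid p (proj₁ M-isPositroid))
        (λ { (C , _ , refl) → p , p∈F , p∉lift p {C} })
      M⁺-card : ∀ B → M⁺ B → ∣ B ∣ ≡ suc k
      M⁺-card B MB with Equivalence.to (M⁺≐ B) MB
      ... | σ , inc , im , _ = image-card (increasing-injective inc) im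
      old-to : ∀ {C x y} → M C → punchIn p x ≢ punchIn p y → punchIn p x ∉ lift p C → punchIn p y ∉ lift p C →
        E (punchIn p x) (punchIn p y)
      old-to MC x≢y x∉ y∉ = Equivalence.to (M-coindependent (λ { refl → x≢y refl })) (_ , MC , x∉ ∘ ∈lift⁺ p , y∉ ∘ ∈lift⁺ p)
      old-from : ∀ {x y} → E (punchIn p x) (punchIn p y) → ∃[ C ] M C × x ∉ C × y ∉ C
      old-from e = Equivalence.from (M-coindependent (λ { refl → irrefl e })) e
      p-to : ∀ {C f y} → M C → f ∈ F → f ∉ lift p C → p ∉ lift p C ∪ ⁅ f ⁆ → punchIn p y ∉ lift p C ∪ ⁅ f ⁆ → E p (punchIn p y)
      p-to {C} {f} {y} MC f∈F f∉ p∉ y∉ with punchView p f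
      ... | hole = ⊥-elim (p∉ ∈∪⁅⁆-new)
      ... | other f′ = spanned (Fin.punchInᵢ≢i p y) f∈F (Fin.punchInᵢ≢i p f′)
        (old-to MC (λ eq → y∉ (subst (λ z → punchIn p y ∈ lift p C ∪ ⁅ z ⁆) (sym eq) ∈∪⁅⁆-new)) f∉ (y∉ ∘ ∈∪⁅⁆-old))
      to : ∀ {x y} → x ≢ y → Coindependent M⁺ x y → E x y
      to {x} {y} x≢y (_ , (_ , f , (C , MC , refl) , f∈F , f∉ , refl) , x∉ , y∉) with punchView p x | punchView p y
      ... | hole    | hole    = ⊥-elim (x≢y refl)
      ... | hole    | other y = p-to MC f∈F f∉ x∉ y∉
      ... | other x | hole    = symm (p-to MC f∈F f∉ y∉ x∉)
      ... | other x | other y = old-to MC x≢y (x∉ ∘ ∈∪⁅⁆-old) (y∉ ∘ ∈∪⁅⁆-old)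
      avoid : ∀ {C x f} → x ∉ C → x ≢ f → punchIn p x ∉ lift p C ∪ ⁅ punchIn p f ⁆
      avoid x∉C x≢f x∈ with ∈∪⁅⁆⁻ x∈
      ... | inj₁ x∈C = x∉C (∈lift⁻ p x∈C)
      ... | inj₂ eq  = x≢f (Fin.punchIn-injective p _ _ eq)
      p-from : ∀ y → E p y → Coindependent M⁺ p y
      p-from y py with spans py
      ... | f , f∈F , f≢p , fy with punchView p f | punchView p y
      ...   | hole     | _        = ⊥-elim (f≢p refl)
      ...   | other f′ | hole     = ⊥-elim (irrefl py)
      ...   | other f′ | other y′ with old-from fy
      ...     | C , MC , f∉ , y∉ = _ , (lift p C , punchIn p f′ , (C , MC , refl) , f∈F , f∉ ∘ ∈lift⁻ p , refl) ,
        p∉ , avoid y∉ (λ { refl → irrefl fy })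
        where
        p∉ : p ∉ lift p C ∪ ⁅ punchIn p f′ ⁆
        p∉ p∈ with ∈∪⁅⁆⁻ p∈
        ... | inj₁ p∈C = p∉lift p {C} p∈C
        ... | inj₂ eq  = Fin.punchInᵢ≢i p f′ (sym eq)
      from : ∀ x y → E x y → Coindependent M⁺ x y
      from x y xy with punchView p x | punchView p y
      ... | hole | _ = p-from y xy
      ... | other x′ | hole = let B , MB , p∉ , x∉ = p-from x (symm xy) in B , MB , x∉ , p∉
      ... | other x′ | other y′ with old-from xy
      ...   | C , MC , x∉ , y∉ = lift p C ∪ ⁅ p ⁆ , (lift p C , p , (C , MC , refl) , p∈F , p∉lift p {C} , refl) ,
        miss x∉ , miss y∉
        where
        miss : ∀ {x} → x ∉ C → punchIn p x ∉ lift p C ∪ ⁅ p ⁆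
        miss {x} x∉C x∈ with ∈∪⁅⁆⁻ x∈
        ... | inj₁ x∈C = x∉C (∈lift⁻ p x∈C)
        ... | inj₂ eq  = Fin.punchInᵢ≢i p x eq

module _ {n k : ℕ} {E : Fin (suc (suc n)) → Fin (suc (suc n)) → Set} (simple : Simple E) (nc : Noncrossing toℕ E)
  (p : Fin (suc (suc n))) where
  open Simple simple
  open Neighbours (neighbours k p)

  private
    -- On a two-element ground set `l` and `r` coincide, and the order of the tests then selects
    -- `εˡ`.
    weight : Fin (suc (suc n)) → ℚ
    weight x with x Fin.≟ p | x Fin.≟ l
    ... | yes _ | _     = 1ℚ
    ... | no _  | yes _ = εˡ
    ... | no _  | no _  = εʳ

    Near : Fin (suc (suc n)) → Set
    Near x = x ≡ p ⊎ x ≡ l ⊎ x ≡ r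

    weight-admissible : ∀ x → Near x → Admissible k p x (weight x)
    weight-admissible x near with x Fin.≟ p | x Fin.≟ l
    ... | yes refl | _       = admissible-self
    ... | no _     | yes refl = admissibleˡ
    weight-admissible x (inj₁ x≡p)        | no x≢p | no _   = ⊥-elim (x≢p x≡p)
    weight-admissible x (inj₂ (inj₁ x≡l)) | no _   | no x≢l = ⊥-elim (x≢l x≡l)
    weight-admissible x (inj₂ (inj₂ refl)) | no _  | no _   = admissibleʳ

  module _ (L : Lifting k (λ x y → E (punchIn p x) (punchIn p y))) where

    private
      adjoin-near : (F : Subset (suc (suc n))) → p ∈ F → (∀ {x} → x ∈ F → Near x) →
        (∀ {y} → E p y → ∃[ f ] f ∈ F × f ≢ p × E f y) →
        (∀ {y f} → y ≢ p → f ∈ F → f ≢ p → E f y → E p y) → Lifting (suc k) E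
      adjoin-near F p∈F near spans spanned = adjoin simple p F p∈F weight
        (λ x x∈F → weight-admissible x (near x∈F)) spans spanned L

    -- F = {p} puts p into every basis, so p is a loop of the dual.
    adjoin-loop : ¬ ∃ (E p) → Lifting (suc k) E
    adjoin-loop p-loop = adjoin-near ⁅ p ⁆ (x∈⁅x⁆ p) (inj₁ ∘ x∈⁅y⁆⇒x≡y p)
      (λ py → ⊥-elim (p-loop (_ , py)))
      (λ _ f∈ f≢p → ⊥-elim (f≢p (x∈⁅y⁆⇒x≡y p f∈)))

    -- A cyclic neighbour q parallel to p spans the flat of p by itself, so the new row is supported
    -- on p and q.
    adjoin-parallel : ∀ {q} → q ≢ p → Near q → ∃ (E p) → ∃ (E q) → ¬ E p q → Lifting (suc k) E
    adjoin-parallel {q} q≢p q-near (_ , pt) (_ , qt) ¬pq = adjoin-near (pair p q) ∈pairˡ near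
      (λ py → q , ∈pairʳ , q≢p , par-trans py ¬pq qt)
      (λ _ → spanned)
      where
      near : ∀ {x} → x ∈ pair p q → Near x
      near x∈ with ∈pair⁻ x∈
      ... | inj₁ refl = inj₁ refl
      ... | inj₂ refl = q-near
      spanned : ∀ {f y} → f ∈ pair p q → f ≢ p → E f y → E p y
      spanned f∈ f≢p fy with ∈pair⁻ f∈
      ... | inj₁ f≡p = ⊥-elim (f≢p f≡p)
      ... | inj₂ refl = par-trans fy (¬pq ∘ symm) pt

    -- Here l and r span the whole plane, and p has to be independent of all other nonloops. A
    -- nonloop z parallel to p would be independent of both l and r, and `separate` would then make
    -- z and p independent.
    adjoin-generic : ∀ {j₁ j₂} → j₁ ≢ p → j₂ ≢ p → E j₁ j₂ → E p l → E p r → Lifting (suc k) E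
    adjoin-generic {j₁} {j₂} j₁≢p j₂≢p j₁j₂ pl pr = adjoin-near (pair l r ∪ ⁅ p ⁆) ∈∪⁅⁆-new near spans spanned
      where
      near : ∀ {x} → x ∈ pair l r ∪ ⁅ p ⁆ → Near x
      near x∈ with ∈∪⁅⁆⁻ x∈
      ... | inj₂ x≡p = inj₁ x≡p
      ... | inj₁ x∈lr = inj₂ (∈pair⁻ x∈lr)
      -- If l and r were parallel, j would be independent of both, and `separate` with z = j would
      -- contradict this.
      third : ∀ {j} → j ≢ p → E l j → E l r
      third {j} j≢p lj with adj? l r
      ... | yes lr = lr
      ... | no ¬lr = proj₂ (separate simple nc j≢p (≢-sym (adj⇒≢ lj)) (λ { refl → ¬lr lj })
        (symm lj) (symm (par-trans lj ¬lr (symm pr))) pl pr)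
      lr : E l r
      lr with triangle j₁j₂ (symm pl)
      ... | inj₁ lj₁ = third j₁≢p lj₁
      ... | inj₂ lj₂ = third j₂≢p lj₂
      spans : ∀ {y} → E p y → ∃[ f ] f ∈ pair l r ∪ ⁅ p ⁆ × f ≢ p × E f y
      spans {y} py with triangle lr (symm py)
      ... | inj₁ yl = l , ∈∪⁅⁆-old ∈pairˡ , l≢p , symm yl
      ... | inj₂ yr = r , ∈∪⁅⁆-old ∈pairʳ , r≢p , symm yr
      neighbour-spanned : ∀ {y f} → y ≢ p → f ≡ l ⊎ f ≡ r → E f y → E p y
      neighbour-spanned {y} y≢p f-near fy with adj? p y | y Fin.≟ l | y Fin.≟ r
      ... | yes py | _ | _ = py
      ... | no _ | yes refl | _ = pl
      ... | no _ | no _ | yes refl = pr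
      ... | no ¬py | no y≢l | no y≢r = symm (proj₁ (separate simple nc y≢p y≢l y≢r
        (par-trans pl ¬py (symm fy)) (par-trans pr ¬py (symm fy)) pl pr))
      spanned : ∀ {y f} → y ≢ p → f ∈ pair l r ∪ ⁅ p ⁆ → f ≢ p → E f y → E p y
      spanned y≢p f∈ f≢p fy with ∈∪⁅⁆⁻ f∈
      ... | inj₂ f≡p = ⊥-elim (f≢p f≡p)
      ... | inj₁ f∈lr = neighbour-spanned y≢p (∈pair⁻ f∈lr) fy

    -- Without loops, a neighbour of p that is not adjacent to p is parallel to it. This is what
    -- fails if loops are still present.
    adjoin-nonloop : (∀ x → ∃ (E x)) → ∀ {j₁ j₂} → j₁ ≢ p → j₂ ≢ p → E j₁ j₂ → Lifting (suc k) E
    adjoin-nonloop nonloop j₁≢p j₂≢p j₁j₂ with adj? p l | adj? p r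
    ... | no ¬pl | _      = adjoin-parallel l≢p (inj₂ (inj₁ refl)) (nonloop p) (nonloop l) ¬pl
    ... | yes _  | no ¬pr = adjoin-parallel r≢p (inj₂ (inj₂ refl)) (nonloop p) (nonloop r) ¬pr
    ... | yes pl | yes pr = adjoin-generic j₁≢p j₂≢p j₁j₂ pl pr

Simple-restrict : ∀ {n} {E : Fin (suc n) → Fin (suc n) → Set} p → Simple E → Simple (λ x y → E (punchIn p x) (punchIn p y))
Simple-restrict p simple = record
  { adj? = λ x y → adj? _ _ ; irrefl = irrefl ; symm = symm ; triangle = triangle }
  where open Simple simple

Noncrossing-restrict : ∀ {n} {E : Fin (suc n) → Fin (suc n) → Set} p → Noncrossing toℕ E →
  Noncrossing toℕ (λ x y → E (punchIn p x) (punchIn p y))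
Noncrossing-restrict p nc a<b b<c c<d = nc (punchIn-mono-< p a<b) (punchIn-mono-< p b<c) (punchIn-mono-< p c<d)

lift-card : ∀ {n} (p : Fin (suc n)) (C : Subset n) → ∣ lift p C ∣ ≡ ∣ C ∣
lift-card Fin.zero    C             = refl
lift-card (Fin.suc p) (outside ∷ C) = lift-card p C
lift-card (Fin.suc p) (inside  ∷ C) = cong suc (lift-card p C)

restrict : ∀ {n} (p : Fin (suc n)) (J : Subset (suc n)) → p ∉ J →
  ∃[ J′ ] ∣ J′ ∣ ≡ ∣ J ∣ × (∀ {x} → x ∈ J′ → punchIn p x ∈ J)
restrict p J p∉J = J′ , trans (sym (lift-card p J′)) (cong ∣_∣ (⊆-antisym to from)) , ∈select⁻ (λ x → punchIn p x ∈? J)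
  where
  J′ = select (λ x → punchIn p x ∈? J)
  to : lift p J′ ⊆ J
  to {x} x∈ with punchView p x
  ... | hole    = ⊥-elim (p∉lift p {J′} x∈)
  ... | other y = ∈select⁻ (λ x → punchIn p x ∈? J) (∈lift⁻ p x∈)
  from : J ⊆ lift p J′
  from {x} x∈ with punchView p x
  ... | hole    = ⊥-elim (p∉J x∈)
  ... | other y = ∈lift⁺ p (∈select⁺ (λ x → punchIn p x ∈? J) x∈)

lifting-full : ∀ {n} {E : Fin n → Fin n → Set} → (∀ {x y} → x ≢ y → E x y) → Lifting 0 E
lifting-full {n} full = record
  { bases = _≡ ⊥
  ; isPositroid = ((⊥ , refl) , (λ { _ _ refl refl x x∈ _ → ⊥-elim (Subset.∉⊥ x∈) })) ,
      (λ { _ refl → Subset.∣⊥∣≡0 n }) ,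
      (λ ()) , (λ _ _ → ℚ.nonNegative⁻¹ 1ℚ) , λ B → mk⇔
        (λ { refl → (λ ()) , (λ ()) , (λ x → mk⇔ (λ x∈ → ⊥-elim (Subset.∉⊥ x∈)) (λ { (() , _) })) , λ () })
        (λ { (σ , _ , im , _) → ⊆-antisym (λ {x} x∈ → case-empty (Equivalence.to (im x) x∈)) (Subset.⊆-min B) })
  ; coindependent = λ x≢y → mk⇔ (λ _ → full x≢y) (λ _ → ⊥ , refl , Subset.∉⊥ , Subset.∉⊥)
  }
  where
  open Data.Fin.Subset using (⊥)
  case-empty : ∀ {n} {σ : Fin 0 → Fin n} {x} {A : Set} → ∃[ i ] σ i ≡ x → A
  case-empty (() , _)

-- Induction on k, removing an element outside J each time. J survives every restriction, so an
-- independent pair is always left, and at k = 0 it is the whole ground set, whence E is complete.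
lifting : ∀ k {n} {E : Fin n → Fin n → Set} → Simple E → Noncrossing toℕ E →
  (J : Subset n) → Clique E J → ∣ J ∣ + k ≡ n → 2 ≤ ∣ J ∣ → Lifting k E
lifting zero {n} {E} simple nc J clique |J|+0≡n 2≤ = lifting-full (λ {x} {y} → clique (full x) (full y))
  where
  full : ∀ x → x ∈ J
  full x = subst (x ∈_) (sym (Subset.∣p∣≡n⇒p≡⊤ (trans (sym (ℕ.+-identityʳ ∣ J ∣)) |J|+0≡n))) Subset.∈⊤
lifting (suc k) {zero} simple nc [] clique eq ()
lifting (suc k) {suc zero} simple nc J clique eq 2≤ = ⊥-elim (ℕ.<⇒≱ 2≤ (Subset.∣p∣≤n J))
lifting (suc k) {suc (suc n)} {E} simple nc J clique |J|+k≡n 2≤ = by-loops (Fin.any? (λ p → ¬? (nonloop? p)))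
  where
  open Simple simple
  induct : ∀ p → p ∉ J → Lifting k (λ x y → E (punchIn p x) (punchIn p y))
  induct p p∉J with restrict p J p∉J
  ... | J′ , card , sub = lifting k (Simple-restrict p simple) (Noncrossing-restrict {E = E} p nc) J′
    (λ x∈ y∈ x≢y → clique (sub x∈) (sub y∈) (x≢y ∘ Fin.punchIn-injective p _ _))
    (trans (cong (_+ k) card) (ℕ.suc-injective (trans (sym (ℕ.+-suc ∣ J ∣ k)) |J|+k≡n)))
    (subst (2 ≤_) (sym card) 2≤)
  -- Loops are removed first and thus put back last. A loop cannot lie in J, a clique with at least
  -- two elements.
  by-loops : Dec (∃[ p ] ¬ ∃ (E p)) → Lifting (suc k) E
  by-loops (yes (p , p-loop)) = adjoin-loop simple nc p (induct p p∉J) p-loop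
    where
    p∉J : p ∉ J
    p∉J p∈J with two-elements J 2≤
    ... | j₁ , j₂ , j₁∈ , j₂∈ , j₁≢j₂ with p Fin.≟ j₁
    ...   | no p≢j₁ = p-loop (_ , clique p∈J j₁∈ p≢j₁)
    ...   | yes refl = p-loop (_ , clique p∈J j₂∈ j₁≢j₂)
  by-loops (no no-loop) with Fin.any? (λ p → ¬? (p ∈? J)) | two-elements J 2≤
  ... | yes (p , p∉J) | j₁ , j₂ , j₁∈ , j₂∈ , j₁≢j₂ = adjoin-nonloop simple nc p (induct p p∉J)
    (λ x → decidable-stable (nonloop? x) (λ ¬nonloop → no-loop (x , ¬nonloop)))
    (λ { refl → p∉J j₁∈ }) (λ { refl → p∉J j₂∈ }) (clique j₁∈ j₂∈ j₁≢j₂)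
  -- J cannot be the whole ground set, because k + 1 elements lie outside it.
  ... | no ¬∃∉ | _ = ⊥-elim (ℕ.m+1+n≢m (suc (suc n)) (trans (cong (_+ suc k) (sym |J|≡)) |J|+k≡n))
    where
    |J|≡ : ∣ J ∣ ≡ suc (suc n)
    |J|≡ = trans (cong ∣_∣ (⊆-antisym (Subset.⊆-max J)
      (λ {x} _ → decidable-stable (x ∈? J) (λ x∉ → ¬∃∉ (x , x∉)))))
      (Subset.∣⊤∣≡n (suc (suc n)))

-- Membership in the poset

∁-involutive : ∀ {n} (X : Subset n) → ∁ (∁ X) ≡ X
∁-involutive X = ⊆-antisym (Subset.x∉∁p⇒x∈p ∘ x∈∁p⇒x∉p) (x∉p⇒x∈∁p ∘ Subset.x∈p⇒x∉∁p)

≐-sym : ∀ {n} {M N : Coll n} → M ≐ᶜ N → N ≐ᶜ M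
≐-sym M≐N B = mk⇔ (Equivalence.from (M≐N B)) (Equivalence.to (M≐N B))

≐-trans : ∀ {n} {M N O : Coll n} → M ≐ᶜ N → N ≐ᶜ O → M ≐ᶜ O
≐-trans M≐N N≐O B = mk⇔ (Equivalence.to (N≐O B) ∘ Equivalence.to (M≐N B))
  (Equivalence.from (M≐N B) ∘ Equivalence.from (N≐O B))

IsPositroid-resp-≐ : ∀ {n k} {M N : Coll n} → M ≐ᶜ N → IsPositroid n k M → IsPositroid n k N
IsPositroid-resp-≐ {M = M} {N} M≐N (((B₀ , MB₀) , exchange) , card , A , tnn , M≐A) =
  ((B₀ , to B₀ MB₀) , λ B₁ B₂ NB₁ NB₂ x x∈ x∉ →
    let y , y∈ , y∉ , M′ = exchange B₁ B₂ (from B₁ NB₁) (from B₂ NB₂) x x∈ x∉ in y , y∈ , y∉ , to _ M′) ,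
  (λ B NB → card B (from B NB)) , A , tnn , ≐-trans (≐-sym M≐N) M≐A
  where
  to : M ⊆ᶜ N
  to B = Equivalence.to (M≐N B)
  from : N ⊆ᶜ M
  from B = Equivalence.from (M≐N B)

⊆∧card⇒⊇ : ∀ {n} {X Y : Subset n} → X ⊆ Y → ∣ Y ∣ ≤ ∣ X ∣ → Y ⊆ X
⊆∧card⇒⊇ {X = X} {Y} X⊆Y |Y|≤|X| {y} y∈Y = decidable-stable (y ∈? X)
  (λ y∉X → ℕ.<⇒≱ (Subset.p⊂q⇒∣p∣<∣q∣ (X⊆Y , y , y∈Y , y∉X)) |Y|≤|X|)

-- The form in which n - k ≥ 2 is used: the clique contains an independent pair, and all its
-- elements are nonloops.
clique-size-≥2 : ∀ {m k n} → m + k ≡ n → k + 2 ≤ n → 2 ≤ m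
clique-size-≥2 {m} {k} refl k+2≤ = ℕ.+-cancelˡ-≤ k 2 m (subst (k + 2 ≤_) (ℕ.+-comm m k) k+2≤)

-- M^{↓2} is N itself, already a positroid, and is therefore its own envelope.
lifting⇒InP : ∀ {n k} {N : Coll n} → IsPositroid n 2 N → Rank2 N → Lifting k (Adj N) → InP n k N
lifting⇒InP {n} {k} {N} N-pos rank2 L = bases , isPositroid , N-pos , upper , least
  where
  open Rank2 rank2
  open Lifting L
  upper : Down2 bases ⊆ᶜ N
  upper B (|B|≡2 , I , M∁I , B⊆I) with card2⇒pair B |B|≡2
  ... | x , y , x≢y , refl = Equivalence.to (coindependent x≢y)
    (∁ I , M∁I , Subset.x∈p⇒x∉∁p (B⊆I ∈pairˡ) , Subset.x∈p⇒x∉∁p (B⊆I ∈pairʳ))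
  least : ∀ N′ → IsPositroid n 2 N′ → Down2 bases ⊆ᶜ N′ → N ⊆ᶜ N′
  least N′ _ ⊆N′ B NB with isPair NB
  ... | x , y , refl , xy with Equivalence.from (coindependent (adj⇒≢ xy)) xy
  ...   | C , MC , x∉C , y∉C = ⊆N′ (pair x y) (pair-card (adj⇒≢ xy) , ∁ C ,
    subst bases (sym (∁-involutive C)) MC , pair⊆ (x∉p⇒x∈∁p x∉C) (x∉p⇒x∈∁p y∉C))

module _ {n k : ℕ} (k+2≤n : k + 2 ≤ n) where

  clique⇒InP : ∀ {N} → IsPositroid n 2 N → ∀ J → Clique (Adj N) J → ∣ J ∣ + k ≡ n → InP n k N
  clique⇒InP {N} N-pos J clique |J|+k≡n = lifting⇒InP N-pos rank2
    (lifting k simple (noncrossing {V = vectors} ordered (mk⇔ (λ e → e) (λ e → e))) J clique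
      |J|+k≡n (clique-size-≥2 {∣ J ∣} |J|+k≡n k+2≤n))
    where
    rank2 = positroid⇒rank2 N-pos
    open Rank2 rank2

  InP⇒clique : ∀ {N} → InP n k N → ∃[ J ] Clique (Adj N) J × ∣ J ∣ + k ≡ n
  InP⇒clique {N} (M , (((B , MB) , _) , card , _) , _ , ⊆N , _) = ∁ B , clique ,
    trans (cong (λ m → ∣ ∁ B ∣ + m) (sym (card B MB))) (∣∁∣+∣∣≡n B)
    where
    clique : Clique (Adj N) (∁ B)
    clique x∈ y∈ x≢y = ⊆N _ (pair-card x≢y , ∁ B , subst M (sym (∁-involutive B)) MB , pair⊆ x∈ y∈)

InP⇒positroid : ∀ {n k N} → InP n k N → IsPositroid n 2 N
InP⇒positroid (_ , _ , N-pos , _) = N-pos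

-- Positroids without nontrivial parallel classes

fromℕℚ : ℕ → ℚ
fromℕℚ zero    = 0ℚ
fromℕℚ (suc m) = 1ℚ ℚ.+ fromℕℚ m

0<1ℚ : 0ℚ ℚ.< 1ℚ
0<1ℚ = ℚ.positive⁻¹ 1ℚ

fromℕℚ-nonneg : ∀ m → 0ℚ ℚ.≤ fromℕℚ m
fromℕℚ-nonneg zero    = ℚ.≤-refl
fromℕℚ-nonneg (suc m) = ℚ.+-mono-≤ (ℚ.<⇒≤ 0<1ℚ) (fromℕℚ-nonneg m)

fromℕℚ-mono-< : ∀ {a b} → a < b → fromℕℚ a ℚ.< fromℕℚ b
fromℕℚ-mono-< {zero}  {suc b} _         = ℚ.+-mono-<-≤ 0<1ℚ (fromℕℚ-nonneg b)
fromℕℚ-mono-< {suc a} {suc b} (s≤s a<b) = ℚ.+-monoʳ-< 1ℚ (fromℕℚ-mono-< a<b)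

cross-points : ∀ a b → cross (1ℚ , a) (1ℚ , b) ≡ b ℚ.- a
cross-points a b = solve 2 (λ a b → con 1ℚ :* b :- con 1ℚ :* a := b :- a) refl a b
  where open +-*-Solver

cross-zeroˡ : ∀ u → cross (0ℚ , 0ℚ) u ≡ 0ℚ
cross-zeroˡ (a , b) = solve 2 (λ a b → con 0ℚ :* b :- a :* con 0ℚ := con 0ℚ) refl a b
  where open +-*-Solver

module _ {n} (L : Subset n) where

  -- Nonloops go to the points (1, x) of a line, so that their cross products are differences of
  -- indices.
  uniform : Fin n → Plane
  uniform x with x ∈? L
  ... | yes _ = 0ℚ , 0ℚ
  ... | no  _ = 1ℚ , fromℕℚ (toℕ x)

  uniform-∈ : ∀ {x} → x ∈ L → uniform x ≡ (0ℚ , 0ℚ)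
  uniform-∈ {x} x∈L with x ∈? L
  ... | yes _  = refl
  ... | no x∉L = ⊥-elim (x∉L x∈L)

  uniform-∉ : ∀ {x} → x ∉ L → uniform x ≡ (1ℚ , fromℕℚ (toℕ x))
  uniform-∉ {x} x∉L with x ∈? L
  ... | yes x∈L = ⊥-elim (x∉L x∈L)
  ... | no _    = refl

  uniform-pos : ∀ {x y} → x Fin.< y → x ∉ L → y ∉ L → 0ℚ ℚ.< cross (uniform x) (uniform y)
  uniform-pos {x} {y} x<y x∉L y∉L = subst (0ℚ ℚ.<_)
    (sym (trans (cong₂ cross (uniform-∉ x∉L) (uniform-∉ y∉L)) (cross-points (fromℕℚ (toℕ x)) (fromℕℚ (toℕ y)))))
    (subst (ℚ._< fromℕℚ (toℕ y) ℚ.- fromℕℚ (toℕ x)) (ℚ.+-inverseʳ (fromℕℚ (toℕ x)))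
      (ℚ.+-monoˡ-< (ℚ.- fromℕℚ (toℕ x)) (fromℕℚ-mono-< x<y)))

  uniform-zeroˡ : ∀ {x} y → x ∈ L → cross (uniform x) (uniform y) ≡ 0ℚ
  uniform-zeroˡ {x} y x∈L = trans (cong (λ u → cross u (uniform y)) (uniform-∈ x∈L)) (cross-zeroˡ (uniform y))

  uniform-zeroʳ : ∀ x {y} → y ∈ L → cross (uniform x) (uniform y) ≡ 0ℚ
  uniform-zeroʳ x {y} y∈L = trans (cross-antisym (uniform x) (uniform y)) (cong ℚ.-_ (uniform-zeroˡ x y∈L))

  uniform-independent : ∀ {x y} → x ≢ y → x ∉ L → y ∉ L → Independent uniform x y
  uniform-independent {x} {y} x≢y x∉L y∉L = cases (Fin.<-cmp x y)
    where
    cases : Tri (x Fin.< y) (x ≡ y) (y Fin.< x) → Independent uniform x y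
    cases (tri< x<y _ _) = ≢-sym (ℚ.<⇒≢ (uniform-pos x<y x∉L y∉L))
    cases (tri≈ _ x≡y _) = ⊥-elim (x≢y x≡y)
    cases (tri> _ _ y<x) = cross≢0-sym {uniform y} {uniform x} (≢-sym (ℚ.<⇒≢ (uniform-pos y<x y∉L x∉L)))

  uniform-ordered : Ordered toℕ uniform
  uniform-ordered x y x<y = cases (x ∈? L) (y ∈? L)
    where
    cases : Dec (x ∈ L) → Dec (y ∈ L) → 0ℚ ℚ.≤ cross (uniform x) (uniform y)
    cases (yes x∈L) _        = ℚ.≤-reflexive (sym (uniform-zeroˡ y x∈L))
    cases (no _)   (yes y∈L) = ℚ.≤-reflexive (sym (uniform-zeroʳ x y∈L))
    cases (no x∉L) (no y∉L)  = ℚ.<⇒≤ (uniform-pos x<y x∉L y∉L)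

  PairsOf-uniform : PairsOf (Independent uniform) ≐ᶜ NoIntervals L
  PairsOf-uniform B = mk⇔ to from
    where
    to : PairsOf (Independent uniform) B → NoIntervals L B
    to (x , y , refl , xy) = pair-card (Simple.adj⇒≢ (independent-simple uniform) {x} {y} xy) , nonloops
      where
      nonloops : ∀ z → z ∈ pair x y → z ∉ L
      nonloops z z∈ z∈L with ∈pair⁻ z∈
      ... | inj₁ refl = xy (uniform-zeroˡ y z∈L)
      ... | inj₂ refl = xy (uniform-zeroʳ x z∈L)
    from : NoIntervals L B → PairsOf (Independent uniform) B
    from (|B|≡2 , nonloops) with card2⇒pair B |B|≡2
    ... | x , y , x≢y , refl = x , y , refl , uniform-independent x≢y (nonloops x ∈pairˡ) (nonloops y ∈pairʳ)

  NoIntervals-isPositroid : 2 ≤ ∣ ∁ L ∣ → IsPositroid n 2 (NoIntervals L)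
  NoIntervals-isPositroid 2≤ with two-elements (∁ L) 2≤
  ... | x , y , x∈ , y∈ , x≢y = IsPositroid-resp-≐ PairsOf-uniform
    (independent-isPositroid {V = uniform} uniform-ordered (x , y , uniform-independent x≢y (x∈∁p⇒x∉p x∈) (x∈∁p⇒x∉p y∈)))

NoIntervals-pair : ∀ {n} {L : Subset n} {x y} → x ≢ y → x ∉ L → y ∉ L → NoIntervals L (pair x y)
NoIntervals-pair {L = L} {x} {y} x≢y x∉L y∉L = pair-card x≢y , nonloops
  where
  nonloops : ∀ z → z ∈ pair x y → z ∉ L
  nonloops z z∈ with ∈pair⁻ {x = x} {y} z∈
  ... | inj₁ refl = x∉L
  ... | inj₂ refl = y∉L

-- Upward closure, minimal elements, and uniformity of maximal ones

module _ {n k : ℕ} (k+2≤n : k + 2 ≤ n) where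

  private
    complement-size : ∀ (L : Subset n) → ∣ L ∣ ≡ k → ∣ ∁ L ∣ + k ≡ n
    complement-size L |L|≡k = trans (cong (λ m → ∣ ∁ L ∣ + m) (sym |L|≡k)) (∣∁∣+∣∣≡n L)

    complement-≥2 : ∀ (L : Subset n) → ∣ L ∣ ≡ k → 2 ≤ ∣ ∁ L ∣
    complement-≥2 L |L|≡k = clique-size-≥2 {∣ ∁ L ∣} (complement-size L |L|≡k) k+2≤n

  NoIntervals-InP : ∀ {N} L → ∣ L ∣ ≡ k → NoIntervals L ≐ᶜ N → InP n k N
  NoIntervals-InP L |L|≡k ≐N = clique⇒InP k+2≤n
    (IsPositroid-resp-≐ ≐N (NoIntervals-isPositroid L (complement-≥2 L |L|≡k))) (∁ L)
    (λ x∈ y∈ x≢y → Equivalence.to (≐N _) (NoIntervals-pair x≢y (x∈∁p⇒x∉p x∈) (x∈∁p⇒x∉p y∈)))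
    (complement-size L |L|≡k)

  up-closed : ∀ N N′ → InP n k N → IsPositroid n 2 N′ → N ⊆ᶜ N′ → InP n k N′
  up-closed N N′ N∈P N′-pos N⊆N′ =
    let J , clique , |J|+k≡n = InP⇒clique k+2≤n N∈P
    in clique⇒InP k+2≤n N′-pos J (λ x∈ y∈ x≢y → N⊆N′ _ (clique x∈ y∈ x≢y)) |J|+k≡n

  -- The clique J of N has n - k elements; making everything outside J a loop gives a member of the
  -- poset below N, which minimality identifies with N.
  minimal⇒NoIntervals : ∀ N → MinimalInP n k N → ∃[ L ] (∣ L ∣ ≡ k × N ≐ᶜ NoIntervals L)
  minimal⇒NoIntervals N (N∈P , minimal) with InP⇒clique k+2≤n N∈P
  ... | J , clique , |J|+k≡n = ∁ J , |L|≡k , λ B → mk⇔ (minimal (NoIntervals (∁ J)) L∈P L⊆N B) (L⊆N B)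
    where
    |L|≡k : ∣ ∁ J ∣ ≡ k
    |L|≡k = ℕ.+-cancelˡ-≡ ∣ J ∣ ∣ ∁ J ∣ k (trans (ℕ.+-comm ∣ J ∣ ∣ ∁ J ∣) (trans (∣∁∣+∣∣≡n J) (sym |J|+k≡n)))
    L∈P : InP n k (NoIntervals (∁ J))
    L∈P = NoIntervals-InP (∁ J) |L|≡k (λ _ → mk⇔ (λ e → e) (λ e → e))
    L⊆N : NoIntervals (∁ J) ⊆ᶜ N
    L⊆N B (|B|≡2 , nonloops) with card2⇒pair B |B|≡2
    ... | x , y , x≢y , refl = clique (Subset.x∉∁p⇒x∈p (nonloops x ∈pairˡ)) (Subset.x∉∁p⇒x∈p (nonloops y ∈pairʳ)) x≢y

  -- Anything smaller in the poset has a clique of n - k elements, all nonloops and hence outside L.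
  -- That is all of `∁ L`, so every basis is present.
  NoIntervals⇒minimal : ∀ N → ∃[ L ] (∣ L ∣ ≡ k × N ≐ᶜ NoIntervals L) → MinimalInP n k N
  NoIntervals⇒minimal N (L , |L|≡k , N≐) = NoIntervals-InP L |L|≡k (≐-sym N≐) , minimal
    where
    minimal : ∀ N′ → InP n k N′ → N′ ⊆ᶜ N → N ⊆ᶜ N′
    minimal N′ N′∈P N′⊆N B NB with InP⇒clique k+2≤n N′∈P
    ... | J , clique , |J|+k≡n with card2⇒pair B (proj₁ (Equivalence.to (N≐ B) NB))
    ...   | x , y , x≢y , refl = clique (∁L⊆J (outside-L x ∈pairˡ)) (∁L⊆J (outside-L y ∈pairʳ)) x≢y
      where
      outside-L : ∀ z → z ∈ pair x y → z ∈ ∁ L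
      outside-L z z∈ = x∉p⇒x∈∁p (proj₂ (Equivalence.to (N≐ (pair x y)) NB) z z∈)
      J⊆∁L : J ⊆ ∁ L
      J⊆∁L {z} z∈ = let t , t∈ , z≢t = other-element (clique-size-≥2 {∣ J ∣} |J|+k≡n k+2≤n) z in
        x∉p⇒x∈∁p (proj₂ (Equivalence.to (N≐ _) (N′⊆N _ (clique z∈ t∈ z≢t))) z ∈pairˡ)
      ∁L⊆J : ∁ L ⊆ J
      ∁L⊆J = ⊆∧card⇒⊇ J⊆∁L (ℕ.≤-reflexive (ℕ.+-cancelʳ-≡ k ∣ ∁ L ∣ ∣ J ∣ (trans (complement-size L |L|≡k) (sym |J|+k≡n))))

  NoIntervals-⊆ : ∀ (L L′ : Subset n) → ∣ L′ ∣ ≡ k → NoIntervals L′ ⊆ᶜ NoIntervals L → L ⊆ L′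
  NoIntervals-⊆ L L′ |L′|≡k ⊆L {x} x∈L = decidable-stable (x ∈? L′) λ x∉L′ →
    let y , y∈ , x≢y = other-element (complement-≥2 L′ |L′|≡k) x
    in proj₂ (⊆L _ (NoIntervals-pair x≢y x∉L′ (x∈∁p⇒x∉p y∈))) x ∈pairˡ x∈L

  NoIntervals-injective : ∀ (L L′ : Subset n) → ∣ L ∣ ≡ k → ∣ L′ ∣ ≡ k → NoIntervals L ≐ᶜ NoIntervals L′ → L ≡ L′
  NoIntervals-injective L L′ |L|≡k |L′|≡k L≐L′ = ⊆-antisym
    (NoIntervals-⊆ L L′ |L′|≡k (λ B → Equivalence.from (L≐L′ B)))
    (NoIntervals-⊆ L′ L |L|≡k (λ B → Equivalence.to (L≐L′ B)))

  -- The uniform matroid without loops lies above N, so it is in the poset by upward closure and is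
  -- contained in a maximal N.
  maximal⇒uniform : ∀ N → MaximalInP n k N → ∀ {x y} → x ≢ y → Adj N x y
  maximal⇒uniform N (N∈P , maximal) x≢y = maximal (NoIntervals ⊥) U∈P N⊆U _ (NoIntervals-pair x≢y Subset.∉⊥ Subset.∉⊥)
    where
    open Data.Fin.Subset using (⊥)
    N⊆U : N ⊆ᶜ NoIntervals ⊥
    N⊆U B NB = proj₁ (proj₂ (InP⇒positroid N∈P)) B NB , λ _ _ → Subset.∉⊥
    U∈P : InP n k (NoIntervals ⊥)
    U∈P = up-closed N (NoIntervals ⊥) N∈P (NoIntervals-isPositroid ⊥ (ℕ.≤-trans (ℕ.m+n≤o⇒n≤o k k+2≤n)
      (ℕ.≤-reflexive (sym (trans (Subset.∣∁p∣≡n∸∣p∣ (⊥ {n})) (cong (n ∸_) (Subset.∣⊥∣≡0 n))))))) N⊆U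

-- Descriptions

∈⋃-tabulate⁺ : ∀ {n r} (C : Fin r → Subset n) {x} i → x ∈ C i → x ∈ ⋃ (List.tabulate C)
∈⋃-tabulate⁺ C Fin.zero    x∈ = x∈p∪q⁺ (inj₁ x∈)
∈⋃-tabulate⁺ C (Fin.suc i) x∈ = x∈p∪q⁺ (inj₂ (∈⋃-tabulate⁺ (C ∘ Fin.suc) i x∈))

∈⋃-tabulate⁻ : ∀ {n r} (C : Fin r → Subset n) {x} → x ∈ ⋃ (List.tabulate C) → ∃[ i ] x ∈ C i
∈⋃-tabulate⁻ {r = zero}  C x∈ = ⊥-elim (Subset.∉⊥ x∈)
∈⋃-tabulate⁻ {r = suc r} C x∈ with x∈p∪q⁻ (C Fin.zero) _ x∈
... | inj₁ x∈C₀ = Fin.zero , x∈C₀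
... | inj₂ x∈rest = let i , x∈C = ∈⋃-tabulate⁻ (C ∘ Fin.suc) x∈rest in Fin.suc i , x∈C

≤ᵇ-refl : ∀ m → (m ℕ.≤ᵇ m) ≡ true
≤ᵇ-refl m = Equivalence.to Bool.T-≡ (ℕ.≤⇒≤ᵇ (ℕ.≤-refl {m}))

start∈CycInt : ∀ {n} (a b : Fin n) → a ∈ CycInt a b
start∈CycInt a b = lookup⇒[]= a _ (trans (lookup∘tabulate (inCycᵇ a b) a) in-interval)
  where
  in-interval : inCycᵇ a b a ≡ true
  in-interval with toℕ a ℕ.≤ᵇ toℕ b
  ... | true  rewrite ≤ᵇ-refl (toℕ a) = refl
  ... | false rewrite ≤ᵇ-refl (toℕ a) = refl

-- A singleton is a clique for trivial reasons; the second condition prevents a single loop from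
-- being counted as a class.
FreeClique : ∀ {n} → (Fin n → Fin n → Set) → Subset n → Set
FreeClique E J = Clique E J × (∀ {x} → x ∈ J → ∃ (E x))

clique≥2⇒free : ∀ {n} {E : Fin n → Fin n → Set} {J} → 2 ≤ ∣ J ∣ → Clique E J → FreeClique E J
clique≥2⇒free 2≤ clique = clique , λ {x} x∈ → let t , t∈ , x≢t = other-element 2≤ x in t , clique x∈ t∈ x≢t

module _ {n} {N : Coll n} (rank2 : Rank2 N) (D : Description N) where
  open Description D

  CommonInterval : Fin n → Fin n → Set
  CommonInterval x y = ∃[ i ] (x ∈ CycInt (a i) (b i) × y ∈ CycInt (a i) (b i))

  adj⁻ : ∀ {x y} → x ≢ y → Adj N x y → x ∉ L × y ∉ L × ¬ CommonInterval x y
  adj⁻ x≢y xy with Equivalence.to (describes _) xy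
  ... | u , v , u≢v , eq , u∉ , v∉ , ¬common with pair-injective u≢v (sym eq)
  ...   | inj₁ (refl , refl) = u∉ , v∉ , ¬common
  ...   | inj₂ (refl , refl) = v∉ , u∉ , λ { (i , p , q) → ¬common (i , q , p) }

  adj⁺ : ∀ {x y} → x ≢ y → x ∉ L → y ∉ L → ¬ CommonInterval x y → Adj N x y
  adj⁺ x≢y x∉ y∉ ¬common = Equivalence.from (describes _) (_ , _ , x≢y , refl , x∉ , y∉ , ¬common)

  ∈L⇒loop : ∀ {x} → x ∈ L → ¬ ∃ (Adj N x)
  ∈L⇒loop x∈L (y , xy) = Equivalence.to (loops _) x∈L _ xy ∈pairˡ

  loop⇒∈L : ∀ {x} → ¬ ∃ (Adj N x) → x ∈ L
  loop⇒∈L {x} loop = Equivalence.from (loops x) avoids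
    where
    avoids : ∀ B → N B → x ∉ B
    avoids B NB x∈ with Equivalence.to (describes B) NB
    ... | u , v , _ , refl , _ with ∈pair⁻ x∈
    ...   | inj₁ refl = loop (v , NB)
    ...   | inj₂ refl = loop (u , subst N (pair-comm u v) NB)

  ∉L⇒nonloop : ∀ {x} → x ∉ L → ∃ (Adj N x)
  ∉L⇒nonloop {x} x∉L = decidable-stable (Rank2.nonloop? rank2 x) (x∉L ∘ loop⇒∈L)

  private
    S = Sᴰ D
    s = ∣ S ∪ L ∣

    start? : ∀ x → Dec (∃[ i ] a i ≡ x)
    start? x = Fin.any? (λ i → a i Fin.≟ x)

    starts : Subset n
    starts = select start?

    start∈S : ∀ i → a i ∈ S
    start∈S i = ∈⋃-tabulate⁺ _ i (start∈CycInt (a i) (b i))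

    starts-card : ∣ starts ∣ ≡ r
    starts-card = image-card {σ = a}
      (λ {i} {j} eq → disjoint i j (a i) (start∈CycInt (a i) (b i))
        (subst (_∈ CycInt (a j) (b j)) (sym eq) (start∈CycInt (a j) (b j))))
      (λ x → mk⇔ (∈select⁻ start?) (∈select⁺ start?))

  -- One element of each parallel class.
  representatives : Subset n
  representatives = ∁ (S ∪ L) ∪ starts

  -- With p for the number of representatives this is e(N) = p - (n - k), cleared of subtraction.
  representatives-card : ∣ representatives ∣ + s ≡ r + n
  representatives-card = begin
    ∣ ∁ (S ∪ L) ∪ starts ∣ + s         ≡⟨ cong (_+ s) (∣∪∣-disjoint (∁ (S ∪ L)) starts disj) ⟩
    ∣ ∁ (S ∪ L) ∣ + ∣ starts ∣ + s     ≡⟨ cong (λ t → ∣ ∁ (S ∪ L) ∣ + t + s) starts-card ⟩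
    ∣ ∁ (S ∪ L) ∣ + r + s              ≡⟨ solve 3 (λ c r s → c :+ r :+ s := r :+ (c :+ s)) refl ∣ ∁ (S ∪ L) ∣ r s ⟩
    r + (∣ ∁ (S ∪ L) ∣ + s)            ≡⟨ cong (λ t → r + t) (∣∁∣+∣∣≡n (S ∪ L)) ⟩
    r + n                              ∎
    where
    open ≡-Reasoning
    open ℕ-Solver
    disj : ∀ {x} → x ∈ ∁ (S ∪ L) → x ∉ starts
    disj x∈ x∈′ with ∈select⁻ start? x∈′
    ... | i , refl = x∈∁p⇒x∉p x∈ (x∈p∪q⁺ (inj₁ (start∈S i)))

  representatives-clique : FreeClique (Adj N) representatives
  representatives-clique = clique , ∉L⇒nonloop ∘ ∉L
    where
    ∉L : ∀ {x} → x ∈ representatives → x ∉ L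
    ∉L x∈ x∈L with x∈p∪q⁻ (∁ (S ∪ L)) starts x∈
    ... | inj₁ x∈∁ = x∈∁p⇒x∉p x∈∁ (x∈p∪q⁺ (inj₂ x∈L))
    ... | inj₂ x∈s with ∈select⁻ start? x∈s
    ...   | i , refl = proj₁ (endpoints i) x∈L
    in-interval : ∀ {x} i → x ∈ representatives → x ∈ CycInt (a i) (b i) → a i ≡ x
    in-interval {x} i x∈ x∈C with x∈p∪q⁻ (∁ (S ∪ L)) starts x∈
    ... | inj₁ x∈∁ = ⊥-elim (x∈∁p⇒x∉p x∈∁ (x∈p∪q⁺ (inj₁ (∈⋃-tabulate⁺ _ i x∈C))))
    ... | inj₂ x∈s with ∈select⁻ start? x∈s
    ...   | j , refl = cong a (disjoint i j (a j) x∈C (start∈CycInt (a j) (b j)))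
    clique : Clique (Adj N) representatives
    clique x∈ y∈ x≢y = adj⁺ x≢y (∉L x∈) (∉L y∈)
      (λ { (i , x∈C , y∈C) → x≢y (trans (sym (in-interval i x∈ x∈C)) (in-interval i y∈ y∈C)) })

  -- Each interval holds at most one element of a clique, and the elements outside S lie outside
  -- `S ∪ L`. Together with `representatives-clique`, p becomes the maximal size of a free clique, a
  -- quantity independent of the description.
  free-clique-card : ∀ {J} → FreeClique (Adj N) J → ∣ J ∣ ≤ ∣ representatives ∣
  free-clique-card {J} (clique , nonloop) = ℕ.+-cancelʳ-≤ s ∣ J ∣ ∣ representatives ∣ (begin
    ∣ J ∣ + s                                 ≡⟨ cong (λ X → ∣ X ∣ + s) (⊆-antisym split merge) ⟩
    ∣ (J ∩ S) ∪ (J ∩ ∁ S) ∣ + s               ≡⟨ cong (_+ s) (∣∪∣-disjoint (J ∩ S) (J ∩ ∁ S) disj) ⟩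
    ∣ J ∩ S ∣ + ∣ J ∩ ∁ S ∣ + s               ≤⟨ ℕ.+-monoˡ-≤ s (ℕ.+-mono-≤ inside≤ outside≤) ⟩
    r + ∣ ∁ (S ∪ L) ∣ + s                     ≡⟨ ℕ.+-assoc r _ s ⟩
    r + (∣ ∁ (S ∪ L) ∣ + s)                   ≡⟨ cong (λ t → r + t) (∣∁∣+∣∣≡n (S ∪ L)) ⟩
    r + n                                     ≡⟨ sym representatives-card ⟩
    ∣ representatives ∣ + s                   ∎)
    where
    open ℕ.≤-Reasoning
    split : J ⊆ (J ∩ S) ∪ (J ∩ ∁ S)
    split {x} x∈ with x ∈? S
    ... | yes x∈S = x∈p∪q⁺ (inj₁ (x∈p∩q⁺ (x∈ , x∈S)))
    ... | no  x∉S = x∈p∪q⁺ (inj₂ (x∈p∩q⁺ (x∈ , x∉p⇒x∈∁p x∉S)))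
    merge : (J ∩ S) ∪ (J ∩ ∁ S) ⊆ J
    merge x∈ with x∈p∪q⁻ (J ∩ S) (J ∩ ∁ S) x∈
    ... | inj₁ x∈′ = proj₁ (x∈p∩q⁻ J S x∈′)
    ... | inj₂ x∈′ = proj₁ (x∈p∩q⁻ J (∁ S) x∈′)
    disj : ∀ {x} → x ∈ J ∩ S → x ∉ J ∩ ∁ S
    disj x∈ x∈′ = x∈∁p⇒x∉p (proj₂ (x∈p∩q⁻ J (∁ S) x∈′)) (proj₂ (x∈p∩q⁻ J S x∈))
    inside≤ : ∣ J ∩ S ∣ ≤ r
    inside≤ = subst (∣ J ∩ S ∣ ≤_) (Subset.∣⊤∣≡n r) (card-≤ (J ∩ S) Data.Fin.Subset.⊤ (λ x i → x ∈ CycInt (a i) (b i))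
      (λ x x∈ → let i , x∈C = ∈⋃-tabulate⁻ _ (proj₂ (x∈p∩q⁻ J S x∈)) in i , Subset.∈⊤ , x∈C)
      (λ {x} {y} {i} x∈ y∈ x∈C y∈C → decidable-stable (x Fin.≟ y) (λ x≢y →
        proj₂ (proj₂ (adj⁻ x≢y (clique (proj₁ (x∈p∩q⁻ J S x∈)) (proj₁ (x∈p∩q⁻ J S y∈)) x≢y))) (i , x∈C , y∈C))))
    outside≤ : ∣ J ∩ ∁ S ∣ ≤ ∣ ∁ (S ∪ L) ∣
    outside≤ = p⊆q⇒∣p∣≤∣q∣ λ {x} x∈ → x∉p⇒x∈∁p (λ x∈′ → outside-both x∈ (x∈p∪q⁻ S L x∈′))
      where
      outside-both : ∀ {x} → x ∈ J ∩ ∁ S → ¬ (x ∈ S ⊎ x ∈ L)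
      outside-both x∈ (inj₁ x∈S) = x∈∁p⇒x∉p (proj₂ (x∈p∩q⁻ J (∁ S) x∈)) x∈S
      outside-both x∈ (inj₂ x∈L) = ∈L⇒loop x∈L (nonloop (proj₁ (x∈p∩q⁻ J (∁ S) x∈)))

  -- Substitute r = p + |S ∪ L| - n and |S ∪ L| = |S ∖ L| + |L| into the definition of d.
  dᴰ-formula : ∀ k → dᴰ D k ≡ + (2 * k + ∣ representatives ∣) ℤ.- + (n + ∣ L ∣)
  dᴰ-formula k = begin
    + (2 * k) ℤ.+ + r ℤ.- + t ℤ.- + (2 * l)
      ≡⟨ cong₂ (λ u v → + (2 * k) ℤ.+ u ℤ.- + t ℤ.- v) r≡ (ℤ.pos-* 2 l) ⟩
    + (2 * k) ℤ.+ (+ p ℤ.+ (+ t ℤ.+ + l) ℤ.- + n) ℤ.- + t ℤ.- + 2 ℤ.* + l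
      ≡⟨ solve 5 (λ K p t l n → K :+ (p :+ (t :+ l) :- n) :- t :- con (+ 2) :* l := (K :+ p) :- (n :+ l))
           refl (+ (2 * k)) (+ p) (+ t) (+ l) (+ n) ⟩
    + (2 * k + p) ℤ.- + (n + l) ∎
    where
    open ≡-Reasoning
    open ℤ.+-*-Solver
    p = ∣ representatives ∣
    t = ∣ S ∩ ∁ L ∣
    l = ∣ L ∣
    s≡t+l : s ≡ t + l
    s≡t+l = trans (cong ∣_∣ (⊆-antisym split merge)) (∣∪∣-disjoint (S ∩ ∁ L) L (λ x∈ → x∈∁p⇒x∉p (proj₂ (x∈p∩q⁻ S (∁ L) x∈))))
      where
      split : S ∪ L ⊆ (S ∩ ∁ L) ∪ L
      split {x} x∈ with x ∈? L | x∈p∪q⁻ S L x∈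
      ... | yes x∈L | _        = x∈p∪q⁺ (inj₂ x∈L)
      ... | no _    | inj₂ x∈L = x∈p∪q⁺ (inj₂ x∈L)
      ... | no x∉L  | inj₁ x∈S = x∈p∪q⁺ (inj₁ (x∈p∩q⁺ (x∈S , x∉p⇒x∈∁p x∉L)))
      merge : (S ∩ ∁ L) ∪ L ⊆ S ∪ L
      merge x∈ with x∈p∪q⁻ (S ∩ ∁ L) L x∈
      ... | inj₁ x∈′ = x∈p∪q⁺ (inj₁ (proj₁ (x∈p∩q⁻ S (∁ L) x∈′)))
      ... | inj₂ x∈L = x∈p∪q⁺ (inj₂ x∈L)
    r≡ : + r ≡ + p ℤ.+ (+ t ℤ.+ + l) ℤ.- + n
    r≡ = begin
      + r                                ≡⟨ solve 2 (λ r n → r := (r :+ n) :- n) refl (+ r) (+ n) ⟩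
      + (r + n) ℤ.- + n                 
        ≡⟨ cong (λ m → + m ℤ.- + n) (trans (sym representatives-card) (cong (λ m → p + m) s≡t+l)) ⟩
      + p ℤ.+ (+ t ℤ.+ + l) ℤ.- + n      ∎

  module _ {k : ℕ} (k+2≤n : k + 2 ≤ n) where

    -- Both sides say p ≥ n - k: a clique is no larger than the set of representatives, and any n -
    -- k representatives form a clique.
    clique-exists⇔eᴰ : (∃[ J ] Clique (Adj N) J × ∣ J ∣ + k ≡ n) ⇔ (+ 0 ℤ.≤ eᴰ D k)
    clique-exists⇔eᴰ = mk⇔ to from
      where
      open ℕ-Solver
      p = ∣ representatives ∣
      to : (∃[ J ] Clique (Adj N) J × ∣ J ∣ + k ≡ n) → + 0 ℤ.≤ eᴰ D k
      to (J , clique , |J|+k≡n) = ℤ.i≤j⇒0≤j-i (ℤ.+≤+ (ℕ.+-cancelˡ-≤ ∣ J ∣ s (r + k) (begin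
        ∣ J ∣ + s         ≤⟨ ℕ.+-monoˡ-≤ s (free-clique-card (clique≥2⇒free (clique-size-≥2 {∣ J ∣} |J|+k≡n k+2≤n) clique)) ⟩
        p + s             ≡⟨ representatives-card ⟩
        r + n             ≡⟨ cong (λ m → r + m) (sym |J|+k≡n) ⟩
        r + (∣ J ∣ + k)   ≡⟨ solve 3 (λ r j k → r :+ (j :+ k) := j :+ (r :+ k)) refl r ∣ J ∣ k ⟩
        ∣ J ∣ + (r + k)   ∎)))
        where open ℕ.≤-Reasoning
      from : + 0 ℤ.≤ eᴰ D k → ∃[ J ] Clique (Adj N) J × ∣ J ∣ + k ≡ n
      from 0≤e with subset-of-size representatives (n ∸ k) n∸k≤p
        where
        open ℕ.≤-Reasoning
        n∸k+k≡n = ℕ.m∸n+n≡m (ℕ.m+n≤o⇒m≤o k k+2≤n)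
        n∸k≤p : n ∸ k ≤ p
        n∸k≤p = ℕ.+-cancelʳ-≤ s (n ∸ k) p (begin
          n ∸ k + s         ≤⟨ ℕ.+-monoʳ-≤ (n ∸ k) (ℤ.drop‿+≤+ (ℤ.0≤i-j⇒j≤i 0≤e)) ⟩
          n ∸ k + (r + k)   ≡⟨ solve 3 (λ m r k → m :+ (r :+ k) := r :+ (m :+ k)) refl (n ∸ k) r k ⟩
          r + (n ∸ k + k)   ≡⟨ cong (λ m → r + m) n∸k+k≡n ⟩
          r + n             ≡⟨ sym representatives-card ⟩
          p + s             ∎)
      ... | J , J⊆ , |J|≡ = J , (λ x∈ y∈ → proj₁ representatives-clique (J⊆ x∈) (J⊆ y∈)) ,
        trans (cong (_+ k) |J|≡) (ℕ.m∸n+n≡m (ℕ.m+n≤o⇒m≤o k k+2≤n))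

-- Merging parallel classes

negate : Plane → Plane
negate (a , b) = ℚ.- a , ℚ.- b

scale : ℚ → Plane → Plane
scale c (a , b) = c ℚ.* a , c ℚ.* b

cross-negateˡ : ∀ u v → cross (negate u) v ≡ cross v u
cross-negateˡ (a , b) (c , d) = solve 4 (λ a b c d → (:- a) :* d :- c :* (:- b) := c :* b :- a :* d) refl a b c d
  where open +-*-Solver

cross-negateʳ : ∀ u v → cross u (negate v) ≡ cross v u
cross-negateʳ (a , b) (c , d) = solve 4 (λ a b c d → a :* (:- d) :- (:- c) :* b := c :* b :- a :* d) refl a b c d
  where open +-*-Solver

cross-scaleˡ : ∀ s u v → cross (scale s u) v ≡ s ℚ.* cross u v
cross-scaleˡ s (a , b) (c , d) = solve 5 (λ s a b c d → (s :* a) :* d :- c :* (s :* b) := s :* (a :* d :- c :* b)) refl s a b c d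
  where open +-*-Solver

cross-scaleʳ : ∀ s u v → cross u (scale s v) ≡ s ℚ.* cross u v
cross-scaleʳ s (a , b) (c , d) = solve 5 (λ s a b c d → a :* (s :* d) :- (s :* c) :* b := s :* (a :* d :- c :* b)) refl s a b c d
  where open +-*-Solver

-- The cyclic order <_z, as the usual order after moving the elements below z to the end.
position : ∀ {n} → Fin n → Fin n → ℕ
position {n} z x = if does (x Fin.<? z) then n + toℕ x else toℕ x

-- Moving a vector from the front to the end reverses its cross products with the vectors it passes;
-- negating it restores their sign.
twist : ∀ {n} → Fin n → (Fin n → Plane) → Fin n → Plane
twist z V x = if does (x Fin.<? z) then negate (V x) else V x

module _ {n} (z : Fin n) where

  position-< : ∀ {x} → x Fin.< z → position z x ≡ n + toℕ x
  position-< {x} x<z = cong (if_then n + toℕ x else toℕ x) (dec-true (x Fin.<? z) x<z)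

  position-≮ : ∀ {x} → ¬ x Fin.< z → position z x ≡ toℕ x
  position-≮ {x} x≮z = cong (if_then n + toℕ x else toℕ x) (dec-false (x Fin.<? z) x≮z)

  position-injective : ∀ {x y} → position z x ≡ position z y → x ≡ y
  position-injective {x} {y} eq = cases (x Fin.<? z) (y Fin.<? z)
    where
    cases : Dec (x Fin.< z) → Dec (y Fin.< z) → x ≡ y
    cases (yes x<z) (yes y<z) = Fin.toℕ-injective (ℕ.+-cancelˡ-≡ n _ _
      (trans (sym (position-< x<z)) (trans eq (position-< y<z))))
    cases (yes x<z) (no y≮z) = ⊥-elim (ℕ.m+n≮m n (toℕ x)
      (subst (_< n) (trans (sym (position-≮ y≮z)) (trans (sym eq) (position-< x<z))) (Fin.toℕ<n y)))
    cases (no x≮z) (yes y<z) = ⊥-elim (ℕ.m+n≮m n (toℕ y)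
      (subst (_< n) (trans (sym (position-≮ x≮z)) (trans eq (position-< y<z))) (Fin.toℕ<n x)))
    cases (no x≮z) (no y≮z) = Fin.toℕ-injective (trans (sym (position-≮ x≮z)) (trans eq (position-≮ y≮z)))

  position-min : ∀ {x} → z ≢ x → position z z < position z x
  position-min {x} z≢x = subst (_< position z x) (sym (position-≮ (Fin.<-irrefl refl))) (cases (x Fin.<? z))
    where
    cases : Dec (x Fin.< z) → toℕ z < position z x
    cases (yes x<z) = subst (toℕ z <_) (sym (position-< x<z)) (ℕ.<-≤-trans (Fin.toℕ<n z) (ℕ.m≤m+n n (toℕ x)))
    cases (no x≮z)  = subst (toℕ z <_) (sym (position-≮ x≮z)) (Fin.≤∧≢⇒< (ℕ.≮⇒≥ x≮z) z≢x)

  module _ {V : Fin n → Plane} where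

    twist-< : ∀ {x} → x Fin.< z → twist z V x ≡ negate (V x)
    twist-< {x} x<z = cong (if_then negate (V x) else V x) (dec-true (x Fin.<? z) x<z)

    twist-≮ : ∀ {x} → ¬ x Fin.< z → twist z V x ≡ V x
    twist-≮ {x} x≮z = cong (if_then negate (V x) else V x) (dec-false (x Fin.<? z) x≮z)

    cross-twist-<< : ∀ {x y} → x Fin.< z → y Fin.< z → cross (twist z V x) (twist z V y) ≡ cross (V x) (V y)
    cross-twist-<< {x} {y} x<z y<z = trans (cong₂ cross (twist-< x<z) (twist-< y<z))
      (trans (cross-negateˡ (V x) (negate (V y))) (cross-negateˡ (V y) (V x)))

    cross-twist-<≮ : ∀ {x y} → x Fin.< z → ¬ y Fin.< z → cross (twist z V x) (twist z V y) ≡ cross (V y) (V x)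
    cross-twist-<≮ {x} {y} x<z y≮z = trans (cong₂ cross (twist-< x<z) (twist-≮ y≮z)) (cross-negateˡ (V x) (V y))

    cross-twist-≮< : ∀ {x y} → ¬ x Fin.< z → y Fin.< z → cross (twist z V x) (twist z V y) ≡ cross (V y) (V x)
    cross-twist-≮< {x} {y} x≮z y<z = trans (cong₂ cross (twist-≮ x≮z) (twist-< y<z)) (cross-negateʳ (V x) (V y))

    cross-twist-≮≮ : ∀ {x y} → ¬ x Fin.< z → ¬ y Fin.< z → cross (twist z V x) (twist z V y) ≡ cross (V x) (V y)
    cross-twist-≮≮ x≮z y≮z = cong₂ cross (twist-≮ x≮z) (twist-≮ y≮z)

    twist-ordered : Ordered toℕ V → Ordered (position z) (twist z V)
    twist-ordered ordered x y x<y = cases (x Fin.<? z) (y Fin.<? z)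
      where
      cases : Dec (x Fin.< z) → Dec (y Fin.< z) → 0ℚ ℚ.≤ cross (twist z V x) (twist z V y)
      cases (yes x<z) (yes y<z) = subst (0ℚ ℚ.≤_) (sym (cross-twist-<< x<z y<z))
        (ordered x y (ℕ.+-cancelˡ-< n _ _ (subst₂ _<_ (position-< x<z) (position-< y<z) x<y)))
      cases (yes x<z) (no y≮z) = ⊥-elim (ℕ.m+n≮m n (toℕ x)
        (ℕ.<-trans (subst₂ _<_ (position-< x<z) (position-≮ y≮z) x<y) (Fin.toℕ<n y)))
      cases (no x≮z) (yes y<z) = subst (0ℚ ℚ.≤_) (sym (cross-twist-≮< x≮z y<z))
        (ordered y x (ℕ.<-≤-trans y<z (ℕ.≮⇒≥ x≮z)))
      cases (no x≮z) (no y≮z) = subst (0ℚ ℚ.≤_) (sym (cross-twist-≮≮ x≮z y≮z))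
        (ordered x y (subst₂ _<_ (position-≮ x≮z) (position-≮ y≮z) x<y))

    -- The same sign change leads back from <_z to the usual order, so vectors constructed in a
    -- rotated order still give a positroid.
    untwist-ordered : Ordered (position z) V → Ordered toℕ (twist z V)
    untwist-ordered ordered x y x<y = cases (x Fin.<? z) (y Fin.<? z)
      where
      cases : Dec (x Fin.< z) → Dec (y Fin.< z) → 0ℚ ℚ.≤ cross (twist z V x) (twist z V y)
      cases (yes x<z) (yes y<z) = subst (0ℚ ℚ.≤_) (sym (cross-twist-<< x<z y<z))
        (ordered x y (subst₂ _<_ (sym (position-< x<z)) (sym (position-< y<z)) (ℕ.+-monoʳ-< n x<y)))
      cases (yes x<z) (no y≮z) = subst (0ℚ ℚ.≤_) (sym (cross-twist-<≮ x<z y≮z))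
        (ordered y x (subst₂ _<_ (sym (position-≮ y≮z)) (sym (position-< x<z)) (ℕ.<-≤-trans (Fin.toℕ<n y) (ℕ.m≤m+n n (toℕ x)))))
      cases (no x≮z) (yes y<z) = ⊥-elim (x≮z (Fin.<-trans x<y y<z))
      cases (no x≮z) (no y≮z) = subst (0ℚ ℚ.≤_) (sym (cross-twist-≮≮ x≮z y≮z))
        (ordered x y (subst₂ _<_ (sym (position-≮ x≮z)) (sym (position-≮ y≮z)) x<y))

    twist-independent : ∀ {x y} → Independent (twist z V) x y ⇔ Independent V x y
    twist-independent {x} {y} = cases (x Fin.<? z) (y Fin.<? z)
      where
      same : cross (twist z V x) (twist z V y) ≡ cross (V x) (V y) → Independent (twist z V) x y ⇔ Independent V x y
      same eq = mk⇔ (subst (_≢ 0ℚ) eq) (subst (_≢ 0ℚ) (sym eq))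
      flipped : cross (twist z V x) (twist z V y) ≡ cross (V y) (V x) → Independent (twist z V) x y ⇔ Independent V x y
      flipped eq = mk⇔ (λ e → cross≢0-sym {V y} {V x} (subst (_≢ 0ℚ) eq e))
                       (λ e → subst (_≢ 0ℚ) (sym eq) (cross≢0-sym {V x} {V y} e))
      cases : Dec (x Fin.< z) → Dec (y Fin.< z) → Independent (twist z V) x y ⇔ Independent V x y
      cases (yes x<z) (yes y<z) = same (cross-twist-<< x<z y<z)
      cases (yes x<z) (no y≮z)  = flipped (cross-twist-<≮ x<z y≮z)
      cases (no x≮z)  (yes y<z) = flipped (cross-twist-≮< x≮z y<z)
      cases (no x≮z)  (no y≮z)  = same (cross-twist-≮≮ x≮z y≮z)

module _ {n} (V : Fin n → Plane) (x : Fin n) where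

  deleted : Fin n → Plane
  deleted a with a Fin.≟ x
  ... | yes _ = 0ℚ , 0ℚ
  ... | no _  = V a

  deleted-≡ : deleted x ≡ (0ℚ , 0ℚ)
  deleted-≡ with x Fin.≟ x
  ... | yes _  = refl
  ... | no x≢x = ⊥-elim (x≢x refl)

  deleted-≢ : ∀ {a} → a ≢ x → deleted a ≡ V a
  deleted-≢ {a} a≢x with a Fin.≟ x
  ... | yes a≡x = ⊥-elim (a≢x a≡x)
  ... | no _    = refl

  cross-deletedˡ : ∀ b → cross (deleted x) (deleted b) ≡ 0ℚ
  cross-deletedˡ b = trans (cong (λ u → cross u (deleted b)) deleted-≡) (cross-zeroˡ (deleted b))

  cross-deletedʳ : ∀ a → cross (deleted a) (deleted x) ≡ 0ℚ
  cross-deletedʳ a = trans (cross-antisym (deleted a) (deleted x)) (cong ℚ.-_ (cross-deletedˡ a))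

  cross-deleted : ∀ {a b} → a ≢ x → b ≢ x → cross (deleted a) (deleted b) ≡ cross (V a) (V b)
  cross-deleted a≢x b≢x = cong₂ cross (deleted-≢ a≢x) (deleted-≢ b≢x)

  deleted-independent : ∀ {a b} → Independent deleted a b ⇔ (Independent V a b × a ≢ x × b ≢ x)
  deleted-independent {a} {b} = mk⇔ to (λ { (ab , a≢x , b≢x) → subst (_≢ 0ℚ) (sym (cross-deleted a≢x b≢x)) ab })
    where
    to : Independent deleted a b → Independent V a b × a ≢ x × b ≢ x
    to ab = subst (_≢ 0ℚ) (cross-deleted a≢x b≢x) ab , a≢x , b≢x
      where
      a≢x : a ≢ x
      a≢x refl = ab (cross-deletedˡ b)
      b≢x : b ≢ x
      b≢x refl = ab (cross-deletedʳ a)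

  deleted-ordered : Ordered toℕ V → Ordered toℕ deleted
  deleted-ordered ordered a b a<b = cases (a Fin.≟ x) (b Fin.≟ x)
    where
    cases : Dec (a ≡ x) → Dec (b ≡ x) → 0ℚ ℚ.≤ cross (deleted a) (deleted b)
    cases (yes refl) _          = ℚ.≤-reflexive (sym (cross-deletedˡ b))
    cases (no _)     (yes refl) = ℚ.≤-reflexive (sym (cross-deletedʳ a))
    cases (no a≢x)   (no b≢x)   = subst (0ℚ ℚ.≤_) (sym (cross-deleted a≢x b≢x)) (ordered a b a<b)

Parallel : ∀ {n} → (Fin n → Fin n → Set) → Fin n → Fin n → Set
Parallel E y q = ∃ (E q) × ¬ E q y

-- On the class of y the factor cross (V x) (V q) is a positive multiple of the ratio V q / V y.
module Merge {n} (pos : Fin n → ℕ) (pos-injective : ∀ {a b} → pos a ≡ pos b → a ≡ b)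
  (V : Fin n → Plane) (ordered : Ordered pos V)
  {x y : Fin n} (xy : Independent V x y)
  (after : ∀ {q} → Parallel (Independent V) y q → pos x < pos q)
  (convex : ∀ {w q} → Parallel (Independent V) y q → ∃ (Independent V w) → pos x < pos w → pos w < pos q →
    Parallel (Independent V) y w) where

  open Simple (independent-simple V)

  private
    Y = Parallel (Independent V) y

    Y? : ∀ q → Dec (Y q)
    Y? q = nonloop? q ×-dec ¬? (adj? q y)

  merged : Fin n → Plane
  merged q with Y? q
  ... | yes _ = scale (cross (V x) (V q)) (V x)
  ... | no  _ = V q

  merged-∈ : ∀ {q} → Y q → merged q ≡ scale (cross (V x) (V q)) (V x)
  merged-∈ {q} q∈Y with Y? q
  ... | yes _  = refl
  ... | no q∉Y = ⊥-elim (q∉Y q∈Y)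

  merged-∉ : ∀ {q} → ¬ Y q → merged q ≡ V q
  merged-∉ {q} q∉Y with Y? q
  ... | yes q∈Y = ⊥-elim (q∉Y q∈Y)
  ... | no _    = refl

  cross-∈∈ : ∀ {a b} → Y a → Y b → cross (merged a) (merged b) ≡ 0ℚ
  cross-∈∈ {a} {b} a∈ b∈ = begin
    cross (merged a) (merged b)                  ≡⟨ cong₂ cross (merged-∈ a∈) (merged-∈ b∈) ⟩
    cross (scale α (V x)) (scale β (V x))        ≡⟨ cross-scaleˡ α (V x) (scale β (V x)) ⟩
    α ℚ.* cross (V x) (scale β (V x))            ≡⟨ cong (α ℚ.*_) (cross-scaleʳ β (V x) (V x)) ⟩
    α ℚ.* (β ℚ.* cross (V x) (V x))              ≡⟨ cong (λ t → α ℚ.* (β ℚ.* t)) (cross-self (V x)) ⟩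
    α ℚ.* (β ℚ.* 0ℚ)                             ≡⟨ cong (α ℚ.*_) (ℚ.*-zeroʳ β) ⟩
    α ℚ.* 0ℚ                                     ≡⟨ ℚ.*-zeroʳ α ⟩
    0ℚ                                           ∎
    where
    open ≡-Reasoning
    α = cross (V x) (V a)
    β = cross (V x) (V b)

  cross-∈∉ : ∀ {a b} → Y a → ¬ Y b → cross (merged a) (merged b) ≡ cross (V x) (V a) ℚ.* cross (V x) (V b)
  cross-∈∉ {a} {b} a∈ b∉ = trans (cong₂ cross (merged-∈ a∈) (merged-∉ b∉)) (cross-scaleˡ (cross (V x) (V a)) (V x) (V b))

  cross-∉∈ : ∀ {a b} → ¬ Y a → Y b → cross (merged a) (merged b) ≡ cross (V x) (V b) ℚ.* cross (V a) (V x)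
  cross-∉∈ {a} {b} a∉ b∈ = trans (cong₂ cross (merged-∉ a∉) (merged-∈ b∈)) (cross-scaleʳ (cross (V x) (V b)) (V a) (V x))

  cross-∉∉ : ∀ {a b} → ¬ Y a → ¬ Y b → cross (merged a) (merged b) ≡ cross (V a) (V b)
  cross-∉∉ a∉ b∉ = cong₂ cross (merged-∉ a∉) (merged-∉ b∉)

  x-independent : ∀ {q} → Y q → Independent V x q
  x-independent {q} (qt , ¬qy) = symm {q} {x} (par-trans {y} {q} {x} (symm {x} {y} xy) (¬qy ∘ symm {y} {q}) (proj₂ qt))

  merged-ordered : Ordered pos merged
  merged-ordered a b a<b = cases (Y? a) (Y? b)
    where
    -- An a between x and an element of the class of y that is independent of x is a nonloop, so
    -- `convex` would put it into that class.
    a-x-nonneg : ¬ Y a → Y b → 0ℚ ℚ.≤ cross (V a) (V x)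
    a-x-nonneg a∉ b∈ = by-position (ℕ.<-cmp (pos a) (pos x)) (cross (V a) (V x) ℚ.≟ 0ℚ)
      where
      by-position : Tri (pos a < pos x) (pos a ≡ pos x) (pos x < pos a) → Dec (cross (V a) (V x) ≡ 0ℚ) → 0ℚ ℚ.≤ cross (V a) (V x)
      by-position (tri< a<x _ _) _ = ordered a x a<x
      by-position (tri≈ _ a≡x _) _ = ℚ.≤-reflexive
        (sym (trans (cong (λ c → cross (V c) (V x)) (pos-injective a≡x)) (cross-self (V x))))
      by-position (tri> _ _ x<a) (yes ≡0) = ℚ.≤-reflexive (sym ≡0)
      by-position (tri> _ _ x<a) (no ≢0) = ⊥-elim (a∉ (convex b∈ (x , ≢0) x<a a<b))
    cases : Dec (Y a) → Dec (Y b) → 0ℚ ℚ.≤ cross (merged a) (merged b)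
    cases (yes a∈) (yes b∈) = ℚ.≤-reflexive (sym (cross-∈∈ a∈ b∈))
    cases (yes a∈) (no b∉)  = subst (0ℚ ℚ.≤_) (sym (cross-∈∉ a∈ b∉))
      (*-nonneg (ordered x a (after a∈)) (ordered x b (ℕ.<-trans (after a∈) a<b)))
    cases (no a∉) (yes b∈)  = subst (0ℚ ℚ.≤_) (sym (cross-∉∈ a∉ b∈))
      (*-nonneg (ordered x b (after b∈)) (a-x-nonneg a∉ b∈))
    cases (no a∉) (no b∉)   = subst (0ℚ ℚ.≤_) (sym (cross-∉∉ a∉ b∉)) (ordered a b a<b)

  independent-∉∉ : ∀ {a b} → ¬ Y a → ¬ Y b → Independent merged a b ⇔ Independent V a b
  independent-∉∉ a∉ b∉ = mk⇔ (subst (_≢ 0ℚ) (cross-∉∉ a∉ b∉)) (subst (_≢ 0ℚ) (sym (cross-∉∉ a∉ b∉)))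

  independent-∈∉ : ∀ {a b} → Y a → ¬ Y b → Independent merged a b ⇔ Independent V x b
  independent-∈∉ {a} {b} a∈ b∉ = mk⇔
    (λ ab → *-≢0ʳ (cross (V x) (V a)) (cross (V x) (V b)) (subst (_≢ 0ℚ) (cross-∈∉ a∈ b∉) ab))
    (λ xb → subst (_≢ 0ℚ) (sym (cross-∈∉ a∈ b∉)) (*-≢0 (x-independent {a} a∈) xb))

  independent-∈∈ : ∀ {a b} → Y a → Y b → ¬ Independent merged a b
  independent-∈∈ a∈ b∈ ab = ab (cross-∈∈ a∈ b∈)

-- Covers

record MergedPositroid {n} (N : Coll n) (x y : Fin n) : Set₁ where
  field
    bases      : Coll n
    isPositroid : IsPositroid n 2 bases
    adj-∉∉     : ∀ {a b} → ¬ Parallel (Adj N) y a → ¬ Parallel (Adj N) y b → Adj bases a b ⇔ Adj N a b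
    adj-∈∉     : ∀ {a b} → Parallel (Adj N) y a → ¬ Parallel (Adj N) y b → Adj bases a b ⇔ Adj N x b
    adj-∈∈     : ∀ {a b} → Parallel (Adj N) y a → Parallel (Adj N) y b → ¬ Adj bases a b

module _ {n} {N : Coll n} (rank2 : Rank2 N) {z x y : Fin n} where
  open Rank2 rank2

  private
    pos = position z
    V = twist z vectors

    V⇔ : ∀ {a b} → Independent V a b ⇔ Independent vectors a b
    V⇔ {a} {b} = twist-independent z {vectors} {a} {b}

    from-V : ∀ {a b} → Independent V a b → Adj N a b
    from-V {a} {b} = ind⇒adj {a} {b} ∘ Equivalence.to (V⇔ {a} {b})

    to-V : ∀ {a b} → Adj N a b → Independent V a b
    to-V {a} {b} = Equivalence.from (V⇔ {a} {b}) ∘ adj⇒ind {a} {b}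

    V-ordered : Ordered pos V
    V-ordered = twist-ordered z ordered

    nc : Noncrossing pos (Adj N)
    nc = noncrossing {V = V} V-ordered (λ {a} {b} → V⇔ {a} {b})

    Y = Parallel (Adj N) y

    Y⇒V : ∀ {q} → Y q → Parallel (Independent V) y q
    Y⇒V {q} ((t , qt) , ¬qy) = (t , to-V qt) , ¬qy ∘ from-V {q} {y}

    V⇒Y : ∀ {q} → Parallel (Independent V) y q → Y q
    V⇒Y {q} ((t , qt) , ¬qy) = (t , from-V {q} {t} qt) , ¬qy ∘ to-V

  -- Since z is first in <_z and not parallel to y, noncrossing makes the class of y an interval of <_z.
  merge : Adj N z y → Adj N x y → pos x < pos y →
    (∀ w → ∃ (Adj N w) → pos x < pos w → ¬ pos w < pos y) →
    ∀ {t} → ¬ Y t → Adj N x t → MergedPositroid N x y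
  merge zy xy x<y adjacent {t} t∉Y xt = record
    { bases = PairsOf (Independent merged)
    ; isPositroid = IsPositroid-resp-≐ untwist≐ (independent-isPositroid {V = twist z merged} (untwist-ordered z merged-ordered)
        (x , t , Equivalence.from (twist-independent z {merged} {x} {t}) merged-xt))
    ; adj-∉∉ = λ {a} {b} a∉ b∉ → mk⇔
        (λ ab → from-V {a} {b} (Equivalence.to (independent-∉∉ {a} {b} (a∉ ∘ V⇒Y) (b∉ ∘ V⇒Y)) (PairsOf-pair M-simple {a} {b} ab)))
        (λ ab → a , b , refl , Equivalence.from (independent-∉∉ {a} {b} (a∉ ∘ V⇒Y) (b∉ ∘ V⇒Y)) (to-V ab))
    ; adj-∈∉ = λ {a} {b} a∈ b∉ → mk⇔
        (λ ab → from-V {x} {b} (Equivalence.to (independent-∈∉ {a} {b} (Y⇒V a∈) (b∉ ∘ V⇒Y)) (PairsOf-pair M-simple {a} {b} ab)))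
        (λ xb → a , b , refl , Equivalence.from (independent-∈∉ {a} {b} (Y⇒V a∈) (b∉ ∘ V⇒Y)) (to-V xb))
    ; adj-∈∈ = λ {a} {b} a∈ b∈ ab → independent-∈∈ {a} {b} (Y⇒V a∈) (Y⇒V b∈) (PairsOf-pair M-simple {a} {b} ab)
    }
    where
    -- An element q of the class before x would stand in the order z, q, x, y; noncrossing applied
    -- to z q and x y then makes q independent of y.
    after : ∀ {q} → Y q → pos x < pos q
    after {q} ((_ , qt) , ¬qy) with ℕ.<-cmp (pos q) (pos x)
    ... | tri> _ _ x<q = x<q
    ... | tri≈ _ q≡x _ = ⊥-elim (¬qy (subst (λ c → Adj N c y) (sym (position-injective z q≡x)) xy))
    ... | tri< q<x _ _ = ⊥-elim (¬qy (proj₂ (nc (position-min z (adj⇒≢ zq)) q<x x<y zq xy)))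
      where
      zq : Adj N z q
      zq = symm (par-trans (symm zy) (¬qy ∘ symm) qt)
    convex : ∀ {w q} → Y q → ∃ (Adj N w) → pos x < pos w → pos w < pos q → Y w
    convex {w} {q} ((_ , qt) , ¬qy) w-nonloop x<w w<q = w-nonloop , not-adjacent
      where
      not-adjacent : ¬ Adj N w y
      not-adjacent wy with ℕ.<-cmp (pos w) (pos y)
      ... | tri< w<y _ _ = adjacent w w-nonloop x<w w<y
      ... | tri≈ _ w≡y _ = adj⇒≢ wy (position-injective z w≡y)
      -- In the order z, y, w, q the pairs z y and w q force y and q to be independent.
      ... | tri> _ _ y<w = ¬qy (symm (proj₂ (nc (position-min z (adj⇒≢ zy)) y<w w<q zy
        (symm (par-trans (symm wy) (¬qy ∘ symm) qt)))))
    after-V : ∀ {q} → Parallel (Independent V) y q → pos x < pos q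
    after-V {q} q∈ = after (V⇒Y {q} q∈)
    convex-V : ∀ {w q} → Parallel (Independent V) y q → ∃ (Independent V w) → pos x < pos w → pos w < pos q →
      Parallel (Independent V) y w
    convex-V {w} {q} q∈ (s , ws) x<w w<q = Y⇒V (convex (V⇒Y {q} q∈) (s , from-V {w} {s} ws) x<w w<q)
    open Merge pos (position-injective z) V V-ordered {x} {y} (to-V xy) (λ {q} → after-V {q}) (λ {w} {q} → convex-V {w} {q})
    M-simple = independent-simple merged
    x∉Y : ¬ Y x
    x∉Y (_ , ¬xy) = ¬xy xy
    -- The pair x t is not touched by the merging and keeps the rank equal to 2.
    merged-xt : Independent merged x t
    merged-xt = Equivalence.from (independent-∉∉ {x} {t} (x∉Y ∘ V⇒Y) (t∉Y ∘ V⇒Y)) (to-V xt)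
    untwist≐ : PairsOf (Independent (twist z merged)) ≐ᶜ PairsOf (Independent merged)
    untwist≐ B = mk⇔
      (λ { (a , b , eq , ab) → a , b , eq , Equivalence.to (twist-independent z {merged} {a} {b}) ab })
      (λ { (a , b , eq , ab) → a , b , eq , Equivalence.from (twist-independent z {merged} {a} {b}) ab })

parallel⇒¬adj : ∀ {n} {E : Fin n → Fin n → Set} → Simple E → ∀ {y a b} → ∃ (E y) →
  Parallel E y a → Parallel E y b → ¬ E a b
parallel⇒¬adj simple (_ , yt) (_ , ¬ay) (_ , ¬by) ab = ¬ay (symm (par-trans (symm ab) ¬by yt))
  where open Simple simple

descend : ∀ {A : Set} {P Q : A → Set} (m : A → ℕ) → (∀ a → P a → Q a ⊎ ∃[ b ] (P b × m b < m a)) →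
  ∀ a → P a → ∃[ c ] (P c × Q c)
descend {A} {P} {Q} m step a pa = go (suc (m a)) a pa ℕ.≤-refl
  where
  go : ∀ bound a → P a → m a < bound → ∃[ c ] (P c × Q c)
  go (suc bound) a pa (s≤s ma≤) with step a pa
  ... | inj₁ qa = a , pa , qa
  ... | inj₂ (b , pb , mb<ma) = go bound b pb (ℕ.<-≤-trans mb<ma ma≤)

swap-card-≥ : ∀ {n} (J : Subset n) x y → y ∉ J → ∣ J ∣ ≤ ∣ swap J x y ∣
swap-card-≥ J x y y∉J = card-≤ J (swap J x y) (λ a b → (a ≢ x × b ≡ a) ⊎ (a ≡ x × b ≡ y)) total
  (λ { a∈ b∈ (inj₁ (_ , refl)) (inj₁ (_ , refl)) → refl
     ; a∈ b∈ (inj₁ (_ , refl)) (inj₂ (_ , refl)) → ⊥-elim (y∉J a∈)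
     ; a∈ b∈ (inj₂ (_ , refl)) (inj₁ (_ , refl)) → ⊥-elim (y∉J b∈)
     ; a∈ b∈ (inj₂ (refl , _)) (inj₂ (refl , _)) → refl })
  where
  total : ∀ a → a ∈ J → ∃[ b ] b ∈ swap J x y × ((a ≢ x × b ≡ a) ⊎ (a ≡ x × b ≡ y))
  total a a∈ with a Fin.≟ x
  ... | yes a≡x = y , ∈swap-new , inj₂ (a≡x , refl)
  ... | no a≢x  = a , ∈swap-old a≢x a∈ , inj₁ (a≢x , refl)

adj-⊆ : ∀ {n} {M O : Coll n} → Rank2 M → (∀ {a b} → Adj M a b → Adj O a b) → M ⊆ᶜ O
adj-⊆ rank2 sub B MB with Rank2.isPair rank2 MB
... | a , b , refl , ab = sub ab

-- `gap` speaks of all rank 2 positroids, which is the covering condition of the poset once upward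
-- closure puts everything above N into it.
module Cover {n} {N N′ : Coll n} (rank2 : Rank2 N) (rank2′ : Rank2 N′) (N⊆N′ : N ⊆ᶜ N′) (N′⊈N : ¬ (N′ ⊆ᶜ N))
  (gap : ∀ M → IsPositroid n 2 M → N ⊆ᶜ M → M ⊆ᶜ N′ → ¬ (N′ ⊆ᶜ M) → ¬ ¬ (M ⊆ᶜ N))
  (D : Description N) (D′ : Description N′) where

  private
    module R = Rank2 rank2
    module R′ = Rank2 rank2′
    L = Description.L D
    L′ = Description.L D′
    p = ∣ representatives rank2 D ∣
    p′ = ∣ representatives rank2′ D′ ∣

    E E′ : Fin n → Fin n → Set
    E = Adj N
    E′ = Adj N′

    E⇒E′ : ∀ {a b} → E a b → E′ a b
    E⇒E′ = N⊆N′ _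

    -- The pair s t shows that M is properly below N′, so M ⊆ N cannot be refuted; since adjacency
    -- in N is decidable, this suffices for each pair.
    squeeze : ∀ M → IsPositroid n 2 M → (∀ {a b} → E a b → Adj M a b) → (∀ {a b} → Adj M a b → E′ a b) →
      ∀ {s t} → E′ s t → ¬ Adj M s t → ∀ {a b} → Adj M a b → E a b
    squeeze M M-pos sub sup {s} {t} st ¬st {a} {b} ab = decidable-stable (R.adj? a b)
      (λ ¬ab → gap M M-pos (adj-⊆ rank2 sub) (adj-⊆ (positroid⇒rank2 M-pos) sup)
        (λ N′⊆M → ¬st (N′⊆M _ st)) (λ M⊆N → ¬ab (M⊆N _ ab)))

    ∉L-nonloop : ∀ {a} → a ∉ L → ∃ (E a)
    ∉L-nonloop = ∉L⇒nonloop rank2 D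

    ∉L′-nonloop : ∀ {a} → a ∉ L′ → ∃ (E′ a)
    ∉L′-nonloop = ∉L⇒nonloop rank2′ D′

    L′⊆L : L′ ⊆ L
    L′⊆L {a} a∈L′ = loop⇒∈L rank2 D (λ (b , ab) → ∈L⇒loop rank2′ D′ a∈L′ (b , E⇒E′ ab))

  -- Making x a loop of N′ gives a positroid between N and N′, which must be N.
  module LoopInClass {x y} (x∈L : x ∈ L) (x∉L′ : x ∉ L′) (y≢x : y ≢ x) (y∉L′ : y ∉ L′) (¬xy : ¬ E′ x y) where
    private
      V = deleted R′.vectors x
      M = PairsOf (Independent V)

      E-avoids : ∀ {a b} → E a b → a ≢ x × b ≢ x
      E-avoids ab = (λ { refl → ∈L⇒loop rank2 D x∈L (_ , ab) }) , (λ { refl → ∈L⇒loop rank2 D x∈L (_ , R.symm ab) })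

      to-M : ∀ {a b} → E′ a b → a ≢ x → b ≢ x → Adj M a b
      to-M {a} {b} ab a≢x b≢x = a , b , refl ,
        Equivalence.from (deleted-independent R′.vectors x {a} {b}) (R′.adj⇒ind ab , a≢x , b≢x)

      from-M : ∀ {a b} → Adj M a b → E′ a b × a ≢ x × b ≢ x
      from-M {a} {b} ab = Product.map₁ (R′.ind⇒adj {a} {b})
        (Equivalence.to (deleted-independent R′.vectors x {a} {b}) (PairsOf-pair (independent-simple V) {a} {b} ab))

      sub : ∀ {a b} → E a b → Adj M a b
      sub ab = to-M (E⇒E′ ab) (proj₁ (E-avoids ab)) (proj₂ (E-avoids ab))

      M-pos : IsPositroid n 2 M
      M-pos = independent-isPositroid {V = V} (deleted-ordered R′.vectors x R′.ordered)
        (let a , b , ab = R.basis in a , b , PairsOf-pair (independent-simple V) {a} {b} (sub ab))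

      x-nonloop = ∉L′-nonloop x∉L′

      E⇐ : ∀ {a b} → E′ a b → a ≢ x → b ≢ x → E a b
      E⇐ ab a≢x b≢x = squeeze M M-pos sub (proj₁ ∘ from-M) (proj₂ x-nonloop)
        (λ xt → proj₁ (proj₂ (from-M xt)) refl) (to-M ab a≢x b≢x)

      -- The nonloop y is parallel to x in N′, so losing x turns no other element into a loop and y
      -- can represent the class of x.
      x⇒y : ∀ {a} → E′ a x → E′ a y
      x⇒y ax = R′.symm (R′.par-trans (R′.symm ax) ¬xy (proj₂ (∉L′-nonloop y∉L′)))

      nonloop : ∀ {a} → a ≢ x → a ∉ L′ → ∃ (E a)
      nonloop {a} a≢x a∉L′ with ∉L′-nonloop a∉L′
      ... | b , ab with b Fin.≟ x
      ...   | no b≢x   = b , E⇐ ab a≢x b≢x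
      ...   | yes refl = y , E⇐ (x⇒y ab) a≢x y≢x

    loops-card : ∣ L ∣ ≡ suc ∣ L′ ∣
    loops-card = trans (cong ∣_∣ (⊆-antisym to from)) (∪⁅⁆-card L′ x x∉L′)
      where
      to : L ⊆ L′ ∪ ⁅ x ⁆
      to {a} a∈L with a ∈? L′ | a Fin.≟ x
      ... | yes a∈L′ | _        = ∈∪⁅⁆-old a∈L′
      ... | no _     | yes refl = ∈∪⁅⁆-new
      ... | no a∉L′  | no a≢x   = ⊥-elim (∈L⇒loop rank2 D a∈L (nonloop a≢x a∉L′))
      from : L′ ∪ ⁅ x ⁆ ⊆ L
      from a∈ with ∈∪⁅⁆⁻ a∈
      ... | inj₁ a∈L′ = L′⊆L a∈L′
      ... | inj₂ refl = x∈L

    points-card : p ≡ p′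
    points-card = ℕ.≤-antisym p≤p′ p′≤p
      where
      J = representatives rank2 D
      J′ = representatives rank2′ D′
      J-free = representatives-clique rank2 D
      J′-free = representatives-clique rank2′ D′
      ∉L′ : ∀ {a} → a ∈ J′ → a ∉ L′
      ∉L′ a∈ a∈L′ = ∈L⇒loop rank2′ D′ a∈L′ (proj₂ J′-free a∈)
      p≤p′ : p ≤ p′
      p≤p′ = free-clique-card rank2′ D′
        ((λ a∈ b∈ a≢b → E⇒E′ (proj₁ J-free a∈ b∈ a≢b)) , λ a∈ → Product.map₂ E⇒E′ (proj₂ J-free a∈))
      p′≤p : p′ ≤ p
      p′≤p with x ∈? J′
      ... | no x∉J′ = free-clique-card rank2 D
        ((λ a∈ b∈ a≢b → E⇐ (proj₁ J′-free a∈ b∈ a≢b) (λ { refl → x∉J′ a∈ }) (λ { refl → x∉J′ b∈ })) ,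
         λ a∈ → nonloop (λ { refl → x∉J′ a∈ }) (∉L′ a∈))
      -- x represents its class in N′ but is a loop of N, so its parallel y is used instead.
      ... | yes x∈J′ = ℕ.≤-trans (swap-card-≥ J′ x y y∉J′) (free-clique-card rank2 D (swapped-clique , swapped-nonloop))
        where
        y∉J′ : y ∉ J′
        y∉J′ y∈J′ = ¬xy (proj₁ J′-free x∈J′ y∈J′ (≢-sym y≢x))
        with-y : ∀ {a} → a ≢ x → a ∈ J′ → E a y
        with-y a≢x a∈ = E⇐ (x⇒y (proj₁ J′-free a∈ x∈J′ a≢x)) a≢x y≢x
        swapped-clique : Clique E (swap J′ x y)
        swapped-clique a∈ b∈ a≢b with ∈swap⁻ a∈ | ∈swap⁻ b∈
        ... | inj₁ (a≢x , a∈J) | inj₁ (b≢x , b∈J) = E⇐ (proj₁ J′-free a∈J b∈J a≢b) a≢x b≢x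
        ... | inj₁ (a≢x , a∈J) | inj₂ refl = with-y a≢x a∈J
        ... | inj₂ refl | inj₁ (b≢x , b∈J) = R.symm (with-y b≢x b∈J)
        ... | inj₂ refl | inj₂ refl = ⊥-elim (a≢b refl)
        swapped-nonloop : ∀ {a} → a ∈ swap J′ x y → ∃ (E a)
        swapped-nonloop a∈ with ∈swap⁻ a∈
        ... | inj₁ (a≢x , a∈J) = nonloop a≢x (∉L′ a∈J)
        ... | inj₂ refl = nonloop y≢x y∉L′

  -- Merging always goes down from N′ and loses the pair x y. `sub∈∉` is what keeps N below the
  -- result, and the covering condition then identifies the result with N.
  module Merging {x y} (xy : E′ x y) (M : MergedPositroid N′ x y)
    (sub∈∉ : ∀ {a b} → Parallel E′ y a → ¬ Parallel E′ y b → E a b → E′ x b) where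
    open MergedPositroid M

    Y : Fin n → Set
    Y = Parallel E′ y

    Y? : ∀ q → Dec (Y q)
    Y? q = R′.nonloop? q ×-dec ¬? (R′.adj? q y)

    x∉Y : ¬ Y x
    x∉Y (_ , ¬xy) = ¬xy xy

    y∈Y : Y y
    y∈Y = (x , R′.symm xy) , R′.irrefl

    private
      M-simple = Rank2.simple (positroid⇒rank2 isPositroid)

      not-both : ∀ {a b} → Y a → Y b → ¬ E′ a b
      not-both = parallel⇒¬adj R′.simple (proj₁ y∈Y)

      sub : ∀ {a b} → E a b → Adj bases a b
      sub {a} {b} ab with Y? a | Y? b
      ... | yes a∈ | yes b∈ = ⊥-elim (not-both a∈ b∈ (E⇒E′ ab))
      ... | yes a∈ | no b∉  = Equivalence.from (adj-∈∉ a∈ b∉) (sub∈∉ a∈ b∉ ab)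
      ... | no a∉  | yes b∈ = Simple.symm M-simple (Equivalence.from (adj-∈∉ b∈ a∉) (sub∈∉ b∈ a∉ (R.symm ab)))
      ... | no a∉  | no b∉  = Equivalence.from (adj-∉∉ a∉ b∉) (E⇒E′ ab)

      sup∈∉ : ∀ {a b} → Y a → ¬ Y b → Adj bases a b → E′ a b
      sup∈∉ {a} {b} a∈@((_ , at) , ¬ay) b∉ ab = R′.par-trans (R′.symm by) (¬ay ∘ R′.symm) at
        where
        xb : E′ x b
        xb = Equivalence.to (adj-∈∉ a∈ b∉) ab
        by : E′ b y
        by = decidable-stable (R′.adj? b y) (λ ¬by → b∉ ((x , R′.symm xb) , ¬by))

      sup : ∀ {a b} → Adj bases a b → E′ a b
      sup {a} {b} ab with Y? a | Y? b
      ... | yes a∈ | yes b∈ = ⊥-elim (adj-∈∈ a∈ b∈ ab)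
      ... | yes a∈ | no b∉  = sup∈∉ a∈ b∉ ab
      ... | no a∉  | yes b∈ = R′.symm (sup∈∉ b∈ a∉ (Simple.symm M-simple ab))
      ... | no a∉  | no b∉  = Equivalence.to (adj-∉∉ a∉ b∉) ab

    merged⇒E : ∀ {a b} → Adj bases a b → E a b
    merged⇒E = squeeze bases isPositroid sub sup (R′.symm xy)
      (λ yx → R′.irrefl (Equivalence.to (adj-∈∉ y∈Y x∉Y) yx))

    E⇒merged : ∀ {a b} → E a b → Adj bases a b
    E⇒merged = sub

    merged-∉∉⁺ : ∀ {a b} → ¬ Y a → ¬ Y b → E′ a b → E a b
    merged-∉∉⁺ a∉ b∉ ab = merged⇒E (Equivalence.from (adj-∉∉ a∉ b∉) ab)

  nonloop′⇒∉L′ : ∀ {a} → ∃ (E′ a) → a ∉ L′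
  nonloop′⇒∉L′ nonloop a∈L′ = ∈L⇒loop rank2′ D′ a∈L′ nonloop

  private
    between? : ∀ z x y → Dec (∃[ w ] (∃ (E′ w) × position z x < position z w × position z w < position z y))
    between? z x y = Fin.any? (λ w → R′.nonloop? w ×-dec (position z x ℕ.<? position z w) ×-dec (position z w ℕ.<? position z y))

    Adjacent : Fin n → Fin n → Fin n → Set
    Adjacent z x y = ∀ w → ∃ (E′ w) → position z x < position z w → ¬ position z w < position z y

  -- Otherwise merging x with its successor in N′ would give a positroid strictly between N and N′.
  no-lone-loop : ∀ {x} → x ∈ L → x ∉ L′ → ¬ (∀ y → y ≢ x → y ∉ L′ → E′ x y)
  no-lone-loop {x} x∈L x∉L′ lone with descend {P = E′ x} {Q = Adjacent x x} (position x) step _ (proj₂ (∉L′-nonloop x∉L′))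
    where
    step : ∀ y → E′ x y → Adjacent x x y ⊎ ∃[ w ] (E′ x w × position x w < position x y)
    step y xy with between? x x y
    ... | no ¬between = inj₁ (λ w w-nonloop x<w w<y → ¬between (w , w-nonloop , x<w , w<y))
    ... | yes (w , w-nonloop , x<w , w<y) = inj₂ (w , lone w (λ { refl → ℕ.<-irrefl refl x<w }) (nonloop′⇒∉L′ w-nonloop) , w<y)
  ... | y , xy , adjacent with R.basis
  -- The merged positroid is N, yet it keeps the pair x t, so x would be a nonloop of N.
  ...   | c , d , cd = ∈L⇒loop rank2 D x∈L (third .proj₁ ,
            merged⇒E (Equivalence.from (adj-∉∉ x∉Y (proj₁ (proj₂ third))) (proj₂ (proj₂ third))))
    where
    joins-x : ∀ {a b} → E a b → E′ x a
    joins-x {a} {b} ab = lone a (λ { refl → ∈L⇒loop rank2 D x∈L (b , ab) }) (nonloop′⇒∉L′ (b , E⇒E′ ab))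
    -- Being independent, c and d are not both parallel to y; the one outside the class of y serves
    -- as t.
    third : ∃[ t ] (¬ Parallel E′ y t × E′ x t)
    third with R′.adj? c y
    ... | yes cy = c , (λ (_ , ¬cy) → ¬cy cy) , joins-x cd
    ... | no ¬cy = d , (λ d∈Y → parallel⇒¬adj R′.simple (x , R′.symm xy) ((d , E⇒E′ cd) , ¬cy) d∈Y (E⇒E′ cd)) ,
      joins-x (R.symm cd)
    M : MergedPositroid N′ x y
    M = merge rank2′ {z = x} xy xy (position-min x (R′.adj⇒≢ xy)) adjacent (proj₁ (proj₂ third)) (proj₂ (proj₂ third))
    open MergedPositroid M
    sub∈∉ : ∀ {a b} → Parallel E′ y a → ¬ Parallel E′ y b → E a b → E′ x b
    sub∈∉ _ _ ab = joins-x (R.symm ab)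
    open Merging xy M sub∈∉

  -- N is N′ with two cyclically adjacent classes merged.
  module SameLoops (L⊆L′ : L ⊆ L′) where

    nonloop : ∀ {a} → ∃ (E′ a) → ∃ (E a)
    nonloop a-nonloop = ∉L-nonloop (nonloop′⇒∉L′ a-nonloop ∘ L⊆L′)

    loops-card : ∣ L ∣ ≡ ∣ L′ ∣
    loops-card = cong ∣_∣ (⊆-antisym L⊆L′ L′⊆L)

    private
      split-pair : ∃[ u ] ∃[ v ] (E′ u v × ¬ E u v)
      split-pair with Fin.any? (λ u → Fin.any? (λ v → R′.adj? u v ×-dec ¬? (R.adj? u v)))
      ... | yes found = found
      ... | no none = ⊥-elim (N′⊈N (adj-⊆ rank2′
        (λ {a} {b} ab → decidable-stable (R.adj? a b) (λ ¬ab → none (a , b , ab , ¬ab)))))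

      -- x and y are parallel in N but not in N′. The cyclic order is cut at an element z outside
      -- their common class in N, so that this class does not wrap around.
      Split : Fin n → Fin n × Fin n → Set
      Split z (x , y) = position z x < position z y × E′ x y × ¬ E x y × E z x

      split-start : ∃[ z ] ∃[ xy ] Split z xy
      split-start with split-pair
      ... | u , v , uv , ¬uv with nonloop (v , uv)
      ...   | z , uz with ℕ.<-cmp (position z u) (position z v)
      ...     | tri< u<v _ _ = z , (u , v) , u<v , uv , ¬uv , R.symm uz
      ...     | tri≈ _ u≡v _ = ⊥-elim (R′.adj⇒≢ uv (position-injective z u≡v))
      ...     | tri> _ _ v<u = z , (v , u) , v<u , R′.symm uv , ¬uv ∘ R.symm ,
                  R.symm (R.par-trans uz ¬uv (proj₂ (nonloop (u , R′.symm uv))))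

      -- A nonloop w between x and y is parallel to both in N, and N′ separates it from one of them.
      -- This gives a split pair at smaller distance.
      step : ∀ z xy → Split z xy → Adjacent z (proj₁ xy) (proj₂ xy) ⊎
        ∃[ xy′ ] (Split z xy′ × position z (proj₂ xy′) ∸ position z (proj₁ xy′) < position z (proj₂ xy) ∸ position z (proj₁ xy))
      step z (x , y) (x<y , xy , ¬xy , zx) with between? z x y
      ... | no ¬between = inj₁ (λ w w-nonloop x<w w<y → ¬between (w , w-nonloop , x<w , w<y))
      ... | yes (w , w-nonloop , x<w , w<y) = inj₂ closer
        where
        nc : Noncrossing (position z) E
        nc = R.noncrossing {V = twist z R.vectors} (twist-ordered z R.ordered)
          (λ {a} {b} → twist-independent z {R.vectors} {a} {b})
        y-nonloop = nonloop (x , R′.symm xy)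
        x-nonloop = nonloop (y , xy)
        -- If x and w were independent in N, so would be w and y; then z, x, w, y in this order
        -- would force x and y to be independent.
        ¬xw : ¬ E x w
        ¬xw xw = ¬xy (proj₂ (nc (position-min z (R.adj⇒≢ zx)) x<w w<y zx (R.symm (R.par-trans xw ¬xy (proj₂ y-nonloop)))))
        zw : E z w
        zw = R.symm (R.par-trans (R.symm zx) ¬xw (proj₂ (nonloop w-nonloop)))
        ¬wy : ¬ E w y
        ¬wy wy = ¬xw (R.par-trans (R.symm wy) (¬xy ∘ R.symm) (proj₂ x-nonloop))
        closer : ∃[ xy′ ] (Split z xy′ × position z (proj₂ xy′) ∸ position z (proj₁ xy′) < position z y ∸ position z x)
        closer with R′.triangle xy (proj₂ w-nonloop)
        ... | inj₁ wx = (x , w) , (x<w , R′.symm wx , ¬xw , zx) , ℕ.∸-monoˡ-< w<y (ℕ.<⇒≤ x<w)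
        ... | inj₂ wy = (w , y) , (w<y , wy , ¬wy , zw) , ℕ.∸-monoʳ-< x<w (ℕ.<⇒≤ w<y)

    private module AdjacentPair {z x y} (split : Split z (x , y)) (adjacent : Adjacent z x y) where
      x<y = proj₁ split
      xy = proj₁ (proj₂ split)
      ¬xy = proj₁ (proj₂ (proj₂ split))
      zx = proj₂ (proj₂ (proj₂ split))
      zy : E z y
      zy = R.symm (R.par-trans (R.symm zx) ¬xy (proj₂ (nonloop (x , R′.symm xy))))
      M : MergedPositroid N′ x y
      M = merge rank2′ {z = z} (E⇒E′ zy) xy x<y adjacent (λ (_ , ¬zy) → ¬zy (E⇒E′ zy)) (E⇒E′ (R.symm zx))
      open MergedPositroid M
      sub∈∉ : ∀ {a b} → Parallel E′ y a → ¬ Parallel E′ y b → E a b → E′ x b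
      sub∈∉ (_ , ¬ay) _ ab = E⇒E′ (R.par-trans
        (R.par-trans ab (¬ay ∘ E⇒E′) (proj₂ (nonloop (x , R′.symm xy)))) (¬xy ∘ R.symm) (proj₂ (nonloop (y , xy))))
      open Merging xy M sub∈∉
      J = representatives rank2 D
      J′ = representatives rank2′ D′
      J-clique = proj₁ (representatives-clique rank2 D)
      J-nonloop = proj₂ (representatives-clique rank2 D)
      J′-clique = proj₁ (representatives-clique rank2′ D′)
      J′-nonloop = proj₂ (representatives-clique rank2′ D′)

      extend : ∀ {t} → (∀ {a} → a ∈ J → E′ a t) → ∃ (E′ t) → suc p ≤ p′
      extend {t} joins t-nonloop = subst (_≤ p′) (∪⁅⁆-card J t (λ t∈J → R′.irrefl (joins t∈J)))
        (free-clique-card rank2′ D′ (clique , nonloops))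
        where
        clique : Clique E′ (J ∪ ⁅ t ⁆)
        clique a∈ b∈ a≢b with ∈∪⁅⁆⁻ a∈ | ∈∪⁅⁆⁻ b∈
        ... | inj₁ a∈J  | inj₁ b∈J  = E⇒E′ (J-clique a∈J b∈J a≢b)
        ... | inj₁ a∈J  | inj₂ refl = joins a∈J
        ... | inj₂ refl | inj₁ b∈J  = R′.symm (joins b∈J)
        ... | inj₂ refl | inj₂ refl = ⊥-elim (a≢b refl)
        nonloops : ∀ {a} → a ∈ J ∪ ⁅ t ⁆ → ∃ (E′ a)
        nonloops a∈ with ∈∪⁅⁆⁻ a∈
        ... | inj₁ a∈J  = Product.map₂ E⇒E′ (J-nonloop a∈J)
        ... | inj₂ refl = t-nonloop

      -- The representatives of N meet at most one half of the split class, and a point of the other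
      -- half can be added: y if none lies in the class of y, and x otherwise. In the latter case
      -- the others are independent of x in N′ because in N they are independent of j.
      1+p≤p′ : suc p ≤ p′
      1+p≤p′ with Fin.any? (λ j → (j ∈? J) ×-dec Y? j)
      ... | no J∩Y≡∅ = extend joins-y (x , R′.symm xy)
        where
        joins-y : ∀ {a} → a ∈ J → E′ a y
        joins-y {a} a∈ = decidable-stable (R′.adj? a y)
          (λ ¬ay → J∩Y≡∅ (a , a∈ , Product.map₂ E⇒E′ (J-nonloop a∈) , ¬ay))
      ... | yes (j , j∈J , j∈Y) = extend joins-x (y , xy)
        where
        j-nonparallel : ∀ {a} → a ∈ J → a ≢ j → ¬ Y a
        j-nonparallel a∈ a≢j a∈Y = parallel⇒¬adj R′.simple (x , R′.symm xy) a∈Y j∈Y (E⇒E′ (J-clique a∈ j∈J a≢j))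
        joins-x : ∀ {a} → a ∈ J → E′ a x
        joins-x {a} a∈ with a Fin.≟ j
        ... | yes refl = R′.par-trans (R′.symm xy) (proj₂ j∈Y ∘ R′.symm) (proj₂ (proj₁ j∈Y))
        ... | no a≢j = R′.symm (Equivalence.to (adj-∈∉ j∈Y (j-nonparallel a∈ a≢j))
          (E⇒merged (J-clique j∈J a∈ (≢-sym a≢j))))

      -- At most one representative of N′ lies in the class of y, and merging leaves all pairs
      -- outside that class unchanged.
      p′≤1+p : p′ ≤ suc p
      p′≤1+p = ℕ.≤-trans J′≤ (s≤s (free-clique-card rank2 D (clique , λ a∈ → nonloop (J′-nonloop (proj₁ (∈select⁻ kept? a∈))))))
        where
        kept? : ∀ a → Dec (a ∈ J′ × ¬ Y a)
        kept? a = (a ∈? J′) ×-dec ¬? (Y? a)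
        kept = select kept?
        clique : Clique E kept
        clique a∈ b∈ a≢b with ∈select⁻ kept? a∈ | ∈select⁻ kept? b∈
        ... | a∈J′ , a∉Y | b∈J′ , b∉Y = merged-∉∉⁺ a∉Y b∉Y (J′-clique a∈J′ b∈J′ a≢b)
        J′≤ : p′ ≤ suc ∣ kept ∣
        J′≤ with Fin.any? (λ j → (j ∈? J′) ×-dec Y? j)
        ... | no J′∩Y≡∅ = ℕ.m≤n⇒m≤1+n (p⊆q⇒∣p∣≤∣q∣ (λ {a} a∈ → ∈select⁺ kept? (a∈ , λ a∈Y → J′∩Y≡∅ (a , a∈ , a∈Y))))
        ... | yes (j , j∈J′ , j∈Y) = subst (p′ ≤_) (∪⁅⁆-card kept j (λ j∈ → proj₂ (∈select⁻ kept? j∈) j∈Y)) (p⊆q⇒∣p∣≤∣q∣ into)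
          where
          into : J′ ⊆ kept ∪ ⁅ j ⁆
          into {a} a∈ with a Fin.≟ j
          ... | yes refl = ∈∪⁅⁆-new
          ... | no a≢j = ∈∪⁅⁆-old (∈select⁺ kept? (a∈ , λ a∈Y →
            parallel⇒¬adj R′.simple (x , R′.symm xy) a∈Y j∈Y (J′-clique a∈ j∈J′ a≢j)))

    private
      AdjacentSplit : Fin n → Fin n × Fin n → Set
      AdjacentSplit z xy = Split z xy × Adjacent z (proj₁ xy) (proj₂ xy)

      close-up : ∀ z xy → Split z xy → ∃[ xy′ ] AdjacentSplit z xy′
      close-up z = descend {P = Split z} {Q = λ xy → Adjacent z (proj₁ xy) (proj₂ xy)}
        (λ xy → position z (proj₂ xy) ∸ position z (proj₁ xy)) (step z)

      count : ∀ z → ∃[ xy ] AdjacentSplit z xy → p′ ≡ suc p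
      count z (_ , split , adjacent) =
        ℕ.≤-antisym (AdjacentPair.p′≤1+p split adjacent) (AdjacentPair.1+p≤p′ split adjacent)

      count-from : ∃[ z ] ∃[ xy ] Split z xy → p′ ≡ suc p
      count-from (z , xy , split) = count z (close-up z xy split)

    points-card : p′ ≡ suc p
    points-card = count-from split-start

  -- The additive form of: p - |L| grows by one. Either the loops agree and p grows, or an element
  -- with a parallel in N′ ceases to be a loop and p stays; a new nonloop without parallels cannot
  -- occur.
  rank-step : p′ + ∣ L ∣ ≡ suc (p + ∣ L′ ∣)
  rank-step with Fin.any? (λ x → (x ∈? L) ×-dec ¬? (x ∈? L′))
  ... | no none = cong₂ _+_ points-card loops-card
    where
    L⊆L′ : L ⊆ L′
    L⊆L′ {x} x∈L = decidable-stable (x ∈? L′) (λ x∉L′ → none (x , x∈L , x∉L′))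
    open SameLoops L⊆L′
  ... | yes (x , x∈L , x∉L′)
    with Fin.any? (λ y → ¬? (y Fin.≟ x) ×-dec ¬? (y ∈? L′) ×-dec ¬? (R′.adj? x y))
  ...   | yes (y , y≢x , y∉L′ , ¬xy) = trans (cong₂ _+_ (sym points-card) loops-card) (ℕ.+-suc p ∣ L′ ∣)
    where open LoopInClass x∈L x∉L′ y≢x y∉L′ ¬xy
  ...   | no none = ⊥-elim (no-lone-loop x∈L x∉L′ (λ y y≢x y∉L′ →
            decidable-stable (R′.adj? x y) (λ ¬xy → none (y , y≢x , y∉L′ , ¬xy))))

-- Minimal and maximal elements, rank function

module _ {n k : ℕ} (k+2≤n : k + 2 ≤ n) where

  private
    InP⇒rank2 : ∀ {N} → InP n k N → Rank2 N
    InP⇒rank2 N∈P = positroid⇒rank2 (InP⇒positroid N∈P)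

  InP⇔eᴰ : ∀ N → IsPositroid n 2 N → (D : Description N) → InP n k N ⇔ (+ 0 ℤ.≤ eᴰ D k)
  InP⇔eᴰ N N-pos D = mk⇔
    (λ N∈P → Equivalence.to (clique-exists⇔eᴰ rank2 D k+2≤n) (InP⇒clique k+2≤n N∈P))
    (λ 0≤e → let J , clique , |J|+k≡n = Equivalence.from (clique-exists⇔eᴰ rank2 D k+2≤n) 0≤e
             in clique⇒InP k+2≤n N-pos J clique |J|+k≡n)
    where rank2 = positroid⇒rank2 N-pos

  -- Here |L| = k and p = n - k, so d = 2k + (n - k) - (n + k).
  minimal⇒dᴰ≡0 : ∀ N → MinimalInP n k N → (D : Description N) → dᴰ D k ≡ + 0
  minimal⇒dᴰ≡0 N N-min@(N∈P , _) D = compute (minimal⇒NoIntervals k+2≤n N N-min)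
    where
    rank2 = InP⇒rank2 N∈P
    open Description D using (L)
    open ℤ.+-*-Solver
    p = ∣ representatives rank2 D ∣
    compute : ∃[ L₀ ] (∣ L₀ ∣ ≡ k × N ≐ᶜ NoIntervals L₀) → dᴰ D k ≡ + 0
    compute (L₀ , |L₀|≡k , N≐) = begin
      dᴰ D k                          ≡⟨ dᴰ-formula rank2 D k ⟩
      + (2 * k + p) ℤ.- + (n + ∣ L ∣)  ≡⟨ cong₂ (λ m l → + (2 * k + p) ℤ.- + (m + l)) (sym p+k≡n) |L|≡k ⟩
      + (2 * k + p) ℤ.- + (p + k + k)  ≡⟨ cong (λ t → t ℤ.+ + p ℤ.- + (p + k + k)) (ℤ.pos-* 2 k) ⟩
      + 2 ℤ.* + k ℤ.+ + p ℤ.- (+ p ℤ.+ + k ℤ.+ + k)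
        ≡⟨ solve 2 (λ k p → con (+ 2) :* k :+ p :- (p :+ k :+ k) := con (+ 0)) refl (+ k) (+ p) ⟩
      + 0                             ∎
      where
      open ≡-Reasoning
      ∁L₀+k≡n : ∣ ∁ L₀ ∣ + k ≡ n
      ∁L₀+k≡n = trans (cong (λ m → ∣ ∁ L₀ ∣ + m) (sym |L₀|≡k)) (∣∁∣+∣∣≡n L₀)
      2≤∁L₀ : 2 ≤ ∣ ∁ L₀ ∣
      2≤∁L₀ = clique-size-≥2 {∣ ∁ L₀ ∣} ∁L₀+k≡n k+2≤n
      ∁L₀-clique : Clique (Adj N) (∁ L₀)
      ∁L₀-clique x∈ y∈ x≢y = Equivalence.from (N≐ _) (NoIntervals-pair x≢y (x∈∁p⇒x∉p x∈) (x∈∁p⇒x∉p y∈))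
      ∁L₀-free = clique≥2⇒free {E = Adj N} 2≤∁L₀ ∁L₀-clique
      nonloop⇒∉L₀ : ∀ {x} → ∃ (Adj N x) → x ∉ L₀
      nonloop⇒∉L₀ {x} (y , xy) = proj₂ (Equivalence.to (N≐ _) xy) x ∈pairˡ
      |L|≡k : ∣ L ∣ ≡ k
      |L|≡k = trans (cong ∣_∣ (⊆-antisym
        (λ {x} x∈L → decidable-stable (x ∈? L₀) (λ x∉L₀ → ∈L⇒loop rank2 D x∈L (proj₂ ∁L₀-free (x∉p⇒x∈∁p x∉L₀))))
        (λ x∈L₀ → loop⇒∈L rank2 D (λ nonloop → nonloop⇒∉L₀ nonloop x∈L₀)))) |L₀|≡k
      p+k≡n : p + k ≡ n
      p+k≡n = trans (cong (_+ k) (ℕ.≤-antisym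
        (p⊆q⇒∣p∣≤∣q∣ (x∉p⇒x∈∁p ∘ nonloop⇒∉L₀ ∘ proj₂ (representatives-clique rank2 D)))
        (free-clique-card rank2 D ∁L₀-free))) ∁L₀+k≡n

  -- The matroid is uniform without loops, so p = n and |L| = 0.
  maximal⇒dᴰ≡2k : ∀ N → MaximalInP n k N → (D : Description N) → dᴰ D k ≡ + (2 * k)
  maximal⇒dᴰ≡2k N N-max@(N∈P , _) D = begin
    dᴰ D k                          ≡⟨ dᴰ-formula rank2 D k ⟩
    + (2 * k + p) ℤ.- + (n + ∣ L ∣)  ≡⟨ cong₂ (λ m l → + (2 * k + m) ℤ.- + (n + l)) p≡n |L|≡0 ⟩
    + (2 * k) ℤ.+ + n ℤ.- (+ n ℤ.+ + 0)
      ≡⟨ solve 2 (λ d n → d :+ n :- (n :+ con (+ 0)) := d) refl (+ (2 * k)) (+ n) ⟩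
    + (2 * k)                       ∎
    where
    open ≡-Reasoning
    open ℤ.+-*-Solver
    open Data.Fin.Subset using (⊤; ⊥)
    rank2 = InP⇒rank2 N∈P
    open Description D using (L)
    p = ∣ representatives rank2 D ∣
    ⊤-free : FreeClique (Adj N) ⊤
    ⊤-free = clique≥2⇒free (ℕ.≤-trans (ℕ.m+n≤o⇒n≤o k k+2≤n) (ℕ.≤-reflexive (sym (Subset.∣⊤∣≡n n))))
      (λ _ _ → maximal⇒uniform k+2≤n N N-max)
    |L|≡0 : ∣ L ∣ ≡ 0
    |L|≡0 = trans (cong ∣_∣ (Subset.Empty-unique
      (λ { (x , x∈L) → ∈L⇒loop rank2 D x∈L (proj₂ ⊤-free Subset.∈⊤) }))) (Subset.∣⊥∣≡0 n)
    p≡n : p ≡ n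
    p≡n = ℕ.≤-antisym (Subset.∣p∣≤n (representatives rank2 D))
      (subst (_≤ p) (Subset.∣⊤∣≡n n) (free-clique-card rank2 D ⊤-free))

  cover⇒dᴰ : ∀ N N′ → CoversInP n k N N′ → (D : Description N) → (D′ : Description N′) → dᴰ D′ k ≡ dᴰ D k ℤ.+ + 1
  cover⇒dᴰ N N′ (N∈P , N′∈P , (N⊆N′ , N′⊈N) , no-between) D D′ = begin
    dᴰ D′ k                                      ≡⟨ dᴰ-formula rank2′ D′ k ⟩
    + (2 * k + p′) ℤ.- + (n + l′)                ≡⟨ cong (λ t → + (2 * k) ℤ.+ t ℤ.- + (n + l′)) p′≡ ⟩
    + (2 * k) ℤ.+ (+ 1 ℤ.+ (+ p ℤ.+ + l′) ℤ.- + l) ℤ.- (+ n ℤ.+ + l′)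
      ≡⟨ solve 5 (λ d p l l′ n → d :+ (con (+ 1) :+ (p :+ l′) :- l) :- (n :+ l′) := d :+ p :- (n :+ l) :+ con (+ 1))
           refl (+ (2 * k)) (+ p) (+ l) (+ l′) (+ n) ⟩
    + (2 * k + p) ℤ.- + (n + l) ℤ.+ + 1          ≡⟨ cong (ℤ._+ + 1) (sym (dᴰ-formula rank2 D k)) ⟩
    dᴰ D k ℤ.+ + 1                               ∎
    where
    open ≡-Reasoning
    open ℤ.+-*-Solver
    rank2 = InP⇒rank2 N∈P
    rank2′ = InP⇒rank2 N′∈P
    p = ∣ representatives rank2 D ∣
    p′ = ∣ representatives rank2′ D′ ∣
    l = ∣ Description.L D ∣
    l′ = ∣ Description.L D′ ∣
    p′+l : p′ + l ≡ suc (p + l′)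
    p′+l = Cover.rank-step rank2 rank2′ N⊆N′ N′⊈N
      (λ M M-pos N⊆M M⊆N′ N′⊈M M⊈N → no-between M (up-closed k+2≤n N M N∈P M-pos N⊆M) (N⊆M , M⊈N) (M⊆N′ , N′⊈M)) D D′
    p′≡ : + p′ ≡ + 1 ℤ.+ (+ p ℤ.+ + l′) ℤ.- + l
    p′≡ = trans (solve 2 (λ p l → p := (p :+ l) :- l) refl (+ p′) (+ l)) (cong (λ m → + m ℤ.- + l) p′+l)

  minimal⇒cᴰ≡2k : ∀ N → MinimalInP n k N → (D : Description N) → cᴰ D k ≡ + (2 * k)
  minimal⇒cᴰ≡2k N N-min D = trans (cong (λ t → + (2 * k) ℤ.- t) (minimal⇒dᴰ≡0 N N-min D)) (ℤ.+-identityʳ (+ (2 * k)))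

  maximal⇒cᴰ≡0 : ∀ N → MaximalInP n k N → (D : Description N) → cᴰ D k ≡ + 0
  maximal⇒cᴰ≡0 N N-max D = trans (cong (λ t → + (2 * k) ℤ.- t) (maximal⇒dᴰ≡2k N N-max D)) (ℤ.+-inverseʳ (+ (2 * k)))

  cover⇒cᴰ : ∀ N N′ → CoversInP n k N N′ → (D : Description N) → (D′ : Description N′) → cᴰ D k ≡ cᴰ D′ k ℤ.+ + 1
  cover⇒cᴰ N N′ cover D D′ = sym (trans (cong (λ t → + (2 * k) ℤ.- t ℤ.+ + 1) (cover⇒dᴰ N N′ cover D D′))
    (solve 2 (λ m d → m :- (d :+ con (+ 1)) :+ con (+ 1) := m :- d) refl (+ (2 * k)) (dᴰ D k)))
    where open ℤ.+-*-Solver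

theorem3p9 : ∀ (n k : ℕ) → 1 ≤ k → k + 2 ≤ n →
    ((∀ N N′ → InP n k N → IsPositroid n 2 N′ → N ⊆ᶜ N′ → InP n k N′)
    × (∀ N → MinimalInP n k N ⇔ (∃[ L ] (∣ L ∣ ≡ k × N ≐ᶜ NoIntervals L)))
    × (∀ (L L′ : Subset n) → ∣ L ∣ ≡ k → ∣ L′ ∣ ≡ k →
    NoIntervals L ≐ᶜ NoIntervals L′ → L ≡ L′))
    × (∀ N → IsPositroid n 2 N → (D : Description N) →
    InP n k N ⇔ (+ 0 ℤ.≤ eᴰ D k))
    × ((∀ N → MinimalInP n k N → (D : Description N) → dᴰ D k ≡ + 0)
    × (∀ N → MaximalInP n k N → (D : Description N) → dᴰ D k ≡ + (2 * k))
    × (∀ N N′ → CoversInP n k N N′ → (D : Description N) → (D′ : Description N′) →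
    dᴰ D′ k ≡ dᴰ D k ℤ.+ + 1)
    × (∀ N → MaximalInP n k N → (D : Description N) → cᴰ D k ≡ + 0)
    × (∀ N → MinimalInP n k N → (D : Description N) → cᴰ D k ≡ + (2 * k))
    × (∀ N N′ → CoversInP n k N N′ → (D : Description N) → (D′ : Description N′) →
    cᴰ D k ≡ cᴰ D′ k ℤ.+ + 1))
theorem3p9 n k _ k+2≤n =
  (up-closed k+2≤n ,
   (λ N → mk⇔ (minimal⇒NoIntervals k+2≤n N) (NoIntervals⇒minimal k+2≤n N)) ,
   NoIntervals-injective k+2≤n) ,
  InP⇔eᴰ k+2≤n ,
  minimal⇒dᴰ≡0 k+2≤n , maximal⇒dᴰ≡2k k+2≤n , cover⇒dᴰ k+2≤n ,
  maximal⇒cᴰ≡0 k+2≤n , minimal⇒cᴰ≡2k k+2≤n , cover⇒cᴰ k+2≤n
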